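{- Let $\mathbb{F}$ be a field, let $\Delta$ be a finite simplicial complex with $\operatorname{depth}_{\mathbb{F}}\Delta=d-1$, and let $r$ be an integer with $2\le r\le d/2$. Let $\mathcal{A},\mathcal{B}$ be nonempty Sperner families consisting of faces of $\Delta$, each face having at most $r$ vertices, such that $A\cap B\neq\emptyset$ for all $A\in\mathcal{A}$, $B\in\mathcal{B}$. If $\Delta$ is shifted with respect to $\{v_1<\cdots<v_r\}$, then \[|\mathcal{A}|+|\mathcal{B}|\le f_r(\Delta)-\gamma+1,\] where $\gamma$ is the number of $r$-element faces of $\Delta$ containing no element of $\{v_1,\dots,v_r\}$.
   Context: A simplicial complex is a finite nonempty family of sets closed under taking subsets; $f_k(\Delta)$ is the number of $k$-element faces. A Sperner family is a family of sets with no proper inclusions among its members. The link of a face $A$ is $\operatorname{link}_\Delta A=\{B\in\Delta: A\cap B=\emptyset,\ A\cup B\in\Delta\}$. $\Delta$ is Cohen-Macaulay over $\mathbb{F}$ if $\tilde H_i(\operatorname{link}_\Delta A;\mathbb{F})=0$ for all $A\in\Delta$ and $i<\dim\operatorname{link}_\Delta A$ (where $\dim A=|A|-1$); $\operatorname{depth}_{\mathbb{F}}\Delta$ is the largest $k$ such that the subcomplex of faces of dimension at most $k$ is Cohen-Macaulay over $\mathbb{F}$. $\Delta$ is shifted with respect to $\{v_1<\cdots<v_t\}$ if for every $i$, every vertex $w\notin\{v_1,\dots,v_i\}$ and every face $B$ with $w\in B$, $v_i\notin B$, also $(B\setminus\{w\})\cup\{v_i\}\in\Delta$. -}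

module Defs where

open import Level using (Level; _⊔_) renaming (suc to lsuc)
open import Data.Bool using (Bool; true; false; _∧_; not; if_then_else_)
import Data.Bool.ListAction
open import Data.Nat using (ℕ; zero; suc; _≤_; _<_) renaming (_+_ to _+ℕ_)
open import Data.Nat.Base using (_%_)
open import Data.Fin using (Fin; zero; suc)
open import Data.Fin.Subset using (Subset; _∪_; _∩_; ⁅_⁆; ∣_∣; _⊆_; Nonempty)
open import Data.Vec using (Vec; []; _∷_; lookup)
open import Data.List using (List; []; _∷_; _++_; map; length; filterᵇ; foldr; allFin)
open import Data.List.Membership.Propositional using (_∈_)
open import Data.List.Relation.Unary.Unique.Propositional using (Unique)
open import Data.Product using (Σ; ∃; _×_; _,_)
open import Data.Sum using (_⊎_)
open import Relation.Nullary using (¬_)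
open import Relation.Binary.PropositionalEquality using (_≡_; _≢_)
open import Algebra.Bundles using (CommutativeRing)

record Field (c ℓ : Level) : Set (lsuc (c ⊔ ℓ)) where
  field
    commutativeRing : CommutativeRing c ℓ
  open CommutativeRing commutativeRing public
  field
    0≉1     : ¬ (0# ≈ 1#)
    inverse : ∀ x → ¬ (x ≈ 0#) → Σ Carrier λ y → x * y ≈ 1#

allSubsets : ∀ n → List (Subset n)
allSubsets zero    = [] ∷ []
allSubsets (suc n) = map (false ∷_) (allSubsets n) ++ map (true ∷_) (allSubsets n)

disjointᵇ : ∀ {n} → Subset n → Subset n → Bool
disjointᵇ []      []      = true
disjointᵇ (x ∷ a) (y ∷ b) = not (x ∧ y) ∧ disjointᵇ a b

countBelow : ∀ {n} → Subset n → Fin n → ℕ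
countBelow (x ∷ σ) zero    = 0
countBelow (x ∷ σ) (suc v) = (if x then 1 else 0) +ℕ countBelow σ v

record SimplicialComplex (n : ℕ) : Set where
  field
    face     : Subset n → Bool
    nonempty : Σ (Subset n) λ σ → face σ ≡ true
    closed   : ∀ {σ τ} → σ ⊆ τ → face τ ≡ true → face σ ≡ true
open SimplicialComplex public

infix 4 _∈Δ_
_∈Δ_ : ∀ {n} → Subset n → SimplicialComplex n → Set
σ ∈Δ Δ = face Δ σ ≡ true

fCount : ∀ {n} → SimplicialComplex n → ℕ → ℕ
fCount {n} Δ k = length (filterᵇ (λ σ → face Δ σ ∧ (∣ σ ∣ Data.Nat.≡ᵇ k)) (allSubsets n))

-- Reduced simplicial homology over a field, computed for a complex
-- given by a Boolean face predicate L on subsets of Fin n.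
-- A (k-1)-chain (supported on k-element faces) is any function
-- Subset n → F; only its values on k-element faces of L matter.
-- Boundary, written pointwise (standard orientation by the order of Fin n):
--   (∂ c)(σ) = Σ_{v ∉ σ, σ ∪ {v} ∈ L} (-1)^{#{u ∈ σ : u < v}} c(σ ∪ {v}).

module Homology {c ℓ : Level} (F : Field c ℓ) {n : ℕ} (L : Subset n → Bool) where
  open Field F

  sgn : ℕ → Carrier → Carrier
  sgn m x = if (m % 2 Data.Nat.≡ᵇ 0) then x else - x

  ∂ : (Subset n → Carrier) → Subset n → Carrier
  ∂ ch σ = foldr _+_ 0#
    (map (λ v → if not (lookup σ v) ∧ L (σ ∪ ⁅ v ⁆)
                 then sgn (countBelow σ v) (ch (σ ∪ ⁅ v ⁆)) else 0#)
         (allFin n))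

  -- H̃_{k-1}(L; F) = 0, for k-element faces (k = 0 gives H̃_{-1})
  HomologyVanishes : ℕ → Set (c ⊔ ℓ)
  HomologyVanishes k =
    ∀ (z : Subset n → Carrier) →
    (∀ σ → L σ ≡ true → suc ∣ σ ∣ ≡ k → ∂ z σ ≈ 0#) →
    Σ (Subset n → Carrier) λ b → ∀ τ → L τ ≡ true → ∣ τ ∣ ≡ k → ∂ b τ ≈ z τ

  -- H̃_i(L) = 0 for all i < dim L, i.e. H̃_{k-1} = 0 whenever L has a face
  -- with more than k elements.
  AcyclicBelowDim : Set (c ⊔ ℓ)
  AcyclicBelowDim = ∀ k → Σ (Subset n) (λ τ → L τ ≡ true × k < ∣ τ ∣) → HomologyVanishes k

linkᵇ : ∀ {n} → (Subset n → Bool) → Subset n → Subset n → Bool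
linkᵇ L A B = disjointᵇ A B ∧ L (A ∪ B)

CohenMacaulay : ∀ {c ℓ} → Field c ℓ → ∀ {n} → (Subset n → Bool) → Set (c ⊔ ℓ)
CohenMacaulay F {n} L = ∀ A → L A ≡ true → Homology.AcyclicBelowDim F (linkᵇ L A)

-- faces with at most s elements (the (s-1)-skeleton)
skeletonᵇ : ∀ {n} → SimplicialComplex n → ℕ → Subset n → Bool
skeletonᵇ Δ s σ = face Δ σ ∧ (∣ σ ∣ Data.Nat.≤ᵇ s)

-- depth_F Δ = d - 1 : the largest k ≤ dim Δ with the k-skeleton (faces of
-- at most k+1 elements) Cohen-Macaulay is k = d - 1.
DepthIs : ∀ {c ℓ} → Field c ℓ → ∀ {n} → SimplicialComplex n → ℕ → Set (c ⊔ ℓ)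
DepthIs F Δ d =
  Σ _ (λ σ → σ ∈Δ Δ × d ≤ ∣ σ ∣) ×
  CohenMacaulay F (skeletonᵇ Δ d) ×
  ((∀ σ → σ ∈Δ Δ → ∣ σ ∣ ≤ d) ⊎ ¬ CohenMacaulay F (skeletonᵇ Δ (suc d)))

-- Shiftedness with respect to v₁ < ⋯ < v_t (given as an injective map
-- v : Fin t → Fin n, the order being that of the index).

Shifted : ∀ {n t} → SimplicialComplex n → (Fin t → Fin n) → Set
Shifted {n} {t} Δ v =
  ∀ (i : Fin t) (w : Fin n) →
  (∀ j → Data.Fin._≤_ j i → w ≢ v j) →
  ∀ B → B ∈Δ Δ → lookup B w ≡ true → lookup B (v i) ≡ false →
  ((B Data.Fin.Subset.- w) ∪ ⁅ v i ⁆) ∈Δ Δ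

gammaCount : ∀ {n t} → SimplicialComplex n → (Fin t → Fin n) → ℕ → ℕ
gammaCount {n} {t} Δ v r =
  length (filterᵇ (λ σ → face Δ σ ∧ (∣ σ ∣ Data.Nat.≡ᵇ r) ∧
                         not (Data.Bool.ListAction.any (λ i → lookup σ (v i)) (allFin t)))
                  (allSubsets n))

Sperner : ∀ {n} → List (Subset n) → Set
Sperner 𝒜 = ∀ {A B} → A ∈ 𝒜 → B ∈ 𝒜 → A ⊆ B → A ≡ B

FaceFamily : ∀ {n} → SimplicialComplex n → ℕ → List (Subset n) → Set
FaceFamily Δ r 𝒜 =
  Unique 𝒜 × 𝒜 ≢ [] × Sperner 𝒜 × (∀ {A} → A ∈ 𝒜 → A ∈Δ Δ × ∣ A ∣ ≤ r)

CrossIntersecting : ∀ {n} → List (Subset n) → List (Subset n) → Set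
CrossIntersecting 𝒜 ℬ = ∀ {A B} → A ∈ 𝒜 → B ∈ ℬ → Nonempty (A ∩ B)

{-# OPTIONS --safe #-}
module Submission where

-- Write m = 2r. Since the d-skeleton is Cohen–Macaulay it is pure, so the upper shadow of a
-- family of faces of size i < r is at least as large as the family, and both families may be
-- replaced by families of r-faces. Over F[t] take the covectors xⁱ = Σ_w (t^w)ⁱ e_w* with i < m
-- on the exterior algebra of the vertices. Vanishing of the homology of all links implies that
-- a chain of Δ killed by x⁰, …, x^j is, up to a regular factor, an iterated contraction by
-- these covectors. Passing to lexicographically initial monomials with respect to
-- x⁰, …, x^(m-1) and the coordinate covectors therefore turns Δ into a complex Y with the same
-- face numbers that is an iterated near-cone over its first m labels. It turns the two families
-- into families of r-faces of Y that are still cross-intersecting, because a ∧ b = 0 excludes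
-- disjoint initial monomials of a and b. In Y the families can be compressed towards the labels
-- one after another, and an induction on the number of labels gives the bound with γ counted in
-- Y. Finally γ is the same for Δ and Y: by purity and shiftedness Δ is an iterated near-cone over
-- v₁, …, v_r in low dimensions, and for iterated near-cones γ is determined by the face numbers.
-- Zero tests in F[t] are made under a double negation, which is harmless since the conclusion
-- is decidable.

open import Defs
open import Level using (Level; _⊔_)
open import Algebra.Bundles using (CommutativeRing)
open import Function using (_∘_; id)
open import Data.Bool using (Bool; true; false; _∧_; _∨_; not; if_then_else_)
open import Data.Bool.Properties using (∧-assoc; ∧-identityʳ; ∧-zeroʳ)
open import Data.Nat as ℕ using (ℕ; zero; suc; _≡ᵇ_; _<ᵇ_; s≤s; z≤n; _%_)
import Data.Nat.Properties as ℕ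
open import Data.Fin using (Fin; zero; suc; toℕ)
import Data.Fin.Properties as Fin
open import Data.Fin.Subset using (Subset; ∣_∣; ⊥; _∪_; ⁅_⁆)
open import Data.Fin.Subset.Properties using (∪-comm; ∪-identityˡ; ∪-identityʳ; ∣⊥∣≡0; ∣p∣≤∣p∪q∣)
open import Data.List as List using (List; foldr; tabulate; allFin)
import Data.List.Properties as List
open import Data.Vec as Vec using (Vec; []; _∷_; lookup; _++_)
open import Data.Vec.Properties using (lookup-replicate)
open import Data.Product using (Σ; ∃; _×_; _,_; proj₁; proj₂)
open import Data.Sum using (_⊎_; inj₁; inj₂; [_,_]′)
open import Data.Unit.Polymorphic using (⊤; tt)
open import Data.Empty using (⊥-elim)
open import Relation.Nullary using (¬_; Dec; yes; no)
open import Relation.Binary.PropositionalEquality as ≡ using (_≡_; _≢_)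

-- A finite F may have fewer than n elements, hence F[t], where the powers of t are pairwise
-- distinct over every field. These explicit points, in place of generic ones, let exactness be
-- proved by interpolation, starting from the single covector x⁰, whose contraction is the
-- simplicial boundary. Fractions never occur: each division becomes a multiplication by a regular
-- element, and such factors leave initial monomials unchanged.
--
-- The number 2r answers two demands. In a near-cone over k labels the count deals with sizes t + s
-- = k, for which two sets meet exactly if their union has fewer than k elements; this bound on
-- unions, not the intersection, is what passes to links. Exactness, on the other hand, reaches only
-- up to total size d, so 2r must not exceed d.
--
-- The summand 1 arises where s has dropped to 0: each family then has at most the empty set as a
-- member, one of the two is paid for by the empty face, and γ has become the number of t-faces
-- itself. For this the nonemptiness of both families has to be carried down along the smaller size.

-- Booleans, insertion and deletion in subsets, counting of subsets

module Subsets where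
  open import Data.Nat using (_+_; _≤_; _<_; _≤ᵇ_)
  open import Data.Nat.Properties
  open import Data.Nat.Tactic.RingSolver using (solve-∀)
  open import Data.List using (length; filterᵇ; map) renaming (_++_ to _++ᴸ_)
  open import Data.Empty renaming (⊥ to Empty)
  open ≡ using (refl; sym; trans; cong; cong₂; subst)

  ∧-true : ∀ {x y} → x ∧ y ≡ true → x ≡ true × y ≡ true
  ∧-true {true} {true} _ = refl , refl

  ∧-intro : ∀ {x y} → x ≡ true → y ≡ true → x ∧ y ≡ true
  ∧-intro refl refl = refl

  ∨-true : ∀ {x y} → x ∨ y ≡ true → x ≡ true ⊎ y ≡ true
  ∨-true {true}  _ = inj₁ refl
  ∨-true {false} e = inj₂ e

  ∨-introʳ : ∀ x {y} → y ≡ true → x ∨ y ≡ true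
  ∨-introʳ true  _ = refl
  ∨-introʳ false e = e

  not-true : ∀ {x} → not x ≡ true → x ≡ false
  not-true {false} _ = refl

  not-intro : ∀ {x} → x ≡ false → not x ≡ true
  not-intro refl = refl

  true≢false : ∀ {x} → x ≡ true → x ≡ false → Empty
  true≢false refl ()

  ¬true⇒false : ∀ {x} → ¬ (x ≡ true) → x ≡ false
  ¬true⇒false {true}  h = ⊥-elim (h refl)
  ¬true⇒false {false} _ = refl

  bool-ext : ∀ {x y} → (x ≡ true → y ≡ true) → (y ≡ true → x ≡ true) → x ≡ y
  bool-ext {true}  {true}  _ _ = refl
  bool-ext {true}  {false} f _ = sym (f refl)
  bool-ext {false} {true}  _ g = g refl
  bool-ext {false} {false} _ _ = refl

  decᵇ : ∀ x → x ≡ true ⊎ x ≡ false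
  decᵇ true  = inj₁ refl
  decᵇ false = inj₂ refl

  ≡ᵇ-true : ∀ {m n} → (m ≡ᵇ n) ≡ true → m ≡ n
  ≡ᵇ-true {zero}  {zero}  _ = refl
  ≡ᵇ-true {suc m} {suc n} e = cong suc (≡ᵇ-true e)

  ≡ᵇ-refl : ∀ m → (m ≡ᵇ m) ≡ true
  ≡ᵇ-refl zero    = refl
  ≡ᵇ-refl (suc m) = ≡ᵇ-refl m

  ≡ᵇ-intro : ∀ {m n} → m ≡ n → (m ≡ᵇ n) ≡ true
  ≡ᵇ-intro {m} refl = ≡ᵇ-refl m

  ≤ᵇ-true : ∀ {m n} → (m ≤ᵇ n) ≡ true → m ≤ n
  ≤ᵇ-true {m} {n} e = ≤ᵇ⇒≤ m n (subst Data.Bool.T (sym e) _)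

  ≤ᵇ-intro : ∀ {m n} → m ≤ n → (m ≤ᵇ n) ≡ true
  ≤ᵇ-intro {zero}          _       = refl
  ≤ᵇ-intro {suc zero}      (s≤s _) = refl
  ≤ᵇ-intro {suc (suc m)} (s≤s h) = ≤ᵇ-intro {suc m} h

  ins del : ∀ {n} → Fin n → Subset n → Subset n
  ins zero    (_ ∷ T) = true ∷ T
  ins (suc v) (b ∷ T) = b ∷ ins v T
  del zero    (_ ∷ T) = false ∷ T
  del (suc v) (b ∷ T) = b ∷ del v T

  lookup-ins : ∀ {n} v (T : Subset n) → lookup (ins v T) v ≡ true
  lookup-ins zero    (_ ∷ _) = refl
  lookup-ins (suc v) (_ ∷ T) = lookup-ins v T

  lookup-ins-≢ : ∀ {n} {v u} (T : Subset n) → u ≢ v → lookup (ins v T) u ≡ lookup T u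
  lookup-ins-≢ {v = zero}  {zero}  (_ ∷ _) u≢v = ⊥-elim (u≢v refl)
  lookup-ins-≢ {v = zero}  {suc u} (_ ∷ _) u≢v = refl
  lookup-ins-≢ {v = suc v} {zero}  (_ ∷ _) u≢v = refl
  lookup-ins-≢ {v = suc v} {suc u} (_ ∷ T) u≢v = lookup-ins-≢ T (u≢v ∘ cong suc)

  lookup-ins-mono : ∀ {n} v u (T : Subset n) → lookup T u ≡ true → lookup (ins v T) u ≡ true
  lookup-ins-mono zero    zero    (_ ∷ _) _ = refl
  lookup-ins-mono zero    (suc u) (_ ∷ _) e = e
  lookup-ins-mono (suc v) zero    (_ ∷ _) e = e
  lookup-ins-mono (suc v) (suc u) (_ ∷ T) e = lookup-ins-mono v u T e

  lookup-del : ∀ {n} v (T : Subset n) → lookup (del v T) v ≡ false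
  lookup-del zero    (_ ∷ _) = refl
  lookup-del (suc v) (_ ∷ T) = lookup-del v T

  ins-id : ∀ {n} v (T : Subset n) → lookup T v ≡ true → ins v T ≡ T
  ins-id zero    (true ∷ T) _ = refl
  ins-id (suc v) (b ∷ T)    e = cong (b ∷_) (ins-id v T e)

  del-ins : ∀ {n} v (T : Subset n) → lookup T v ≡ false → del v (ins v T) ≡ T
  del-ins zero    (false ∷ T) _ = refl
  del-ins (suc v) (b ∷ T)     e = cong (b ∷_) (del-ins v T e)

  ins-del : ∀ {n} v (T : Subset n) → lookup T v ≡ true → ins v (del v T) ≡ T
  ins-del zero    (true ∷ T) _ = refl
  ins-del (suc v) (b ∷ T)    e = cong (b ∷_) (ins-del v T e)

  size-ins : ∀ {n} v (T : Subset n) → lookup T v ≡ false → ∣ ins v T ∣ ≡ suc ∣ T ∣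
  size-ins zero    (false ∷ T) _ = refl
  size-ins (suc v) (true ∷ T)  e = cong suc (size-ins v T e)
  size-ins (suc v) (false ∷ T) e = size-ins v T e

  size-ins-≤ : ∀ {n} v (T : Subset n) → ∣ ins v T ∣ ≤ suc ∣ T ∣
  size-ins-≤ v T with decᵇ (lookup T v)
  ... | inj₁ e rewrite ins-id v T e = n≤1+n _
  ... | inj₂ e = ≤-reflexive (size-ins v T e)

  size-ins-≥ : ∀ {n} v (T : Subset n) → ∣ T ∣ ≤ ∣ ins v T ∣
  size-ins-≥ v T with decᵇ (lookup T v)
  ... | inj₁ e rewrite ins-id v T e = ≤-refl
  ... | inj₂ e rewrite size-ins v T e = n≤1+n _

  size-del : ∀ {n} v (T : Subset n) → lookup T v ≡ true → suc ∣ del v T ∣ ≡ ∣ T ∣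
  size-del v T e = trans (sym (size-ins v (del v T) (lookup-del v T))) (cong ∣_∣ (ins-del v T e))

  size-0 : ∀ {n} (T : Subset n) → ∣ T ∣ ≡ 0 → T ≡ ⊥
  size-0 []          _ = refl
  size-0 (false ∷ T) e = cong (false ∷_) (size-0 T e)

  size-pos : ∀ {n} (T : Subset n) {k} → ∣ T ∣ ≡ suc k → ∃ λ v → lookup T v ≡ true
  size-pos (true ∷ T)  e = zero , refl
  size-pos (false ∷ T) e with size-pos T e
  ... | v , h = suc v , h

  ∪-⁅⁆ : ∀ {n} (T : Subset n) v → T ∪ ⁅ v ⁆ ≡ ins v T
  ∪-⁅⁆ (true ∷ T)  zero    = cong (true ∷_) (∪-identityʳ T)
  ∪-⁅⁆ (false ∷ T) zero    = cong (true ∷_) (∪-identityʳ T)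
  ∪-⁅⁆ (true ∷ T)  (suc v) = cong (true ∷_) (∪-⁅⁆ T v)
  ∪-⁅⁆ (false ∷ T) (suc v) = cong (false ∷_) (∪-⁅⁆ T v)

  ∪-ins : ∀ {n} v (T U : Subset n) → T ∪ ins v U ≡ ins v (T ∪ U)
  ∪-ins zero    (true ∷ T)  (_ ∷ U) = refl
  ∪-ins zero    (false ∷ T) (_ ∷ U) = refl
  ∪-ins (suc v) (b ∷ T)     (c ∷ U) = cong (_ ∷_) (∪-ins v T U)

  ins-∪ : ∀ {n} v (T U : Subset n) → ins v T ∪ U ≡ ins v (T ∪ U)
  ins-∪ v T U = trans (∪-comm (ins v T) U) (trans (∪-ins v U T) (cong (ins v) (∪-comm U T)))

  del-∪-ins : ∀ {n} v (T U : Subset n) → del v T ∪ ins v U ≡ ins v (T ∪ U)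
  del-∪-ins zero    (_ ∷ T) (_ ∷ U) = refl
  del-∪-ins (suc v) (b ∷ T) (c ∷ U) = cong (_ ∷_) (del-∪-ins v T U)

  lookup-∪ : ∀ {n} v (T U : Subset n) → lookup (T ∪ U) v ≡ lookup T v ∨ lookup U v
  lookup-∪ zero    (b ∷ T) (c ∷ U) = refl
  lookup-∪ (suc v) (b ∷ T) (c ∷ U) = lookup-∪ v T U

  lookup-∪-false : ∀ {n} v (T U : Subset n) → lookup T v ≡ false → lookup U v ≡ false → lookup (T ∪ U) v ≡ false
  lookup-∪-false v T U e e′ rewrite lookup-∪ v T U | e = e′

  lookup-∪-trueˡ : ∀ {n} v (T U : Subset n) → lookup T v ≡ true → lookup (T ∪ U) v ≡ true
  lookup-∪-trueˡ v T U e rewrite lookup-∪ v T U | e = refl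

  overlap⇒common : ∀ {n} (T U : Subset n) → ∣ T ∪ U ∣ < ∣ T ∣ + ∣ U ∣ → ∃ λ v → lookup T v ≡ true × lookup U v ≡ true
  overlap⇒common []          []          ()
  overlap⇒common (true ∷ T)  (true ∷ U)  _ = zero , refl , refl
  overlap⇒common (true ∷ T)  (false ∷ U) (s≤s h) with overlap⇒common T U h
  ... | v , p , q = suc v , p , q
  overlap⇒common (false ∷ T) (true ∷ U)  h with overlap⇒common T U (≤-pred (≤-trans h (≤-reflexive (+-suc ∣ T ∣ ∣ U ∣))))
  ... | v , p , q = suc v , p , q
  overlap⇒common (false ∷ T) (false ∷ U) h with overlap⇒common T U h
  ... | v , p , q = suc v , p , q

  +-interchange : ∀ a b c d → (a + b) + (c + d) ≡ (a + c) + (b + d)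
  +-interchange = solve-∀

  toℕᵇ : Bool → ℕ
  toℕᵇ b = if b then 1 else 0

  cnt : ∀ {n} → (Subset n → Bool) → ℕ
  cnt {zero}  P = toℕᵇ (P [])
  cnt {suc n} P = cnt (P ∘ (false ∷_)) + cnt (P ∘ (true ∷_))

  length-filter-map : ∀ {A B : Set} (P : B → Bool) (f : A → B) xs →
    length (filterᵇ P (map f xs)) ≡ length (filterᵇ (P ∘ f) xs)
  length-filter-map P f List.[] = refl
  length-filter-map P f (x List.∷ xs) with P (f x)
  ... | true  = cong suc (length-filter-map P f xs)
  ... | false = length-filter-map P f xs

  length-filter-++ : ∀ {A : Set} (P : A → Bool) xs ys →
    length (filterᵇ P (xs ++ᴸ ys)) ≡ length (filterᵇ P xs) + length (filterᵇ P ys)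
  length-filter-++ P List.[] ys = refl
  length-filter-++ P (x List.∷ xs) ys with P x
  ... | true  = cong suc (length-filter-++ P xs ys)
  ... | false = length-filter-++ P xs ys

  length-filter-allSubsets : ∀ {n} (P : Subset n → Bool) → length (filterᵇ P (allSubsets n)) ≡ cnt P
  length-filter-allSubsets {zero} P with P []
  ... | true  = refl
  ... | false = refl
  length-filter-allSubsets {suc n} P =
    trans (length-filter-++ P (map (false ∷_) (allSubsets n)) _)
      (cong₂ _+_ (trans (length-filter-map P (false ∷_) (allSubsets n)) (length-filter-allSubsets (P ∘ (false ∷_))))
                 (trans (length-filter-map P (true ∷_) (allSubsets n)) (length-filter-allSubsets (P ∘ (true ∷_)))))

  cnt-cong : ∀ {n} {P Q : Subset n → Bool} → (∀ T → P T ≡ Q T) → cnt P ≡ cnt Q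
  cnt-cong {zero}  h = cong toℕᵇ (h [])
  cnt-cong {suc n} h = cong₂ _+_ (cnt-cong (h ∘ (false ∷_))) (cnt-cong (h ∘ (true ∷_)))

  cnt-mono : ∀ {n} {P Q : Subset n → Bool} → (∀ T → P T ≡ true → Q T ≡ true) → cnt P ≤ cnt Q
  cnt-mono {zero} {P} {Q} h with P [] | Q [] | h []
  ... | false | _     | _ = z≤n
  ... | true  | true  | _ = ≤-refl
  ... | true  | false | f with f refl
  ...   | ()
  cnt-mono {suc n} h = +-mono-≤ (cnt-mono (h ∘ (false ∷_))) (cnt-mono (h ∘ (true ∷_)))

  cnt-none : ∀ {n} {P : Subset n → Bool} → (∀ T → P T ≡ false) → cnt P ≡ 0
  cnt-none {zero}  h rewrite h [] = refl
  cnt-none {suc n} h rewrite cnt-none (h ∘ (false ∷_)) = cnt-none (h ∘ (true ∷_))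

  cnt-pos : ∀ {n} {P : Subset n → Bool} T → P T ≡ true → 1 ≤ cnt P
  cnt-pos {P = P} []          e rewrite e = ≤-refl
  cnt-pos {P = P} (false ∷ T) e = ≤-trans (cnt-pos T e) (m≤m+n _ _)
  cnt-pos {P = P} (true ∷ T)  e = ≤-trans (cnt-pos T e) (m≤n+m _ _)

  cnt-find : ∀ {n} (P : Subset n → Bool) → (∀ T → P T ≡ false) ⊎ ∃ λ T → P T ≡ true
  cnt-find {zero} P with decᵇ (P [])
  ... | inj₁ e = inj₂ ([] , e)
  ... | inj₂ e = inj₁ λ where [] → e
  cnt-find {suc n} P with cnt-find (P ∘ (false ∷_)) | cnt-find (P ∘ (true ∷_))
  ... | inj₂ (T , e) | _            = inj₂ (false ∷ T , e)
  ... | inj₁ _       | inj₂ (T , e) = inj₂ (true ∷ T , e)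
  ... | inj₁ h       | inj₁ h′      = inj₁ λ where
    (false ∷ T) → h T
    (true ∷ T)  → h′ T

  cnt≥1⇒∃ : ∀ {n} (P : Subset n → Bool) → 1 ≤ cnt P → ∃ λ T → P T ≡ true
  cnt≥1⇒∃ P h with cnt-find P
  ... | inj₂ e = e
  ... | inj₁ none with subst (1 ≤_) (cnt-none none) h
  ...   | ()

  cnt≡0⇒none : ∀ {n} {P : Subset n → Bool} → cnt P ≡ 0 → ∀ T → P T ≡ false
  cnt≡0⇒none {P = P} e T with decᵇ (P T)
  ... | inj₂ f = f
  ... | inj₁ t with subst (1 ≤_) e (cnt-pos T t)
  ...   | ()

  cnt-split : ∀ {n} (Q P : Subset n → Bool) → cnt P ≡ cnt (λ T → Q T ∧ P T) + cnt (λ T → not (Q T) ∧ P T)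
  cnt-split {zero} Q P with Q []
  ... | true  = sym (+-identityʳ _)
  ... | false = refl
  cnt-split {suc n} Q P =
    trans (cong₂ _+_ (cnt-split (Q ∘ (false ∷_)) (P ∘ (false ∷_))) (cnt-split (Q ∘ (true ∷_)) (P ∘ (true ∷_))))
          (+-interchange (cnt (λ T → Q (false ∷ T) ∧ P (false ∷ T))) _ _ _)

  cnt-disjoint : ∀ {n} {P Q R : Subset n → Bool} → (∀ T → P T ≡ true → R T ≡ true) → (∀ T → Q T ≡ true → R T ≡ true) →
    (∀ T → P T ≡ true → Q T ≡ false) → cnt P + cnt Q ≤ cnt R
  cnt-disjoint {P = P} {Q} {R} pr qr pq = ≤-trans
    (+-mono-≤ (cnt-mono λ T e → ∧-intro e (pr T e)) (cnt-mono λ T e → ∧-intro (not-intro (¬true⇒false λ p → true≢false e (pq T p))) (qr T e)))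
    (≤-reflexive (sym (cnt-split P R)))

  cnt-toggle : ∀ {n} v (P : Subset n → Bool) →
    cnt (λ T → lookup T v ∧ P T) ≡ cnt (λ T → not (lookup T v) ∧ P (ins v T))
  cnt-toggle {suc n} zero P =
    trans (cong (_+ cnt (P ∘ (true ∷_))) (cnt-none {n} λ _ → refl))
          (sym (trans (cong (cnt (P ∘ (true ∷_)) +_) (cnt-none {n} λ _ → refl)) (+-identityʳ _)))
  cnt-toggle {suc n} (suc v) P = cong₂ _+_ (cnt-toggle v (P ∘ (false ∷_))) (cnt-toggle v (P ∘ (true ∷_)))

  fc : ∀ {n} → ℕ → (Subset n → Bool) → ℕ
  fc p Y = cnt λ T → Y T ∧ (∣ T ∣ ≡ᵇ p)

open Subsets

-- Compression and the counting bound in iterated near-cones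

module NearCones where
  open import Data.Nat using (_+_; _*_; _≤_; _<_)
  open import Data.Nat.Properties
  open import Data.Nat.Tactic.RingSolver using (solve-∀)
  open import Data.Unit using () renaming (⊤ to Unit)
  open import Relation.Nullary using (¬?)
  open ≡ using (refl; sym; trans; cong; cong₂; subst; subst₂)

  size-∪-≤ : ∀ {n} (T U : Subset n) → ∣ T ∪ U ∣ ≤ ∣ T ∣ + ∣ U ∣
  size-∪-≤ []          []          = z≤n
  size-∪-≤ (true ∷ T)  (true ∷ U)  = s≤s (≤-trans (size-∪-≤ T U) (+-monoʳ-≤ ∣ T ∣ (n≤1+n _)))
  size-∪-≤ (true ∷ T)  (false ∷ U) = s≤s (size-∪-≤ T U)
  size-∪-≤ (false ∷ T) (true ∷ U)  = ≤-trans (s≤s (size-∪-≤ T U)) (≤-reflexive (sym (+-suc _ _)))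
  size-∪-≤ (false ∷ T) (false ∷ U) = size-∪-≤ T U

  -- The condition that unions have fewer than m elements, after splitting off the head label: index
  -- 1 marks the members that contain it, and it adds one to the union as soon as one of the two
  -- members does. For sizes adding up to m the condition says that the members meet; for larger
  -- sizes it is stronger, for smaller ones automatic.
  record Conf {N} (m : ℕ) (A₀ A₁ B₀ B₁ : Subset N → Bool) : Set where
    field
      c00 : ∀ T U → A₀ T ≡ true → B₀ U ≡ true → ∣ T ∪ U ∣ < m
      c01 : ∀ T U → A₀ T ≡ true → B₁ U ≡ true → suc ∣ T ∪ U ∣ < m
      c10 : ∀ T U → A₁ T ≡ true → B₀ U ≡ true → suc ∣ T ∪ U ∣ < m
      c11 : ∀ T U → A₁ T ≡ true → B₁ U ≡ true → suc ∣ T ∪ U ∣ < m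
  open Conf

  Conf-swap : ∀ {N m} {A₀ A₁ B₀ B₁ : Subset N → Bool} → Conf m A₀ A₁ B₀ B₁ → Conf m B₀ B₁ A₀ A₁
  Conf-swap {m = m} c = record
    { c00 = λ T U p q → subst (λ X → ∣ X ∣ < m) (∪-comm U T) (c00 c U T q p)
    ; c01 = λ T U p q → subst (λ X → suc ∣ X ∣ < m) (∪-comm U T) (c10 c U T q p)
    ; c10 = λ T U p q → subst (λ X → suc ∣ X ∣ < m) (∪-comm U T) (c01 c U T q p)
    ; c11 = λ T U p q → subst (λ X → suc ∣ X ∣ < m) (∪-comm U T) (c11 c U T q p) }

  -- One compression step: w is exchanged for the head label in every member for which the result is
  -- not yet a member. `mv₀` is what stays without the head label, `mv₁` what then contains it.
  mv₀ mv₁ : ∀ {N} → Fin N → (A₀ A₁ : Subset N → Bool) → Subset N → Bool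
  mv₀ w A₀ A₁ T = (not (lookup T w) ∨ A₁ (del w T)) ∧ A₀ T
  mv₁ w A₀ A₁ T = A₁ T ∨ (not (lookup T w) ∧ A₀ (ins w T))

  -- Both families must be compressed with the same w. The critical T contains w and stays, which
  -- happens only because `del w T` is already in `A₁`; this set and the unmoved `ins w U` have the
  -- same union as T and U.
  mv-conf01 : ∀ {N m} w {A₀ A₁ B₀ B₁ : Subset N → Bool} → Conf m A₀ A₁ B₀ B₁ →
    ∀ T U → mv₀ w A₀ A₁ T ≡ true → mv₁ w B₀ B₁ U ≡ true → suc ∣ T ∪ U ∣ < m
  mv-conf01 {m = m} w c T U p q with ∧-true p | ∨-true q
  ... | _ , a | inj₁ b = c01 c T U a b
  ... | h , a | inj₂ q′ with ∧-true q′
  ...   | nw , b with decᵇ (lookup T w) | ∨-true h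
  ...     | inj₂ w∉T | _ = subst (_< m) (trans (cong ∣_∣ (∪-ins w T U)) (size-ins w (T ∪ U) (lookup-∪-false w T U w∉T (not-true nw)))) (c00 c T _ a b)
  ...     | inj₁ w∈T | inj₁ w∉T = ⊥-elim (true≢false w∈T (not-true w∉T))
  ...     | inj₁ w∈T | inj₂ a₁ = subst (λ X → suc ∣ X ∣ < m)
            (trans (del-∪-ins w T U) (ins-id w (T ∪ U) (lookup-∪-trueˡ w T U w∈T))) (c10 c _ _ a₁ b)

  mv-conf : ∀ {N m} w {A₀ A₁ B₀ B₁ : Subset N → Bool} → Conf m A₀ A₁ B₀ B₁ →
    Conf m (mv₀ w A₀ A₁) (mv₁ w A₀ A₁) (mv₀ w B₀ B₁) (mv₁ w B₀ B₁)
  mv-conf {m = m} w {A₀} {A₁} {B₀} {B₁} c = record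
    { c00 = λ T U p q → c00 c T U (proj₂ (∧-true p)) (proj₂ (∧-true q))
    ; c01 = mv-conf01 w c
    ; c10 = λ T U p q → subst (λ X → suc ∣ X ∣ < m) (∪-comm U T) (mv-conf01 w (Conf-swap c) U T q p)
    ; c11 = both }
    where
    half : ∀ {A₀ A₁ B₀ B₁ : Subset _ → Bool} → Conf m A₀ A₁ B₀ B₁ → ∀ T U → A₁ T ≡ true → B₀ (ins w U) ≡ true → suc ∣ T ∪ U ∣ < m
    half c T U a b = ≤-<-trans (s≤s (subst (λ X → ∣ T ∪ U ∣ ≤ ∣ X ∣) (sym (∪-ins w T U)) (size-ins-≥ w (T ∪ U)))) (c10 c T _ a b)
    both : ∀ T U → mv₁ w A₀ A₁ T ≡ true → mv₁ w B₀ B₁ U ≡ true → suc ∣ T ∪ U ∣ < m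
    both T U p q with ∨-true p | ∨-true q
    ... | inj₁ a | inj₁ b = c11 c T U a b
    ... | inj₁ a | inj₂ b = half c T U a (proj₂ (∧-true b))
    ... | inj₂ a | inj₁ b = subst (λ X → suc ∣ X ∣ < m) (∪-comm U T) (half (Conf-swap c) U T b (proj₂ (∧-true a)))
    ... | inj₂ a | inj₂ b = subst (_< m)
      (trans (cong ∣_∣ (trans (ins-∪ w T (ins w U)) (trans (cong (ins w) (∪-ins w T U)) (ins-id w (ins w (T ∪ U)) (lookup-ins w (T ∪ U))))))
             (size-ins w (T ∪ U) (lookup-∪-false w T U (not-true (proj₁ (∧-true a))) (not-true (proj₁ (∧-true b))))))
      (c00 c _ _ (proj₂ (∧-true a)) (proj₂ (∧-true b)))

  removed : ∀ {N} → Fin N → (A₀ A₁ : Subset N → Bool) → Subset N → Bool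
  removed w A₀ A₁ T = lookup T w ∧ (A₀ T ∧ not (A₁ (del w T)))

  mv₀-cnt : ∀ {N} w (A₀ A₁ : Subset N → Bool) → cnt A₀ ≡ cnt (mv₀ w A₀ A₁) + cnt (removed w A₀ A₁)
  mv₀-cnt w A₀ A₁ = trans (cnt-split (λ T → not (lookup T w) ∨ A₁ (del w T)) A₀)
    (cong (cnt (mv₀ w A₀ A₁) +_) (cnt-cong λ T → demorgan (lookup T w) (A₁ (del w T)) (A₀ T)))
    where
    demorgan : ∀ a b c → not (not a ∨ b) ∧ c ≡ a ∧ (c ∧ not b)
    demorgan false _     _     = refl
    demorgan true  true  true  = refl
    demorgan true  true  false = refl
    demorgan true  false true  = refl
    demorgan true  false false = refl

  mv₁-cnt : ∀ {N} w (A₀ A₁ : Subset N → Bool) → cnt (mv₁ w A₀ A₁) ≡ cnt A₁ + cnt (removed w A₀ A₁)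
  mv₁-cnt w A₀ A₁ = trans (cnt-split A₁ (mv₁ w A₀ A₁)) (cong₂ _+_
    (cnt-cong λ T → absorb (A₁ T) _)
    (trans (cnt-cong λ T → moved T)
           (sym (cnt-toggle w (λ T → A₀ T ∧ not (A₁ (del w T)))))))
    where
    absorb : ∀ a b → a ∧ (a ∨ b) ≡ a
    absorb true  _ = refl
    absorb false _ = refl
    rearrange : ∀ a b c → not a ∧ (a ∨ (b ∧ c)) ≡ b ∧ (c ∧ not a)
    rearrange true  true  true  = refl
    rearrange true  true  false = refl
    rearrange true  false _     = refl
    rearrange false false _     = refl
    rearrange false true  true  = refl
    rearrange false true  false = refl
    dead : ∀ {a x y} → a ≡ true → not a ∧ x ≡ not a ∧ y
    dead refl = refl
    moved : ∀ T → not (A₁ T) ∧ mv₁ w A₀ A₁ T ≡ not (lookup T w) ∧ (A₀ (ins w T) ∧ not (A₁ (del w (ins w T))))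
    moved T with decᵇ (lookup T w)
    ... | inj₁ e = trans (rearrange (A₁ T) (not (lookup T w)) _) (dead e)
    ... | inj₂ e rewrite del-ins w T e = rearrange (A₁ T) (not (lookup T w)) _

  -- The Boolean index is the size class. `lo` and `hi` hold the members without and with the head
  -- label, both written on the remaining labels.
  record Fam (N : ℕ) : Set where
    field lo hi : Bool → Subset N → Bool
  open Fam

  Closed : ∀ {N} → (Subset N → Bool) → Set
  Closed Y = ∀ v T → Y (ins v T) ≡ true → Y T ≡ true

  record Within {N} (Λ : Subset N → Bool) (sz : Bool → ℕ) (A : Fam N) : Set where
    field
      lo-in : ∀ i T → lo A i T ≡ true → Λ T ≡ true × ∣ T ∣ ≡ sz i
      hi-in : ∀ i T → hi A i T ≡ true → Λ T ≡ true × suc ∣ T ∣ ≡ sz i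
  open Within

  move : ∀ {N} → Fin N → Fam N → Fam N
  lo (move w A) i = mv₀ w (lo A i) (hi A i)
  hi (move w A) i = mv₁ w (lo A i) (hi A i)

  move-within : ∀ {N Λ sz} w {A : Fam N} → Closed Λ → Within Λ sz A → Within Λ sz (move w A)
  lo-in (move-within w cl W) i T p = lo-in W i T (proj₂ (∧-true p))
  hi-in (move-within w cl W) i T p with ∨-true p
  ... | inj₁ q = hi-in W i T q
  ... | inj₂ q with ∧-true q
  ...   | nw , a with lo-in W i (ins w T) a
  ...     | y , e = cl w T y , trans (sym (size-ins w T (not-true nw))) e

  total : ∀ {N} → Fam N → ℕ
  total A = cnt (lo A true) + cnt (lo A false)

  violAt : ∀ {N} → Fin N → Fam N → ℕ
  violAt w A = cnt (removed w (lo A true) (hi A true)) + cnt (removed w (lo A false) (hi A false))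

  total-move : ∀ {N} w (A : Fam N) → total A ≡ total (move w A) + violAt w A
  total-move w A = trans (cong₂ _+_ (mv₀-cnt w (lo A true) (hi A true)) (mv₀-cnt w (lo A false) (hi A false)))
    (+-interchange (cnt (mv₀ w (lo A true) (hi A true))) _ _ _)

  SameCount : ∀ {N} → Fam N → Fam N → Set
  SameCount A A′ = ∀ i → cnt (lo A′ i) + cnt (hi A′ i) ≡ cnt (lo A i) + cnt (hi A i)

  move-count : ∀ {N} w (A : Fam N) → SameCount A (move w A)
  move-count w A i = trans (cong (cnt (mv₀ w (lo A i) (hi A i)) +_) (mv₁-cnt w (lo A i) (hi A i)))
    (trans (swap (cnt (mv₀ w (lo A i) (hi A i))) _ _) (cong (_+ cnt (hi A i)) (sym (mv₀-cnt w (lo A i) (hi A i)))))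
    where
    swap : ∀ a b c → a + (b + c) ≡ (a + c) + b
    swap = solve-∀

  Stable : ∀ {N} → Fam N → Set
  Stable A = ∀ i T w → lo A i T ≡ true → lookup T w ≡ true → hi A i (del w T) ≡ true

  noviol⇒stable : ∀ {N} (A : Fam N) → (∀ w → violAt w A ≡ 0) → Stable A
  noviol⇒stable A h i T w a w∈T with decᵇ (hi A i (del w T))
  ... | inj₁ e = e
  ... | inj₂ e = ⊥-elim (true≢false (∧-intro w∈T (∧-intro a (not-intro e))) (cnt≡0⇒none (none i) T))
    where
    none : ∀ i → cnt (removed w (lo A i) (hi A i)) ≡ 0
    none true  = m+n≡0⇒m≡0 _ (h w)
    none false = m+n≡0⇒n≡0 (cnt (removed w (lo A true) (hi A true))) (h w)

  record Stabilised {N} (Λ : Subset N → Bool) (sz : Bool → ℕ) (m : ℕ) (A B : Fam N) : Set where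
    field
      A′ B′    : Fam N
      A-in     : Within Λ sz A′
      B-in     : Within Λ sz B′
      conf     : ∀ i j → Conf m (lo A′ i) (hi A′ i) (lo B′ j) (hi B′ j)
      A-stable : Stable A′
      B-stable : Stable B′
      A-count  : SameCount A A′
      B-count  : SameCount B B′

  -- Every move that changes something strictly lowers the number of members without the head label,
  -- so the fuel suffices; moves preserve the size classes, their counts and the conditions on
  -- unions.
  stabilise : ∀ fuel {N Λ sz m} (A B : Fam N) → total A + total B < fuel → Closed Λ → Within Λ sz A → Within Λ sz B →
    (∀ i j → Conf m (lo A i) (hi A i) (lo B j) (hi B j)) → Stabilised Λ sz m A B
  stabilise (suc fuel) A B lt cl WA WB c with Fin.any? (λ w → ¬? (violAt w A + violAt w B ≟ 0))
  ... | no none = record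
    { A′ = A ; B′ = B ; A-in = WA ; B-in = WB ; conf = c
    ; A-stable = noviol⇒stable A λ w → m+n≡0⇒m≡0 _ (zeroAt w)
    ; B-stable = noviol⇒stable B λ w → m+n≡0⇒n≡0 (violAt w A) (zeroAt w)
    ; A-count = λ _ → refl ; B-count = λ _ → refl }
    where
    zeroAt : ∀ w → violAt w A + violAt w B ≡ 0
    zeroAt w with violAt w A + violAt w B ≟ 0
    ... | yes e = e
    ... | no ne = ⊥-elim (none (w , ne))
  ... | yes (w , ne) = record
    { A′ = A′ R ; B′ = B′ R ; A-in = A-in R ; B-in = B-in R ; conf = conf R
    ; A-stable = A-stable R ; B-stable = B-stable R
    ; A-count = λ i → trans (A-count R i) (move-count w A i)
    ; B-count = λ i → trans (B-count R i) (move-count w B i) }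
    where
    open Stabilised
    regroup : total A + total B ≡ (total (move w A) + total (move w B)) + (violAt w A + violAt w B)
    regroup = trans (cong₂ _+_ (total-move w A) (total-move w B)) (+-interchange (total (move w A)) _ _ _)
    smaller : total (move w A) + total (move w B) < total A + total B
    smaller = subst (total (move w A) + total (move w B) <_) (sym regroup) (m<m+n _ (n≢0⇒n>0 ne))
    R = stabilise fuel (move w A) (move w B) (<-≤-trans smaller (≤-pred lt)) cl
          (move-within w cl WA) (move-within w cl WB) (λ i j → mv-conf w (c i j))

  -- The first label is a cone point for faces of at most k elements, and its link satisfies the
  -- same with k - 1. Since the bound drops with every link taken, a face together with the labels
  -- removed before it always stays within the original k, which is the range in which exactness is
  -- available.
  Coned : ∀ k {n} → (Subset (k + n) → Bool) → Set
  Coned zero    Y = Unit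
  Coned (suc k) Y = Closed Y × (∀ T → ∣ T ∣ ≤ k → Y (false ∷ T) ≡ true → Y (true ∷ T) ≡ true) × Coned k (Y ∘ (true ∷_))

  -- The number γ of the statement is gam r (r + r) r Y, the first r labels playing the part of v₁, …, v_r.
  gam : ∀ (s k : ℕ) {n} → ℕ → (Subset (k + n) → Bool) → ℕ
  gam zero    k       t Y = fc t Y
  gam (suc s) zero    t Y = 0
  gam (suc s) (suc k) t Y = gam s k t (Y ∘ (true ∷_))

  link-closed : ∀ k {n} {Y : Subset (suc k + n) → Bool} → Coned (suc k) Y → Closed (Y ∘ (true ∷_))
  link-closed k (cl , _) v T = cl (suc v) (true ∷ T)

  fc-del : ∀ k {n} {Y : Subset (suc k + n) → Bool} → Coned (suc k) Y → ∀ p → p ≤ k → fc p (Y ∘ (false ∷_)) ≡ fc p (Y ∘ (true ∷_))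
  fc-del k {Y = Y} (cl , cone , _) p p≤k = cnt-cong λ T → bool-ext
    (λ h → let (y , e) = ∧-true h in ∧-intro (cone T (subst (_≤ k) (sym (≡ᵇ-true e)) p≤k) y) e)
    (λ h → let (y , e) = ∧-true h in ∧-intro (cl zero (false ∷ T) y) e)

  fc-cone : ∀ k {n} {Y : Subset (suc k + n) → Bool} → Coned (suc k) Y → ∀ p → suc p ≤ k →
    fc (suc p) Y ≡ fc (suc p) (Y ∘ (true ∷_)) + fc p (Y ∘ (true ∷_))
  fc-cone k {Y = Y} C p p<k = cong (_+ fc p (Y ∘ (true ∷_))) (fc-del k C (suc p) p<k)

  fc-cone-0 : ∀ k {n} {Y : Subset (suc k + n) → Bool} → Coned (suc k) Y → fc 0 Y ≡ fc 0 (Y ∘ (true ∷_))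
  fc-cone-0 k {Y = Y} C = trans (cong₂ _+_ (fc-del k C 0 z≤n) (cnt-none λ T → ∧-zeroʳ (Y (true ∷ T)))) (+-identityʳ _)

  fc-0-≤1 : ∀ {N} (Y : Subset N → Bool) → fc 0 Y ≤ 1
  fc-0-≤1 {zero} Y with Y []
  ... | true  = ≤-refl
  ... | false = z≤n
  fc-0-≤1 {suc N} Y = ≤-trans (≤-reflexive (trans (cong (fc 0 (Y ∘ (false ∷_)) +_) (cnt-none λ T → ∧-zeroʳ (Y (true ∷ T)))) (+-identityʳ _))) (fc-0-≤1 (Y ∘ (false ∷_)))

  cone-full : ∀ k {n} (Y : Subset (k + n) → Bool) → Coned k Y → Y ⊥ ≡ true → ∃ λ T → Y T ≡ true × ∣ T ∣ ≡ k
  cone-full zero    {n} Y C y = ⊥ , y , ∣⊥∣≡0 n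
  cone-full (suc k) {n} Y (_ , cone , C) y with cone-full k (Y ∘ (true ∷_)) C (cone ⊥ (subst (_≤ k) (sym (∣⊥∣≡0 (k + n))) z≤n) y)
  ... | T , y′ , e = true ∷ T , y′ , cong suc e

  fc-0-≤-top : ∀ k {n} (Y : Subset (k + n) → Bool) → Coned k Y → fc 0 Y ≤ fc k Y
  fc-0-≤-top k Y C with cnt-find (λ T → Y T ∧ (∣ T ∣ ≡ᵇ 0))
  ... | inj₁ none = subst (_≤ fc k Y) (sym (cnt-none none)) z≤n
  ... | inj₂ (T , h) with ∧-true h
  ...   | y , e with cone-full k Y C (subst (λ T → Y T ≡ true) (size-0 T (≡ᵇ-true e)) y)
  ...     | U , yU , eU = ≤-trans (fc-0-≤1 Y) (cnt-pos U (∧-intro yU (≡ᵇ-intro eU)))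

  pick : Bool → ℕ → ℕ → ℕ
  pick true  t s = t
  pick false t s = s

  extra : Bool → ℕ → ℕ
  extra true  g = g
  extra false g = 0

  within-cnt : ∀ {N p} {Y A : Subset N → Bool} → (∀ T → A T ≡ true → Y T ≡ true × ∣ T ∣ ≡ p) → cnt A ≤ fc p Y
  within-cnt h = cnt-mono λ T a → ∧-intro (proj₁ (h T a)) (≡ᵇ-intro (proj₂ (h T a)))

  top-blocks : ∀ {N k} {A B : Subset N → Bool} → (∀ T U → A T ≡ true → B U ≡ true → ∣ T ∪ U ∣ < k) →
    ∀ T → A T ≡ true → ∣ T ∣ ≡ k → ∀ U → B U ≡ false
  top-blocks {k = k} c T a e U = ¬true⇒false λ b → <-irrefl refl (≤-<-trans (subst (_≤ ∣ T ∪ U ∣) e (∣p∣≤∣p∪q∣ T U)) (c T U a b))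

  -- As 2t exceeds k, the members T and U share some w. By stability T with w exchanged for the head
  -- label is a member too; since w still lies in U, the union with U loses nothing and gains the
  -- head label, so the original union was smaller by one than required.
  stable⇒lower : ∀ {N k t} {Λ sz} {A B : Fam N} i j → Within Λ sz A → Within Λ sz B → Stable A →
    Conf (suc k) (lo A i) (hi A i) (lo B j) (hi B j) → sz i ≡ t → sz j ≡ t → k < t + t →
    ∀ T U → lo A i T ≡ true → lo B j U ≡ true → ∣ T ∪ U ∣ < k
  stable⇒lower {k = k} {t} i j WA WB st c ei ej lt T U a b
    with overlap⇒common T U (<-≤-trans (c00 c T U a b) (≤-trans lt (≤-reflexive (sym (cong₂ _+_ (trans (proj₂ (lo-in WA i T a)) ei) (trans (proj₂ (lo-in WB j U b)) ej))))))
  ... | w , w∈T , w∈U = ≤-pred (subst (λ X → suc ∣ X ∣ < suc k)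
          (trans (cong (del w T ∪_) (sym (ins-id w U w∈U))) (trans (del-∪-ins w T U) (ins-id w (T ∪ U) (lookup-∪-trueˡ w T U w∈T))))
          (c10 c (del w T) U (st i T w a w∈T) b))

  -- The flagged bound asks for members of the smaller size. They survive the passage to the link
  -- because stability turns any nonempty member without the head label into one with it.
  hi-nonempty : ∀ {N s} {Λ sz} (A A′ : Fam N) i → Within Λ sz A′ → Stable A′ → SameCount A A′ → sz i ≡ suc s →
    1 ≤ cnt (lo A i) + cnt (hi A i) → ∃ λ T → hi A′ i T ≡ true
  hi-nonempty A A′ i W st sc es h with cnt-find (hi A′ i) | cnt-find (lo A′ i)
  ... | inj₂ r  | _ = r
  ... | inj₁ _  | inj₂ (T , a) with size-pos T (trans (proj₂ (lo-in W i T a)) es)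
  ...   | w , w∈T = del w T , st i T w a w∈T
  hi-nonempty A A′ i W st sc es h | inj₁ e | inj₁ e′ with subst (1 ≤_) (trans (sym (sc i)) (cong₂ _+_ (cnt-none e′) (cnt-none e))) h
  ... | ()

  split-fam : ∀ {N} → (Bool → Subset (suc N) → Bool) → Fam N
  lo (split-fam A) i = A i ∘ (false ∷_)
  hi (split-fam A) i = A i ∘ (true ∷_)

  split-conf : ∀ {N m} {A B : Subset (suc N) → Bool} → (∀ T U → A T ≡ true → B U ≡ true → ∣ T ∪ U ∣ < m) →
    Conf m (A ∘ (false ∷_)) (A ∘ (true ∷_)) (B ∘ (false ∷_)) (B ∘ (true ∷_))
  split-conf c = record
    { c00 = λ T U → c (false ∷ T) (false ∷ U) ; c01 = λ T U → c (false ∷ T) (true ∷ U)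
    ; c10 = λ T U → c (true ∷ T) (false ∷ U) ; c11 = λ T U → c (true ∷ T) (true ∷ U) }

  split-within : ∀ k {n} {Y : Subset (suc k + n) → Bool} {sz} {A : Bool → Subset (suc k + n) → Bool} → Coned (suc k) Y →
    (∀ i → sz i ≤ k) → (∀ i T → A i T ≡ true → Y T ≡ true × ∣ T ∣ ≡ sz i) → Within (Y ∘ (true ∷_)) sz (split-fam A)
  lo-in (split-within k (_ , cone , _) le h) i T a with h i (false ∷ T) a
  ... | y , e = cone T (subst (_≤ k) (sym e) (le i)) y , e
  hi-in (split-within k C le h) i T a = h i (true ∷ T) a

  nonempty-split : ∀ {N} (A : Subset (suc N) → Bool) → (∃ λ T → A T ≡ true) → 1 ≤ cnt (A ∘ (false ∷_)) + cnt (A ∘ (true ∷_))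
  nonempty-split A (T , a) = cnt-pos {P = A} T a

  +-cancel-half : ∀ {a b} → a + a ≤ b + b → a ≤ b
  +-cancel-half {a} {b} h = *-cancelˡ-≤ 2 (subst₂ _≤_ (dbl a) (dbl b) h)
    where
    dbl : ∀ x → x + x ≡ 2 * x
    dbl = solve-∀

  -- Splitting at the head label leads from sizes (t, s) over t + s labels to sizes (t, s - 1)
  -- and (t - 1, s) over one label less. The only condition that gets stronger is the one between
  -- members of size t avoiding the head label: they share an element, which compression
  -- allows to be exchanged for the head label. The flagged form is the one for nonempty families.

  cross-bound-< : ∀ k {n} (Y : Subset (k + n) → Bool) → Coned k Y → ∀ flag t s → s < t → t + s ≡ k →
    (A B : Bool → Subset (k + n) → Bool) →
    (∀ i T → A i T ≡ true → Y T ≡ true × ∣ T ∣ ≡ pick i t s) →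
    (∀ i T → B i T ≡ true → Y T ≡ true × ∣ T ∣ ≡ pick i t s) →
    (∀ i j T U → A i T ≡ true → B j U ≡ true → ∣ T ∪ U ∣ < k) →
    (flag ≡ true → (∃ λ T → A false T ≡ true) × (∃ λ T → B false T ≡ true)) →
    (cnt (A true) + cnt (A false)) + (cnt (B true) + cnt (B false)) + extra flag (gam s k t Y) ≤ fc t Y + fc s Y + extra flag 1

  cross-bound-≡ : ∀ k {n} (Y : Subset (k + n) → Bool) → Coned k Y → ∀ flag j → j + j ≡ k →
    (A B : Subset (k + n) → Bool) →
    (∀ T → A T ≡ true → Y T ≡ true × ∣ T ∣ ≡ j) →
    (∀ T → B T ≡ true → Y T ≡ true × ∣ T ∣ ≡ j) →
    (∀ T U → A T ≡ true → B U ≡ true → ∣ T ∪ U ∣ < k) →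
    (flag ≡ true → (∃ λ T → A T ≡ true) × (∃ λ T → B T ≡ true)) →
    cnt A + cnt B + extra flag (gam j k j Y) ≤ fc j Y + extra flag 1

  cross-bound-< k Y C flag t zero s<t e A B inA inB c ne with cnt-find (A true) | cnt-find (B true)
  ... | inj₂ (T , a) | _ = one-sided flag ne
    where
    noB : ∀ j U → B j U ≡ false
    noB j = top-blocks (c true j) T a (trans (proj₂ (inA true T a)) (trans (sym (+-identityʳ t)) e))
    one-sided : ∀ flag → (flag ≡ true → (∃ λ T → A false T ≡ true) × (∃ λ T → B false T ≡ true)) →
      (cnt (A true) + cnt (A false)) + (cnt (B true) + cnt (B false)) + extra flag (fc t Y) ≤ fc t Y + fc 0 Y + extra flag 1
    one-sided true  ne with ne refl
    ... | _ , U , b = ⊥-elim (true≢false b (noB false U))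
    one-sided false _ rewrite cnt-none (noB true) | cnt-none (noB false) = +-monoˡ-≤ 0 (≤-trans (≤-reflexive (+-identityʳ _))
      (+-mono-≤ (within-cnt (inA true)) (within-cnt (inA false))))
  ... | inj₁ _ | inj₂ (U , b) = one-sided flag ne
    where
    noA : ∀ i T → A i T ≡ false
    noA i = top-blocks (λ U T b a → subst (λ X → ∣ X ∣ < k) (∪-comm T U) (c i true T U a b)) U b (trans (proj₂ (inB true U b)) (trans (sym (+-identityʳ t)) e))
    one-sided : ∀ flag → (flag ≡ true → (∃ λ T → A false T ≡ true) × (∃ λ T → B false T ≡ true)) →
      (cnt (A true) + cnt (A false)) + (cnt (B true) + cnt (B false)) + extra flag (fc t Y) ≤ fc t Y + fc 0 Y + extra flag 1
    one-sided true  ne with ne refl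
    ... | (T , a) , _ = ⊥-elim (true≢false a (noA false T))
    one-sided false _ rewrite cnt-none (noA true) | cnt-none (noA false) = +-monoˡ-≤ 0
      (+-mono-≤ (within-cnt (inB true)) (within-cnt (inB false)))
  ... | inj₁ noA | inj₁ noB rewrite cnt-none noA | cnt-none noB = bottom flag
    where
    bottom : ∀ flag → cnt (A false) + cnt (B false) + extra flag (fc t Y) ≤ fc t Y + fc 0 Y + extra flag 1
    -- The larger size classes are empty and `gam` has become `fc t Y`. One family is charged to the
    -- empty face; the other one accounts for the summand 1.
    bottom true = ≤-trans (+-monoˡ-≤ (fc t Y) (+-mono-≤ (within-cnt (inA false)) (≤-trans (within-cnt (inB false)) (fc-0-≤1 Y))))
      (≤-reflexive (rot (fc 0 Y) (fc t Y)))
      where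
      rot : ∀ a b → a + 1 + b ≡ b + a + 1
      rot = solve-∀
    -- Without the summand 1 the second empty set is charged to a face with k elements, which exists
    -- because coning extends the empty face by all k labels.
    bottom false = +-monoˡ-≤ 0 (+-mono-≤ (≤-trans (within-cnt (inA false)) (subst (λ p → fc 0 Y ≤ fc p Y) (trans (sym e) (+-identityʳ t)) (fc-0-≤-top k Y C))) (within-cnt (inB false)))
  cross-bound-< zero Y C flag (suc t) (suc s) s<t () A B inA inB c ne
  cross-bound-< (suc k) Y C flag (suc t) (suc s) s<t e A B inA inB c ne = conclude (<-cmp′ (≤-pred s<t))
    where
    Λ = Y ∘ (true ∷_)
    CΛ = proj₂ (proj₂ C)
    t+s : t + suc s ≡ k
    t+s = suc-injective e
    st+s : suc t + s ≡ k
    st+s = trans (sym (+-suc t s)) t+s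
    t≤k : suc t ≤ k
    t≤k = subst (suc t ≤_) st+s (m≤m+n (suc t) s)
    s≤k : suc s ≤ k
    s≤k = subst (suc s ≤_) t+s (m≤n+m (suc s) t)
    sz-≤ : ∀ i → pick i (suc t) (suc s) ≤ k
    sz-≤ true  = t≤k
    sz-≤ false = s≤k
    S = stabilise _ (split-fam A) (split-fam B) ≤-refl (link-closed k C)
          (split-within k C sz-≤ inA) (split-within k C sz-≤ inB) (λ i j → split-conf (c i j))
    open Stabilised S
    <-cmp′ : suc s ≤ t → suc s < t ⊎ suc s ≡ t
    <-cmp′ h = m≤n⇒m<n∨m≡n h
    k<tt : k < suc t + suc t
    k<tt = subst (_< suc t + suc t) t+s (s≤s (+-monoʳ-≤ t (≤-trans (≤-pred s<t) (n≤1+n t))))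
    ss<k : s + s < k
    ss<k = subst (s + s <_) st+s (+-monoˡ-< s (≤-trans (≤-pred s<t) (n≤1+n t)))
    pairA : (lo₁ hi₂ : Subset _ → Bool) → Bool → Subset _ → Bool
    pairA f g true  = f
    pairA f g false = g
    -- Larger sets without the head label go with smaller sets containing it, so that the sizes
    -- again add up to the number of labels. The flag travels with this pair: its smaller size drops
    -- by one, exactly as the link does in `gam`.
    group₁ : (cnt (lo A′ true) + cnt (hi A′ false)) + (cnt (lo B′ true) + cnt (hi B′ false)) + extra flag (gam s k (suc t) Λ)
             ≤ fc (suc t) Λ + fc s Λ + extra flag 1
    group₁ = cross-bound-< k Λ CΛ flag (suc t) s (≤-trans (≤-pred s<t) (n≤1+n t)) st+s
      (pairA (lo A′ true) (hi A′ false)) (pairA (lo B′ true) (hi B′ false)) (ins₁ A-in) (ins₁ B-in) conf₁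
      (λ f → hi-nonempty (split-fam A) A′ false A-in A-stable A-count refl (nonempty-split (A false) (proj₁ (ne f)))
           , hi-nonempty (split-fam B) B′ false B-in B-stable B-count refl (nonempty-split (B false) (proj₂ (ne f))))
      where
      ins₁ : ∀ {D} → Within Λ (λ i → pick i (suc t) (suc s)) D → ∀ i T → pairA (lo D true) (hi D false) i T ≡ true → Λ T ≡ true × ∣ T ∣ ≡ pick i (suc t) s
      ins₁ W true  T a = lo-in W true T a
      ins₁ W false T a = proj₁ (hi-in W false T a) , suc-injective (proj₂ (hi-in W false T a))
      conf₁ : ∀ i j T U → pairA (lo A′ true) (hi A′ false) i T ≡ true → pairA (lo B′ true) (hi B′ false) j U ≡ true → ∣ T ∪ U ∣ < k
      conf₁ true  true  T U a b = stable⇒lower true true A-in B-in A-stable (conf true true) refl refl k<tt T U a b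
      conf₁ true  false T U a b = ≤-pred (c01 (conf true false) T U a b)
      conf₁ false true  T U a b = ≤-pred (c10 (conf false true) T U a b)
      conf₁ false false T U a b = ≤-<-trans (size-∪-≤ T U) (subst (_< k)
        (sym (cong₂ _+_ (suc-injective (proj₂ (hi-in A-in false T a))) (suc-injective (proj₂ (hi-in B-in false U b))))) ss<k)
    group₂ : suc s < t ⊎ suc s ≡ t →
      (cnt (hi A′ true) + cnt (lo A′ false)) + (cnt (hi B′ true) + cnt (lo B′ false)) + 0 ≤ fc t Λ + fc (suc s) Λ + 0
    group₂ (inj₁ lt) = cross-bound-< k Λ CΛ false t (suc s) lt t+s
      (pairA (hi A′ true) (lo A′ false)) (pairA (hi B′ true) (lo B′ false)) (ins₂ A-in) (ins₂ B-in) conf₂ (λ ())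
      where
      ins₂ : ∀ {D} → Within Λ (λ i → pick i (suc t) (suc s)) D → ∀ i T → pairA (hi D true) (lo D false) i T ≡ true → Λ T ≡ true × ∣ T ∣ ≡ pick i t (suc s)
      ins₂ W true  T a = proj₁ (hi-in W true T a) , suc-injective (proj₂ (hi-in W true T a))
      ins₂ W false T a = lo-in W false T a
      conf₂ : ∀ i j T U → pairA (hi A′ true) (lo A′ false) i T ≡ true → pairA (hi B′ true) (lo B′ false) j U ≡ true → ∣ T ∪ U ∣ < k
      conf₂ true  true  T U a b = ≤-pred (c11 (conf true true) T U a b)
      conf₂ true  false T U a b = ≤-pred (c10 (conf true false) T U a b)
      conf₂ false true  T U a b = ≤-pred (c01 (conf false true) T U a b)
      conf₂ false false T U a b = ≤-<-trans (size-∪-≤ T U) (subst₂ _<_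
        (sym (cong₂ _+_ (proj₂ (lo-in A-in false T a)) (proj₂ (lo-in B-in false U b)))) t+s (+-monoˡ-< (suc s) lt))
    -- The two sizes of the second pair have become equal. The bound for equal sizes is applied
    -- twice and crosswise, to the `hi` part of one family against the `lo` part of the other.
    group₂ (inj₂ eq) = ≤-trans (≤-reflexive (rot (cnt (hi A′ true)) _ _ _)) (≤-trans (+-mono-≤ one two)
        (≤-reflexive (trans (cong (λ p → fc (suc s) Λ + 0 + (fc p Λ + 0)) eq) (rot′ (fc (suc s) Λ) _))))
      where
      rot : ∀ a b x y → (a + b) + (x + y) + 0 ≡ (a + y + 0) + (b + x + 0)
      rot = solve-∀
      rot′ : ∀ a b → a + 0 + (b + 0) ≡ b + a + 0
      rot′ = solve-∀
      ss : suc s + suc s ≡ k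
      ss = trans (cong (_+ suc s) eq) t+s
      hi-size : ∀ {D} → Within Λ (λ i → pick i (suc t) (suc s)) D → ∀ T → hi D true T ≡ true → Λ T ≡ true × ∣ T ∣ ≡ suc s
      hi-size W T a = proj₁ (hi-in W true T a) , trans (suc-injective (proj₂ (hi-in W true T a))) (sym eq)
      one = cross-bound-≡ k Λ CΛ false (suc s) ss (hi A′ true) (lo B′ false) (hi-size A-in) (lo-in B-in false)
              (λ T U a b → ≤-pred (c10 (conf true false) T U a b)) (λ ())
      two = cross-bound-≡ k Λ CΛ false (suc s) ss (lo A′ false) (hi B′ true) (lo-in A-in false) (hi-size B-in)
              (λ T U a b → ≤-pred (c01 (conf false true) T U a b)) (λ ())
    conclude : suc s < t ⊎ suc s ≡ t → (cnt (A true) + cnt (A false)) + (cnt (B true) + cnt (B false)) + extra flag (gam s k (suc t) Λ)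
        ≤ fc (suc t) Y + fc (suc s) Y + extra flag 1
    conclude cmp = subst₂ _≤_
      (trans (rotˡ (cnt (lo A′ true)) (cnt (hi A′ false)) (cnt (lo B′ true)) (cnt (hi B′ false)) (cnt (hi A′ true)) (cnt (lo A′ false)) (cnt (hi B′ true)) (cnt (lo B′ false)) _)
        (cong (_+ extra flag (gam s k (suc t) Λ)) (cong₂ _+_ (cong₂ _+_ (A-count true) (A-count false)) (cong₂ _+_ (B-count true) (B-count false)))))
      (trans (rotʳ (fc (suc t) Λ) (fc s Λ) (fc t Λ) (fc (suc s) Λ) _)
        (sym (cong₂ (λ a b → a + b + extra flag 1) (fc-cone k C t t≤k) (fc-cone k C s s≤k))))
      (+-mono-≤ group₁ (group₂ cmp))
      where
      rotˡ : ∀ at af bt bf at′ af′ bt′ bf′ g → ((at + af) + (bt + bf) + g) + ((at′ + af′) + (bt′ + bf′) + 0) ≡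
        ((at + at′) + (af′ + af)) + ((bt + bt′) + (bf′ + bf)) + g
      rotˡ = solve-∀
      rotʳ : ∀ a b x y g → (a + b + g) + (x + y + 0) ≡ (a + x) + (y + b) + g
      rotʳ = solve-∀

  cross-bound-≡ k Y C flag zero e A B inA inB c ne with cnt-find A
  ... | inj₁ noA = one-sided flag ne
    where
    one-sided : ∀ flag → (flag ≡ true → (∃ λ T → A T ≡ true) × (∃ λ T → B T ≡ true)) → cnt A + cnt B + extra flag (fc 0 Y) ≤ fc 0 Y + extra flag 1
    one-sided true ne with ne refl
    ... | (T , a) , _ = ⊥-elim (true≢false a (noA T))
    one-sided false _ rewrite cnt-none noA = +-monoˡ-≤ 0 (within-cnt inB)
  ... | inj₂ (T , a) = one-sided flag ne
    where
    noB : ∀ U → B U ≡ false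
    noB = top-blocks c T a (trans (proj₂ (inA T a)) e)
    one-sided : ∀ flag → (flag ≡ true → (∃ λ T → A T ≡ true) × (∃ λ T → B T ≡ true)) → cnt A + cnt B + extra flag (fc 0 Y) ≤ fc 0 Y + extra flag 1
    one-sided true ne with ne refl
    ... | _ , U , b = ⊥-elim (true≢false b (noB U))
    one-sided false _ rewrite cnt-none noB | +-identityʳ (cnt A) = +-monoˡ-≤ 0 (within-cnt inA)
  -- Both size classes hold a copy of the same family. Pairing the `lo` part of one copy with the
  -- `hi` part of the other gives two inequalities whose sum is twice the claim.
  cross-bound-≡ (suc k) Y C flag (suc j) e A B inA inB c ne = +-cancel-half (subst₂ _≤_
      (trans (rotˡ (cnt (lo A′ true)) (cnt (hi A′ false)) (cnt (lo B′ true)) (cnt (hi B′ false)) (cnt (lo A′ false)) (cnt (hi A′ true)) (cnt (lo B′ false)) (cnt (hi B′ true)) _)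
        (cong₂ _+_ (cong (_+ extra flag (gam j k (suc j) Λ)) (cong₂ _+_ (A-count true) (B-count true)))
                   (cong (_+ extra flag (gam j k (suc j) Λ)) (cong₂ _+_ (A-count false) (B-count false)))))
      (cong (λ a → a + extra flag 1 + (a + extra flag 1)) (sym (fc-cone k C j j≤k)))
      (+-mono-≤ (group true false) (group false true)))
    where
    Λ = Y ∘ (true ∷_)
    CΛ = proj₂ (proj₂ C)
    sj+j : suc j + j ≡ k
    sj+j = trans (sym (+-suc j j)) (suc-injective e)
    j≤k : suc j ≤ k
    j≤k = subst (suc j ≤_) sj+j (m≤m+n (suc j) j)
    S = stabilise _ {sz = λ _ → suc j} (split-fam (λ _ → A)) (split-fam (λ _ → B)) ≤-refl (link-closed k C)
          (split-within k C (λ _ → j≤k) (λ _ → inA)) (split-within k C (λ _ → j≤k) (λ _ → inB)) (λ _ _ → split-conf c)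
    open Stabilised S
    pairA : (lo₁ hi₂ : Subset _ → Bool) → Bool → Subset _ → Bool
    pairA f g true  = f
    pairA f g false = g
    group : ∀ a b → (cnt (lo A′ a) + cnt (hi A′ b)) + (cnt (lo B′ a) + cnt (hi B′ b)) + extra flag (gam j k (suc j) Λ)
            ≤ fc (suc j) Λ + fc j Λ + extra flag 1
    group x y = cross-bound-< k Λ CΛ flag (suc j) j ≤-refl sj+j
      (pairA (lo A′ x) (hi A′ y)) (pairA (lo B′ x) (hi B′ y)) (ins₁ A-in) (ins₁ B-in) conf₁
      (λ f → hi-nonempty (split-fam (λ _ → A)) A′ y A-in A-stable A-count refl (nonempty-split A (proj₁ (ne f)))
           , hi-nonempty (split-fam (λ _ → B)) B′ y B-in B-stable B-count refl (nonempty-split B (proj₂ (ne f))))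
      where
      ins₁ : ∀ {D} → Within Λ (λ _ → suc j) D → ∀ i T → pairA (lo D x) (hi D y) i T ≡ true → Λ T ≡ true × ∣ T ∣ ≡ pick i (suc j) j
      ins₁ W true  T a = lo-in W x T a
      ins₁ W false T a = proj₁ (hi-in W y T a) , suc-injective (proj₂ (hi-in W y T a))
      conf₁ : ∀ i j′ T U → pairA (lo A′ x) (hi A′ y) i T ≡ true → pairA (lo B′ x) (hi B′ y) j′ U ≡ true → ∣ T ∪ U ∣ < k
      conf₁ true  true  T U a b = stable⇒lower x x A-in B-in A-stable (conf x x) refl refl
        (subst (_< suc j + suc j) sj+j (+-monoʳ-< (suc j) (n<1+n j))) T U a b
      conf₁ true  false T U a b = ≤-pred (c01 (conf x y) T U a b)
      conf₁ false true  T U a b = ≤-pred (c10 (conf y x) T U a b)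
      conf₁ false false T U a b = ≤-<-trans (size-∪-≤ T U) (subst₂ _<_
        (sym (cong₂ _+_ (suc-injective (proj₂ (hi-in A-in y T a))) (suc-injective (proj₂ (hi-in B-in y U b))))) sj+j (n<1+n (j + j)))
    rotˡ : ∀ at af bt bf at′ af′ bt′ bf′ g → ((at + af) + (bt + bf) + g) + ((at′ + af′) + (bt′ + bf′) + g) ≡
        ((at + af′) + (bt + bf′) + g) + ((at′ + af) + (bt′ + bf) + g)
    rotˡ = solve-∀

open NearCones

-- Ring identities with integer coefficients

module RingSolver where
  open import Data.Maybe using (Maybe; just; nothing)
  open import Data.Integer as ℤ using (ℤ; +_; -[1+_]; _⊖_; _◃_)
  import Data.Integer.Properties as ℤ
  open import Data.Sign as Sign using (Sign)
  open import Algebra.Solver.Ring.AlmostCommutativeRing using (fromCommutativeRing; _-Raw-AlmostCommutative⟶_)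
  import Algebra.Solver.Ring

  -- Cancellation requires equality tests on coefficients, which an arbitrary ring does not offer.
  -- Integer coefficients, interpreted in the ring, can be compared.
  module IntegerSolver {c ℓ} (R : CommutativeRing c ℓ) where
    open CommutativeRing R
    open import Algebra.Properties.Ring ring using (-0#≈0#; -‿distribˡ-*; -‿distribʳ-*; -‿involutive; -‿+-comm)
    open import Algebra.Properties.Semiring.Mult.TCOptimised semiring using (×-homo-+; ×1-homo-*) renaming (_×_ to _×ₙ_)
    open import Algebra.Properties.CommutativeSemigroup +-commutativeSemigroup using (interchange)
    open import Relation.Binary.Reasoning.Setoid setoid

    ⟦_⟧ᶻ : ℤ → Carrier
    ⟦ + n ⟧ᶻ      = n ×ₙ 1#
    ⟦ -[1+ n ] ⟧ᶻ = - (suc n ×ₙ 1#)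

    suc-× : ∀ n → suc n ×ₙ 1# ≈ 1# + n ×ₙ 1#
    suc-× n = ×-homo-+ 1# 1 n

    ⊖-homo : ∀ m n → ⟦ m ⊖ n ⟧ᶻ ≈ m ×ₙ 1# + - (n ×ₙ 1#)
    ⊖-homo m       zero    = sym (trans (+-congˡ -0#≈0#) (+-identityʳ _))
    ⊖-homo zero    (suc n) = sym (+-identityˡ _)
    ⊖-homo (suc m) (suc n) rewrite ℤ.[1+m]⊖[1+n]≡m⊖n m n = begin
      ⟦ m ⊖ n ⟧ᶻ                                    ≈⟨ ⊖-homo m n ⟩
      m ×ₙ 1# + - (n ×ₙ 1#)                           ≈⟨ +-identityˡ _ ⟨
      0# + (m ×ₙ 1# + - (n ×ₙ 1#))                    ≈⟨ +-congʳ (-‿inverseʳ 1#) ⟨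
      (1# + - 1#) + (m ×ₙ 1# + - (n ×ₙ 1#))           ≈⟨ interchange _ _ _ _ ⟩
      (1# + m ×ₙ 1#) + (- 1# + - (n ×ₙ 1#))           ≈⟨ +-cong (suc-× m) (trans (-‿cong (suc-× n)) (sym (-‿+-comm _ _))) ⟨
      suc m ×ₙ 1# + - (suc n ×ₙ 1#)                   ∎

    +-homo : ∀ i j → ⟦ i ℤ.+ j ⟧ᶻ ≈ ⟦ i ⟧ᶻ + ⟦ j ⟧ᶻ
    +-homo (+ m)      (+ n)      = ×-homo-+ 1# m n
    +-homo (+ m)      -[1+ n ]   = ⊖-homo m (suc n)
    +-homo -[1+ m ]   (+ n)      = trans (⊖-homo n (suc m)) (+-comm _ _)
    +-homo -[1+ m ]   -[1+ n ]   = trans (-‿cong (trans (reflexive (≡.cong (λ k → k ×ₙ 1#) (≡.cong suc (≡.sym (ℕ.+-suc m n))))) (×-homo-+ 1# (suc m) (suc n)))) (sym (-‿+-comm _ _))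

    ◃-homo⁺ : ∀ n → ⟦ Sign.+ ◃ n ⟧ᶻ ≈ n ×ₙ 1#
    ◃-homo⁺ zero    = refl
    ◃-homo⁺ (suc n) = refl

    ◃-homo⁻ : ∀ n → ⟦ Sign.- ◃ n ⟧ᶻ ≈ - (n ×ₙ 1#)
    ◃-homo⁻ zero    = sym -0#≈0#
    ◃-homo⁻ (suc n) = refl

    *-homo : ∀ i j → ⟦ i ℤ.* j ⟧ᶻ ≈ ⟦ i ⟧ᶻ * ⟦ j ⟧ᶻ
    *-homo (+ m)    (+ n)    = trans (◃-homo⁺ (m ℕ.* n)) (×1-homo-* m n)
    *-homo (+ m)    -[1+ n ] = trans (◃-homo⁻ (m ℕ.* suc n)) (trans (-‿cong (×1-homo-* m (suc n))) (-‿distribʳ-* _ _))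
    *-homo -[1+ m ] (+ n)    = trans (◃-homo⁻ (suc m ℕ.* n)) (trans (-‿cong (×1-homo-* (suc m) n)) (-‿distribˡ-* _ _))
    *-homo -[1+ m ] -[1+ n ] = begin
      (suc m ℕ.* suc n) ×ₙ 1#                     ≈⟨ ×1-homo-* (suc m) (suc n) ⟩
      (suc m ×ₙ 1#) * (suc n ×ₙ 1#)                ≈⟨ -‿involutive _ ⟨
      - - ((suc m ×ₙ 1#) * (suc n ×ₙ 1#))          ≈⟨ -‿cong (-‿distribˡ-* _ _) ⟩
      - (- (suc m ×ₙ 1#) * (suc n ×ₙ 1#))          ≈⟨ -‿distribʳ-* _ _ ⟩
      - (suc m ×ₙ 1#) * - (suc n ×ₙ 1#)            ∎

    -‿homo : ∀ i → ⟦ ℤ.- i ⟧ᶻ ≈ - ⟦ i ⟧ᶻ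
    -‿homo (+ zero)  = sym -0#≈0#
    -‿homo (+ suc n) = refl
    -‿homo -[1+ n ]  = sym (-‿involutive _)

    morphism : ℤ.+-*-rawRing -Raw-AlmostCommutative⟶ fromCommutativeRing R
    morphism = record
      { ⟦_⟧ = ⟦_⟧ᶻ ; +-homo = +-homo ; *-homo = *-homo ; -‿homo = -‿homo ; 0-homo = refl ; 1-homo = refl }

    coefficient-≟ : ∀ i j → Maybe (⟦ i ⟧ᶻ ≈ ⟦ j ⟧ᶻ)
    coefficient-≟ i j with i ℤ.≟ j
    ... | yes ≡.refl = just refl
    ... | no _       = nothing

    open Algebra.Solver.Ring ℤ.+-*-rawRing (fromCommutativeRing R) morphism coefficient-≟ public
      using (Polynomial; solve; _:=_; _:+_; _:*_; :-_; _:-_; con)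

    :0 :1 : ∀ {k} → Polynomial k
    :0 = con (+ 0)
    :1 = con (+ 1)

open RingSolver

-- Contractions in the exterior algebra

module Exterior {c ℓ} (R : CommutativeRing c ℓ) where
  open CommutativeRing R hiding (zero)
  open import Algebra.Properties.Ring ring using (-0#≈0#; -‿involutive)
  open IntegerSolver R

  Chain : ℕ → Set c
  Chain n = Subset n → Carrier

  Covector : ℕ → Set c
  Covector n = Fin n → Carrier

  infix 4 _≐_
  _≐_ : ∀ {n} → Chain n → Chain n → Set ℓ
  a ≐ b = ∀ T → a T ≈ b T

  -- The interior product: the value at T is the sum over v outside T of g v times the value at T
  -- with v inserted, with the sign given by the number of elements of T before v.
  ι : ∀ {n} → Covector n → Chain n → Chain n
  ι {zero}  g a []          = 0#
  ι {suc n} g a (false ∷ T) = g zero * a (true ∷ T) + ι (g ∘ suc) (a ∘ (false ∷_)) T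
  ι {suc n} g a (true ∷ T)  = - ι (g ∘ suc) (a ∘ (true ∷_)) T

  -- Only the covers of T enter the value at T, always with the same signs. Identities between
  -- contractions thus reduce to one equation per inserted v, free of signs, and the factors s and
  -- s′ may depend on T.
  ι-local₂ : ∀ {n} {h g g′ : Covector n} {y z z′ : Chain n} s s′ T →
    (∀ v → lookup T v ≡ false → h v * y (ins v T) ≈ s * (g v * z (ins v T)) + s′ * (g′ v * z′ (ins v T))) →
    ι h y T ≈ s * ι g z T + s′ * ι g′ z′ T
  ι-local₂ {zero} s s′ [] e = sym (trans (+-cong (zeroʳ s) (zeroʳ s′)) (+-identityˡ 0#))
  ι-local₂ {suc n} s s′ (false ∷ T) e = trans (+-cong (e zero ≡.refl) (ι-local₂ s s′ T (e ∘ suc)))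
    (solve 6 (λ s s′ a b x y → (s :* a :+ s′ :* b) :+ (s :* x :+ s′ :* y) := s :* (a :+ x) :+ s′ :* (b :+ y)) refl s s′ _ _ _ _)
  ι-local₂ {suc n} s s′ (true ∷ T) e = trans (-‿cong (ι-local₂ s s′ T (e ∘ suc)))
    (solve 4 (λ s s′ a b → :- (s :* a :+ s′ :* b) := s :* (:- a) :+ s′ :* (:- b)) refl s s′ _ _)

  ι-local : ∀ {n} {h g : Covector n} {y z : Chain n} s T →
    (∀ v → lookup T v ≡ false → h v * y (ins v T) ≈ s * (g v * z (ins v T))) → ι h y T ≈ s * ι g z T
  ι-local {h = h} {g} {y} {z} s T e = trans
    (ι-local₂ {g′ = g} {z′ = z} s 0# T λ v v∉T → trans (e v v∉T) (solve 2 (λ x y → x := x :+ :0 :* y) refl _ _))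
    (solve 2 (λ x y → x :+ :0 :* y := x) refl _ _)

  ι-cong-local : ∀ {n} {h g : Covector n} {y z : Chain n} T →
    (∀ v → lookup T v ≡ false → h v * y (ins v T) ≈ g v * z (ins v T)) → ι h y T ≈ ι g z T
  ι-cong-local T e = trans (ι-local 1# T λ v v∉T → trans (e v v∉T) (sym (*-identityˡ _))) (*-identityˡ _)

  ι-vanish : ∀ {n} {g : Covector n} {y : Chain n} T → (∀ v → lookup T v ≡ false → y (ins v T) ≈ 0#) → ι g y T ≈ 0#
  ι-vanish {g = g} {y} T e = trans (ι-local {g = g} {z = y} 0# T λ v v∉T → trans (*-congˡ (e v v∉T)) (trans (zeroʳ _) (sym (zeroˡ _)))) (zeroˡ _)

  ι-cong : ∀ {n} {g : Covector n} {y z : Chain n} → y ≐ z → ι g y ≐ ι g z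
  ι-cong e T = ι-cong-local T λ v _ → *-congˡ (e (ins v T))

  ι-linear : ∀ {n} (g : Covector n) s s′ (y z : Chain n) → ι g (λ T → s * y T + s′ * z T) ≐ λ T → s * ι g y T + s′ * ι g z T
  ι-linear g s s′ y z T = ι-local₂ s s′ T λ v _ → solve 5 (λ g s s′ a b → g :* (s :* a :+ s′ :* b) := s :* (g :* a) :+ s′ :* (g :* b)) refl _ _ _ _ _

  ι-scale : ∀ {n} (g : Covector n) s (y : Chain n) → ι g (λ T → s * y T) ≐ λ T → s * ι g y T
  ι-scale g s y T = ι-local s T λ v _ → solve 3 (λ g s a → g :* (s :* a) := s :* (g :* a)) refl _ _ _

  ι-+ : ∀ {n} (g : Covector n) (y z : Chain n) → ι g (λ T → y T + z T) ≐ λ T → ι g y T + ι g z T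
  ι-+ g y z T = trans (ι-cong {g = g} (λ U → sym (+-cong (*-identityˡ _) (*-identityˡ _))) T)
    (trans (ι-linear g 1# 1# y z T) (+-cong (*-identityˡ _) (*-identityˡ _)))

  ι-neg : ∀ {n} (g : Covector n) (y : Chain n) → ι g (λ T → - y T) ≐ λ T → - ι g y T
  ι-neg g y T = trans (ι-local {z = y} (- 1#) T λ v _ → solve 2 (λ g a → g :* (:- a) := (:- :1) :* (g :* a)) refl _ _)
    (solve 1 (λ a → (:- :1) :* a := :- a) refl _)

  ι-zero : ∀ {n} (g : Covector n) {y : Chain n} → (∀ T → y T ≈ 0#) → ∀ T → ι g y T ≈ 0#
  ι-zero g e T = ι-vanish {g = g} T λ v _ → e (ins v T)

  ι-anticomm : ∀ {n} (g h : Covector n) a → ι g (ι h a) ≐ λ T → - ι h (ι g a) T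
  ι-anticomm {zero}  g h a []          = sym -0#≈0#
  ι-anticomm {suc n} g h a (false ∷ T) = trans (+-congˡ (ι-scale-+ (g ∘ suc) (h zero) (ι (h ∘ suc) (a ∘ (false ∷_)))))
    (trans (+-congˡ (+-congˡ (ι-anticomm (g ∘ suc) (h ∘ suc) (a ∘ (false ∷_)) T)))
      (sym (trans (-‿cong (+-congˡ (ι-scale-+ (h ∘ suc) (g zero) (ι (g ∘ suc) (a ∘ (false ∷_))))))
        (solve 5 (λ g h x y z → :- (h :* (:- y) :+ (g :* x :+ z)) := g :* (:- x) :+ (h :* y :+ (:- z))) refl
          (g zero) (h zero) (ι (h ∘ suc) (a ∘ (true ∷_)) T) (ι (g ∘ suc) (a ∘ (true ∷_)) T) (ι (h ∘ suc) (ι (g ∘ suc) (a ∘ (false ∷_))) T)))))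
    where
    ι-scale-+ : ∀ g s z → ι g (λ T → s * a (true ∷ T) + z T) T ≈ s * ι g (a ∘ (true ∷_)) T + ι g z T
    ι-scale-+ g s z = trans (ι-+ g (λ T → s * a (true ∷ T)) z T) (+-congʳ (ι-scale g s (a ∘ (true ∷_)) T))
  ι-anticomm {suc n} g h a (true ∷ T) = -‿cong (trans (ι-neg (g ∘ suc) (ι (h ∘ suc) (a ∘ (true ∷_))) T)
    (trans (-‿cong (ι-anticomm (g ∘ suc) (h ∘ suc) (a ∘ (true ∷_)) T))
      (trans (-‿involutive _) (sym (trans (-‿cong (ι-neg (h ∘ suc) (ι (g ∘ suc) (a ∘ (true ∷_))) T)) (-‿involutive _))))))

  ι-square : ∀ {n} (g : Covector n) a T → ι g (ι g a) T ≈ 0#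
  ι-square {zero}  g a []          = refl
  ι-square {suc n} g a (false ∷ T) = trans
    (+-congˡ (trans (ι-+ (g ∘ suc) (λ T → g zero * a (true ∷ T)) (ι (g ∘ suc) (a ∘ (false ∷_))) T)
      (+-cong (ι-scale (g ∘ suc) (g zero) (a ∘ (true ∷_)) T) (ι-square (g ∘ suc) (a ∘ (false ∷_)) T))))
    (solve 2 (λ g x → g :* (:- x) :+ (g :* x :+ :0) := :0) refl (g zero) _)
  ι-square {suc n} g a (true ∷ T) = trans (-‿cong (trans (ι-neg (g ∘ suc) (ι (g ∘ suc) (a ∘ (true ∷_))) T)
    (-‿cong (ι-square (g ∘ suc) (a ∘ (true ∷_)) T)))) (trans (-‿cong -0#≈0#) -0#≈0#)

  -- Left multiplication by the basis vector of w. Its relation to contraction, `ι-ext`, is the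
  -- antiderivation rule.
  ext : ∀ {n} → Fin n → Chain n → Chain n
  ext zero    a (true ∷ T)  = a (false ∷ T)
  ext zero    a (false ∷ T) = 0#
  ext (suc w) a (true ∷ T)  = - ext w (a ∘ (true ∷_)) T
  ext (suc w) a (false ∷ T) = ext w (a ∘ (false ∷_)) T

  ext-linear : ∀ {n} w s s′ (y z : Chain n) → ext w (λ T → s * y T + s′ * z T) ≐ λ T → s * ext w y T + s′ * ext w z T
  ext-linear zero    s s′ y z (true ∷ T)  = refl
  ext-linear zero    s s′ y z (false ∷ T) = solve 2 (λ s s′ → :0 := s :* :0 :+ s′ :* :0) refl s s′
  ext-linear (suc w) s s′ y z (true ∷ T)  = trans (-‿cong (ext-linear w s s′ (y ∘ (true ∷_)) (z ∘ (true ∷_)) T))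
    (solve 4 (λ s s′ a b → :- (s :* a :+ s′ :* b) := s :* (:- a) :+ s′ :* (:- b)) refl s s′ _ _)
  ext-linear (suc w) s s′ y z (false ∷ T) = ext-linear w s s′ (y ∘ (false ∷_)) (z ∘ (false ∷_)) T

  ext-cong : ∀ {n} w {y z : Chain n} → y ≐ z → ext w y ≐ ext w z
  ext-cong zero    e (true ∷ T)  = e (false ∷ T)
  ext-cong zero    e (false ∷ T) = refl
  ext-cong (suc w) e (true ∷ T)  = -‿cong (ext-cong w (e ∘ (true ∷_)) T)
  ext-cong (suc w) e (false ∷ T) = ext-cong w (e ∘ (false ∷_)) T

  ext-vanish : ∀ {n} w {y : Chain n} T → (lookup T w ≡ true → y (del w T) ≈ 0#) → ext w y T ≈ 0#
  ext-vanish zero    (true ∷ T)  e = e ≡.refl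
  ext-vanish zero    (false ∷ T) e = refl
  ext-vanish (suc w) (true ∷ T)  e = trans (-‿cong (ext-vanish w T e)) -0#≈0#
  ext-vanish (suc w) (false ∷ T) e = ext-vanish w T e

  ext-scale : ∀ {n} w s (y : Chain n) → ext w (λ T → s * y T) ≐ λ T → s * ext w y T
  ext-scale w s y T = trans (ext-cong w (λ U → solve 2 (λ s a → s :* a := s :* a :+ :0 :* a) refl s _) T)
    (trans (ext-linear w s 0# y y T) (solve 2 (λ s a → s :* a :+ :0 :* a := s :* a) refl s _))

  ι-ext : ∀ {n} (g : Covector n) w a → ι g (ext w a) ≐ λ T → g w * a T - ext w (ι g a) T
  ι-ext g zero a (false ∷ T) = trans (+-congˡ (ι-zero (g ∘ suc) (λ _ → refl) T)) (solve 1 (λ x → x :+ :0 := x :- :0) refl _)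
  ι-ext g zero a (true ∷ T)  = solve 2 (λ x y → :- y := x :- (x :+ y)) refl _ _
  ι-ext g (suc w) a (false ∷ T) = trans (+-congˡ (ι-ext (g ∘ suc) w (a ∘ (false ∷_)) T))
    (sym (trans (+-congˡ (-‿cong (trans (ext-cong w (λ U → +-congˡ (sym (*-identityˡ _))) T) (ext-linear w (g zero) 1# (a ∘ (true ∷_)) (ι (g ∘ suc) (a ∘ (false ∷_))) T))))
      (solve 4 (λ g x y z → z :- (g :* x :+ :1 :* y) := g :* (:- x) :+ (z :- y)) refl _ _ _ _)))
  ι-ext g (suc w) a (true ∷ T) = trans (-‿cong (ι-neg (g ∘ suc) (ext w (a ∘ (true ∷_))) T))
    (trans (-‿involutive _) (trans (ι-ext (g ∘ suc) w (a ∘ (true ∷_)) T)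
      (+-congˡ (-‿cong (sym (trans (-‿cong (trans (ext-cong w (λ U → solve 1 (λ x → :- x := (:- :1) :* x) refl _) T)
        (ext-scale w (- 1#) (ι (g ∘ suc) (a ∘ (true ∷_))) T))) (solve 1 (λ x → :- ((:- :1) :* x) := x) refl _)))))))

  coord : ∀ {n} → Fin n → Covector n
  coord zero    zero    = 1#
  coord zero    (suc v) = 0#
  coord (suc w) zero    = 0#
  coord (suc w) (suc v) = coord w v

  coord-≡ : ∀ {n} (w : Fin n) → coord w w ≈ 1#
  coord-≡ zero    = refl
  coord-≡ (suc w) = coord-≡ w

  coord-≢ : ∀ {n} {w v : Fin n} → v ≢ w → coord w v ≈ 0#
  coord-≢ {w = zero}  {zero}  ne = Data.Empty.⊥-elim (ne ≡.refl) where import Data.Empty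
  coord-≢ {w = zero}  {suc v} ne = refl
  coord-≢ {w = suc w} {zero}  ne = refl
  coord-≢ {w = suc w} {suc v} ne = coord-≢ (ne ∘ ≡.cong suc)

  ext-ι : ∀ {n} w {y : Chain n} → (∀ T → lookup T w ≡ false → y T ≈ 0#) → ext w (ι (coord w) y) ≐ y
  ext-ι w {y} e T = begin
    ext w (ι (coord w) y) T                                              ≈⟨ solve 2 (λ x z → z := x :- (x :- z)) refl (y T) _ ⟩
    y T - (y T - ext w (ι (coord w) y) T)                                ≈⟨ +-congˡ (-‿cong (trans (+-congʳ (trans (*-congʳ (coord-≡ w)) (*-identityˡ _))) refl)) ⟨
    y T - (coord w w * y T - ext w (ι (coord w) y) T)                    ≈⟨ +-congˡ (-‿cong (ι-ext (coord w) w y T)) ⟨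
    y T - ι (coord w) (ext w y) T                                        ≈⟨ +-congˡ (-‿cong (ι-zero (coord w) (λ U → ext-vanish w U λ _ → e (del w U) (lookup-del w U)) T)) ⟩
    y T - 0#                                                             ≈⟨ solve 1 (λ x → x :- :0 := x) refl _ ⟩
    y T                                                                  ∎
    where open import Relation.Binary.Reasoning.Setoid setoid

  It : ∀ {n} → (ℕ → Covector n) → ℕ → Chain n → Chain n
  It h zero    a = a
  It h (suc m) a = ι (h m) (It h m a)

  It-cong : ∀ {n} (h : ℕ → Covector n) m {a b : Chain n} → a ≐ b → It h m a ≐ It h m b
  It-cong h zero    e = e
  It-cong h (suc m) e = ι-cong (It-cong h m e)

  It-linear : ∀ {n} (h : ℕ → Covector n) m s s′ (y z : Chain n) → It h m (λ T → s * y T + s′ * z T) ≐ λ T → s * It h m y T + s′ * It h m z T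
  It-linear h zero    s s′ y z T = refl
  It-linear h (suc m) s s′ y z T = trans (ι-cong (It-linear h m s s′ y z) T) (ι-linear (h m) s s′ (It h m y) (It h m z) T)

  It-scale : ∀ {n} (h : ℕ → Covector n) m s (y : Chain n) → It h m (λ T → s * y T) ≐ λ T → s * It h m y T
  It-scale h zero    s y T = refl
  It-scale h (suc m) s y T = trans (ι-cong (It-scale h m s y) T) (ι-scale (h m) s (It h m y) T)

  It-kill : ∀ {n} (h : ℕ → Covector n) m (a : Chain n) j → j ℕ.< m → ∀ T → ι (h j) (It h m a) T ≈ 0#
  It-kill h (suc m) a j j<m T with ℕ.m≤n⇒m<n∨m≡n (ℕ.≤-pred j<m)
  ... | inj₂ ≡.refl = ι-square (h m) (It h m a) T
  ... | inj₁ lt = trans (ι-anticomm (h j) (h m) (It h m a) T)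
    (trans (-‿cong (ι-zero (h m) (It-kill h m a j lt) T)) -0#≈0#)

  signed : ∀ {n} → ℕ → Chain n → Chain n
  signed zero    a = a
  signed (suc m) a = λ T → - signed m a T

  signed-cong : ∀ {n} m {a b : Chain n} → a ≐ b → signed m a ≐ signed m b
  signed-cong zero    e T = e T
  signed-cong (suc m) e T = -‿cong (signed-cong m e T)

  signed-zero : ∀ {n} m {a : Chain n} T → a T ≈ 0# → signed m a T ≈ 0#
  signed-zero zero    T e = e
  signed-zero (suc m) T e = trans (-‿cong (signed-zero m T e)) -0#≈0#

  signed-neg : ∀ {n} m (a : Chain n) → signed m (λ T → - a T) ≐ λ T → - signed m a T
  signed-neg zero    a T = refl
  signed-neg (suc m) a T = -‿cong (signed-neg m a T)

  signed-twice : ∀ {n} m (a : Chain n) → signed m (signed m a) ≐ a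
  signed-twice zero    a T = refl
  signed-twice (suc m) a T = trans (-‿cong (signed-neg m (signed m a) T)) (trans (-‿involutive _) (signed-twice m a T))

  ι-signed : ∀ {n} (g : Covector n) m (a : Chain n) → ι g (signed m a) ≐ signed m (ι g a)
  ι-signed g zero    a T = refl
  ι-signed g (suc m) a T = trans (ι-neg g (signed m a) T) (-‿cong (ι-signed g m a T))

  ι-It : ∀ {n} (g : Covector n) (h : ℕ → Covector n) m (a : Chain n) → ι g (It h m a) ≐ signed m (It h m (ι g a))
  ι-It g h zero    a T = refl
  ι-It g h (suc m) a T = trans (ι-anticomm g (h m) (It h m a) T)
    (-‿cong (trans (ι-cong (ι-It g h m a) T) (ι-signed (h m) m (It h m (ι g a)) T)))

  It-ext : ∀ {n} (h : ℕ → Covector n) w m (a : Chain n) → (∀ i → h i w ≈ 0#) → It h m (ext w a) ≐ signed m (ext w (It h m a))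
  It-ext h w zero    a e T = refl
  It-ext h w (suc m) a e T = trans (ι-cong (It-ext h w m a e) T) (trans (ι-signed (h m) m (ext w (It h m a)) T)
    (trans (signed-cong m (λ U → trans (ι-ext (h m) w (It h m a) U) (trans (+-congʳ (trans (*-congʳ (e m)) (zeroˡ _))) (+-identityˡ _))) T)
      (signed-neg m (ext w (It h (suc m) a)) T)))

  It-head : ∀ {n} (h : ℕ → Covector n) m (a : Chain n) → It h (suc m) a ≐ It (h ∘ suc) m (ι (h 0) a)
  It-head h zero    a T = refl
  It-head h (suc m) a T = ι-cong (It-head h m a) T

  It-zero : ∀ {n} (h : ℕ → Covector n) m {a : Chain n} → (∀ T → a T ≈ 0#) → ∀ T → It h m a T ≈ 0#
  It-zero h zero    e = e
  It-zero h (suc m) e = ι-zero (h m) (It-zero h m e)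

-- Exterior products, coordinates and initial monomials

module Initial {c ℓ} (R : CommutativeRing c ℓ) where
  open CommutativeRing R hiding (zero)
  open import Algebra.Properties.Ring ring using (-0#≈0#; -‿distribˡ-*; -‿involutive)
  open IntegerSolver R
  open Exterior R

  Regular : Carrier → Set (c ⊔ ℓ)
  Regular x = ∀ y → x * y ≈ 0# → y ≈ 0#

  Regular-cong : ∀ {x y} → x ≈ y → Regular x → Regular y
  Regular-cong e r z h = r z (trans (*-congʳ e) h)

  Regular-neg : ∀ {x} → Regular x → Regular (- x)
  Regular-neg {x} r z h = r z (trans (solve 2 (λ x z → x :* z := :- ((:- x) :* z)) refl x z) (trans (-‿cong h) -0#≈0#))

  Regular-* : ∀ {x y} → Regular x → Regular y → Regular (x * y)
  Regular-* {x} {y} r s z h = s z (r (y * z) (trans (sym (*-assoc x y z)) h))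

  Regular-1 : Regular 1#
  Regular-1 y h = trans (sym (*-identityˡ y)) h

  -- The grade involution, the sign (-1) to the number of elements; it enters the antiderivation
  -- rule `ι-⋀` for contractions of a product.
  bar : ∀ {n} → Chain n → Chain n
  bar a []          = a []
  bar a (false ∷ T) = bar (a ∘ (false ∷_)) T
  bar a (true ∷ T)  = - bar (a ∘ (true ∷_)) T

  infixl 7 _⋀_
  _⋀_ : ∀ {n} → Chain n → Chain n → Chain n
  (a ⋀ b) []          = a [] * b []
  (a ⋀ b) (false ∷ T) = ((a ∘ (false ∷_)) ⋀ (b ∘ (false ∷_))) T
  (a ⋀ b) (true ∷ T)  = ((a ∘ (true ∷_)) ⋀ (b ∘ (false ∷_))) T + (bar (a ∘ (false ∷_)) ⋀ (b ∘ (true ∷_))) T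

  bar-linear : ∀ {n} s s′ (y z : Chain n) → bar (λ T → s * y T + s′ * z T) ≐ λ T → s * bar y T + s′ * bar z T
  bar-linear s s′ y z []          = refl
  bar-linear s s′ y z (false ∷ T) = bar-linear s s′ (y ∘ (false ∷_)) (z ∘ (false ∷_)) T
  bar-linear s s′ y z (true ∷ T)  = trans (-‿cong (bar-linear s s′ (y ∘ (true ∷_)) (z ∘ (true ∷_)) T))
    (solve 4 (λ s s′ a b → :- (s :* a :+ s′ :* b) := s :* (:- a) :+ s′ :* (:- b)) refl s s′ _ _)

  bar-cong : ∀ {n} {y z : Chain n} → y ≐ z → bar y ≐ bar z
  bar-cong e []          = e []
  bar-cong e (false ∷ T) = bar-cong (e ∘ (false ∷_)) T
  bar-cong e (true ∷ T)  = -‿cong (bar-cong (e ∘ (true ∷_)) T)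

  bar-neg : ∀ {n} (y : Chain n) → bar (λ T → - y T) ≐ λ T → - bar y T
  bar-neg y []          = refl
  bar-neg y (false ∷ T) = bar-neg (y ∘ (false ∷_)) T
  bar-neg y (true ∷ T)  = -‿cong (bar-neg (y ∘ (true ∷_)) T)

  bar-bar : ∀ {n} (y : Chain n) → bar (bar y) ≐ y
  bar-bar y []          = refl
  bar-bar y (false ∷ T) = bar-bar (y ∘ (false ∷_)) T
  bar-bar y (true ∷ T)  = trans (-‿cong (bar-neg (bar (y ∘ (true ∷_))) T)) (trans (-‿involutive _) (bar-bar (y ∘ (true ∷_)) T))

  bar-± : ∀ {n} (y : Chain n) T → bar y T ≈ y T ⊎ bar y T ≈ - y T
  bar-± y []          = inj₁ refl
  bar-± y (false ∷ T) = bar-± (y ∘ (false ∷_)) T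
  bar-± y (true ∷ T) with bar-± (y ∘ (true ∷_)) T
  ... | inj₁ e = inj₂ (-‿cong e)
  ... | inj₂ e = inj₁ (trans (-‿cong e) (-‿involutive _))

  bar-* : ∀ {n} (y : Chain n) T {z} → y T * z ≈ 0# → bar y T * z ≈ 0#
  bar-* y T h with bar-± y T
  ... | inj₁ e = trans (*-congʳ e) h
  ... | inj₂ e = trans (*-congʳ e) (trans (sym (-‿distribˡ-* _ _)) (trans (-‿cong h) -0#≈0#))

  bar-*⁻¹ : ∀ {n} (y : Chain n) T {z} → bar y T * z ≈ 0# → y T * z ≈ 0#
  bar-*⁻¹ y T h = trans (*-congʳ (sym (bar-bar y T))) (bar-* (bar y) T h)

  ι-bar : ∀ {n} (g : Covector n) a → bar (ι g a) ≐ λ T → - ι g (bar a) T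
  ι-bar {zero} g a [] = sym -0#≈0#
  ι-bar {suc n} g a (false ∷ T) = trans (bar-cong (λ U → +-congˡ (sym (*-identityˡ _))) T)
    (trans (bar-linear (g zero) 1# (a ∘ (true ∷_)) (ι (g ∘ suc) (a ∘ (false ∷_))) T)
      (trans (+-congˡ (*-congˡ (ι-bar (g ∘ suc) (a ∘ (false ∷_)) T)))
        (solve 3 (λ g x y → g :* x :+ :1 :* (:- y) := :- (g :* (:- x) :+ y)) refl _ _ _)))
  ι-bar {suc n} g a (true ∷ T) = -‿cong (trans (bar-neg (ι (g ∘ suc) (a ∘ (true ∷_))) T)
    (trans (-‿cong (ι-bar (g ∘ suc) (a ∘ (true ∷_)) T))
      (trans (-‿involutive _) (sym (trans (-‿cong (ι-neg (g ∘ suc) (bar (a ∘ (true ∷_))) T)) (-‿involutive _))))))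

  ⋀-cong : ∀ {n} {a a′ b b′ : Chain n} → a ≐ a′ → b ≐ b′ → a ⋀ b ≐ a′ ⋀ b′
  ⋀-cong e f []          = *-cong (e []) (f [])
  ⋀-cong e f (false ∷ T) = ⋀-cong (e ∘ (false ∷_)) (f ∘ (false ∷_)) T
  ⋀-cong e f (true ∷ T)  = +-cong (⋀-cong (e ∘ (true ∷_)) (f ∘ (false ∷_)) T) (⋀-cong (bar-cong (e ∘ (false ∷_))) (f ∘ (true ∷_)) T)

  ⋀-linearˡ : ∀ {n} s s′ (a a′ b : Chain n) → (λ T → s * a T + s′ * a′ T) ⋀ b ≐ λ T → s * (a ⋀ b) T + s′ * (a′ ⋀ b) T
  ⋀-linearˡ s s′ a a′ b []          = solve 5 (λ s s′ a a′ b → (s :* a :+ s′ :* a′) :* b := s :* (a :* b) :+ s′ :* (a′ :* b)) refl s s′ _ _ _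
  ⋀-linearˡ s s′ a a′ b (false ∷ T) = ⋀-linearˡ s s′ (a ∘ (false ∷_)) (a′ ∘ (false ∷_)) (b ∘ (false ∷_)) T
  ⋀-linearˡ s s′ a a′ b (true ∷ T)  = trans (+-cong (⋀-linearˡ s s′ (a ∘ (true ∷_)) (a′ ∘ (true ∷_)) (b ∘ (false ∷_)) T)
      (trans (⋀-cong (bar-linear s s′ (a ∘ (false ∷_)) (a′ ∘ (false ∷_))) (λ _ → refl) T) (⋀-linearˡ s s′ (bar (a ∘ (false ∷_))) (bar (a′ ∘ (false ∷_))) (b ∘ (true ∷_)) T)))
    (solve 6 (λ s s′ x x′ y y′ → (s :* x :+ s′ :* x′) :+ (s :* y :+ s′ :* y′) := s :* (x :+ y) :+ s′ :* (x′ :+ y′)) refl s s′ _ _ _ _)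

  ⋀-linearʳ : ∀ {n} s s′ (a b b′ : Chain n) → a ⋀ (λ T → s * b T + s′ * b′ T) ≐ λ T → s * (a ⋀ b) T + s′ * (a ⋀ b′) T
  ⋀-linearʳ s s′ a b b′ []          = solve 5 (λ s s′ a b b′ → a :* (s :* b :+ s′ :* b′) := s :* (a :* b) :+ s′ :* (a :* b′)) refl s s′ _ _ _
  ⋀-linearʳ s s′ a b b′ (false ∷ T) = ⋀-linearʳ s s′ (a ∘ (false ∷_)) (b ∘ (false ∷_)) (b′ ∘ (false ∷_)) T
  ⋀-linearʳ s s′ a b b′ (true ∷ T)  = trans (+-cong (⋀-linearʳ s s′ (a ∘ (true ∷_)) (b ∘ (false ∷_)) (b′ ∘ (false ∷_)) T) (⋀-linearʳ s s′ (bar (a ∘ (false ∷_))) (b ∘ (true ∷_)) (b′ ∘ (true ∷_)) T))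
    (solve 6 (λ s s′ x x′ y y′ → (s :* x :+ s′ :* x′) :+ (s :* y :+ s′ :* y′) := s :* (x :+ y) :+ s′ :* (x′ :+ y′)) refl s s′ _ _ _ _)

  ⋀-zero : ∀ {n} {a b : Chain n} → (∀ S U → disjointᵇ S U ≡ true → a S * b U ≈ 0#) → ∀ T → (a ⋀ b) T ≈ 0#
  ⋀-zero h []          = h [] [] ≡.refl
  ⋀-zero h (false ∷ T) = ⋀-zero (λ S U → h (false ∷ S) (false ∷ U)) T
  ⋀-zero {a = a} h (true ∷ T) = trans (+-cong (⋀-zero (λ S U → h (true ∷ S) (false ∷ U)) T)
    (⋀-zero (λ S U d → bar-* (a ∘ (false ∷_)) S (h (false ∷ S) (true ∷ U) d)) T)) (+-identityˡ 0#)

  ⋀-negˡ : ∀ {n} (a b : Chain n) → (λ T → - a T) ⋀ b ≐ λ T → - (a ⋀ b) T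
  ⋀-negˡ a b T = trans (⋀-cong {b = b} (λ U → solve 1 (λ x → :- x := (:- :1) :* x :+ :0 :* x) refl (a U)) (λ _ → refl) T)
    (trans (⋀-linearˡ (- 1#) 0# a a b T) (solve 1 (λ x → (:- :1) :* x :+ :0 :* x := :- x) refl _))

  ⋀-negʳ : ∀ {n} (a b : Chain n) → a ⋀ (λ T → - b T) ≐ λ T → - (a ⋀ b) T
  ⋀-negʳ a b T = trans (⋀-cong {a = a} (λ _ → refl) (λ U → solve 1 (λ x → :- x := (:- :1) :* x :+ :0 :* x) refl (b U)) T)
    (trans (⋀-linearʳ (- 1#) 0# a b b T) (solve 1 (λ x → (:- :1) :* x :+ :0 :* x := :- x) refl _))

  ι-⋀ : ∀ {n} (g : Covector n) a b → ι g (a ⋀ b) ≐ λ T → (ι g a ⋀ b) T + (bar a ⋀ ι g b) T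
  ι-⋀ {zero} g a b [] = solve 2 (λ a b → :0 := :0 :* b :+ a :* :0) refl (a []) (b [])
  ι-⋀ {suc n} g a b (false ∷ T) = trans (+-congˡ (ι-⋀ (g ∘ suc) a₀ b₀ T))
    (sym (trans (+-cong
      (trans (⋀-cong (λ U → +-congˡ (sym (*-identityˡ _))) (λ _ → refl) T) (⋀-linearˡ (g zero) 1# a₁ (ι (g ∘ suc) a₀) b₀ T))
      (trans (⋀-cong {a = bar a₀} (λ _ → refl) (λ U → +-congˡ (sym (*-identityˡ _))) T) (⋀-linearʳ (g zero) 1# (bar a₀) b₁ (ι (g ∘ suc) b₀) T)))
      (solve 5 (λ g x y z w → (g :* x :+ :1 :* y) :+ (g :* z :+ :1 :* w) := g :* (x :+ z) :+ (y :+ w)) refl _ _ _ _ _)))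
    where
    a₀ = a ∘ (false ∷_)
    a₁ = a ∘ (true ∷_)
    b₀ = b ∘ (false ∷_)
    b₁ = b ∘ (true ∷_)
  ι-⋀ {suc n} g a b (true ∷ T) = trans (-‿cong (trans (ι-+ g′ (a₁ ⋀ b₀) (bar a₀ ⋀ b₁) T) (+-cong (ι-⋀ g′ a₁ b₀ T) (ι-⋀ g′ (bar a₀) b₁ T))))
    (trans (-‿cong (+-congˡ (+-cong
        (trans (⋀-cong {b = b₁} (λ U → trans (sym (-‿involutive _)) (-‿cong (sym (ι-bar g′ a₀ U)))) (λ _ → refl) T) (⋀-negˡ (bar (ι g′ a₀)) b₁ T))
        (⋀-cong {b = ι g′ b₁} (bar-bar a₀) (λ _ → refl) T))))
      (sym (trans (+-cong
          (+-cong (⋀-negˡ (ι g′ a₁) b₀ T)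
            (trans (⋀-cong {b = b₁} (λ U → trans (bar-cong (λ V → +-congˡ (sym (*-identityˡ _))) U) (bar-linear (g zero) 1# a₁ (ι g′ a₀) U)) (λ _ → refl) T)
              (⋀-linearˡ (g zero) 1# (bar a₁) (bar (ι g′ a₀)) b₁ T)))
          (+-cong
            (trans (⋀-negˡ (bar a₁) (λ U → g zero * b₁ U + ι g′ b₀ U) T) (-‿cong (trans (⋀-cong {a = bar a₁} (λ _ → refl) (λ U → +-congˡ (sym (*-identityˡ _))) T) (⋀-linearʳ (g zero) 1# (bar a₁) b₁ (ι g′ b₀) T))))
            (trans (⋀-cong {b = λ U → - ι g′ b₁ U} (bar-bar a₀) (λ _ → refl) T) (⋀-negʳ a₀ (ι g′ b₁) T))))
        (solve 6 (λ g p q x y z → (:- p :+ (g :* q :+ :1 :* x)) :+ (:- (g :* q :+ :1 :* y) :+ :- z) := :- ((p :+ y) :+ (:- x :+ z))) refl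
          (g zero) ((ι g′ a₁ ⋀ b₀) T) ((bar a₁ ⋀ b₁) T) ((bar (ι g′ a₀) ⋀ b₁) T) ((bar a₁ ⋀ ι g′ b₀) T) ((a₀ ⋀ ι g′ b₁) T)))))
    where
    g′ = g ∘ suc
    a₀ = a ∘ (false ∷_)
    a₁ = a ∘ (true ∷_)
    b₀ = b ∘ (false ∷_)
    b₁ = b ∘ (true ∷_)

  -- The coordinates of a chain with respect to a list of covectors: at T the chain is contracted
  -- with the covectors chosen by T and read off at the empty set. It is the map of exterior
  -- algebras induced by the list, hence compatible with products and contractions; the covectors
  -- may be dependent and more than n in number.
  φ : ∀ {n M} → Vec (Covector n) M → Chain n → Chain M
  φ []       a []          = a ⊥
  φ (f ∷ fs) a (false ∷ T) = φ fs a T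
  φ (f ∷ fs) a (true ∷ T)  = φ fs (ι f a) T

  φ-cong : ∀ {n M} (fs : Vec (Covector n) M) {a b} → a ≐ b → φ fs a ≐ φ fs b
  φ-cong []       e []          = e ⊥
  φ-cong (f ∷ fs) e (false ∷ T) = φ-cong fs e T
  φ-cong (f ∷ fs) e (true ∷ T)  = φ-cong fs (ι-cong e) T

  φ-linear : ∀ {n M} (fs : Vec (Covector n) M) s s′ a b → φ fs (λ T → s * a T + s′ * b T) ≐ λ T → s * φ fs a T + s′ * φ fs b T
  φ-linear []       s s′ a b []          = refl
  φ-linear (f ∷ fs) s s′ a b (false ∷ T) = φ-linear fs s s′ a b T
  φ-linear (f ∷ fs) s s′ a b (true ∷ T)  = trans (φ-cong fs (ι-linear f s s′ a b) T) (φ-linear fs s s′ (ι f a) (ι f b) T)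

  φ-neg : ∀ {n M} (fs : Vec (Covector n) M) a → φ fs (λ T → - a T) ≐ λ T → - φ fs a T
  φ-neg fs a T = trans (φ-cong fs (λ U → solve 1 (λ x → :- x := (:- :1) :* x :+ :0 :* x) refl (a U)) T)
    (trans (φ-linear fs (- 1#) 0# a a T) (solve 1 (λ x → (:- :1) :* x :+ :0 :* x := :- x) refl _))

  φ-zero : ∀ {n M} (fs : Vec (Covector n) M) {a} → (∀ S → a S ≈ 0#) → ∀ T → φ fs a T ≈ 0#
  φ-zero []       e []          = e ⊥
  φ-zero (f ∷ fs) e (false ∷ T) = φ-zero fs e T
  φ-zero (f ∷ fs) e (true ∷ T)  = φ-zero fs (ι-zero f e) T

  φ-bar : ∀ {n M} (fs : Vec (Covector n) M) a → φ fs (bar a) ≐ bar (φ fs a)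
  φ-bar {n} [] a [] = bar-⊥ a
    where
    bar-⊥ : ∀ {n} (a : Chain n) → bar a ⊥ ≈ a ⊥
    bar-⊥ {zero}  a = refl
    bar-⊥ {suc n} a = bar-⊥ (a ∘ (false ∷_))
  φ-bar (f ∷ fs) a (false ∷ T) = φ-bar fs a T
  φ-bar (f ∷ fs) a (true ∷ T)  = trans (φ-cong fs (λ U → trans (sym (-‿involutive _)) (-‿cong (sym (ι-bar f a U)))) T)
    (trans (φ-neg fs (bar (ι f a)) T) (-‿cong (φ-bar fs (ι f a) T)))

  φ-⋀ : ∀ {n M} (fs : Vec (Covector n) M) a b → φ fs (a ⋀ b) ≐ φ fs a ⋀ φ fs b
  φ-⋀ [] a b [] = ⋀-⊥ a b
    where
    ⋀-⊥ : ∀ {n} (a b : Chain n) → (a ⋀ b) ⊥ ≈ a ⊥ * b ⊥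
    ⋀-⊥ {zero}  a b = refl
    ⋀-⊥ {suc n} a b = ⋀-⊥ (a ∘ (false ∷_)) (b ∘ (false ∷_))
  φ-⋀ (f ∷ fs) a b (false ∷ T) = φ-⋀ fs a b T
  φ-⋀ (f ∷ fs) a b (true ∷ T)  = trans (φ-cong fs (λ U → trans (ι-⋀ f a b U) (sym (+-cong (*-identityˡ _) (*-identityˡ _)))) T)
    (trans (φ-linear fs 1# 1# (ι f a ⋀ b) (bar a ⋀ ι f b) T)
      (+-cong (trans (*-identityˡ _) (φ-⋀ fs (ι f a) b T))
        (trans (*-identityˡ _) (trans (φ-⋀ fs (bar a) (ι f b) T) (⋀-cong {b = φ fs (ι f b)} (φ-bar fs a) (λ _ → refl) T)))))

  ι-0 : ∀ {n} {g : Covector n} {a : Chain n} → (∀ v → g v ≈ 0#) → ∀ T → ι g a T ≈ 0#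
  ι-0 {g = g} {a} e T = trans (ι-local {g = g} {z = a} 0# T λ v _ → trans (*-congʳ (e v)) (trans (zeroˡ _) (sym (zeroˡ _)))) (zeroˡ _)

  φ-ι : ∀ {n M} (fs : Vec (Covector n) M) w a → φ fs (ι (lookup fs w) a) ≐ ι (coord w) (φ fs a)
  φ-ι (f ∷ fs) zero    a (false ∷ T) = sym (trans (+-cong (*-identityˡ _) (ι-0 (λ _ → refl) T)) (+-identityʳ _))
  φ-ι (f ∷ fs) zero    a (true ∷ T)  = trans (φ-zero fs (ι-square f a) T) (sym (trans (-‿cong (ι-0 (λ _ → refl) T)) -0#≈0#))
  φ-ι (f ∷ fs) (suc w) a (false ∷ T) = trans (φ-ι fs w a T) (sym (trans (+-congʳ (zeroˡ _)) (+-identityˡ _)))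
  φ-ι (f ∷ fs) (suc w) a (true ∷ T)  = trans (φ-cong fs (ι-anticomm f (lookup fs w) a) T)
    (trans (φ-neg fs (ι (lookup fs w) (ι f a)) T) (-‿cong (φ-ι fs w (ι f a) T)))

  Homogeneous : ∀ {n} → ℕ → Chain n → Set ℓ
  Homogeneous p a = ∀ S → ∣ S ∣ ≢ p → a S ≈ 0#

  φ-homogeneous : ∀ {n M} (fs : Vec (Covector n) M) p a → Homogeneous p a → Homogeneous p (φ fs a)
  φ-homogeneous {n} []       p a h []          ne = h ⊥ (λ e → ne (≡.trans (≡.sym (∣⊥∣≡0 n)) e))
  φ-homogeneous     (f ∷ fs) p a h (false ∷ T) ne = φ-homogeneous fs p a h T ne
  φ-homogeneous     (f ∷ fs) zero    a h (true ∷ T)  ne = φ-zero fs (λ S → ι-vanish {g = f} S λ v v∉S → h (ins v S) λ e → absurd (≡.trans (≡.sym (size-ins v S v∉S)) e)) T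
    where
    absurd : ∀ {k} → suc k ≢ 0
    absurd ()
  φ-homogeneous     (f ∷ fs) (suc p) a h (true ∷ T)  ne = φ-homogeneous fs p (ι f a)
    (λ S ne′ → ι-vanish {g = f} S λ v v∉S → h (ins v S) λ e → ne′ (ℕ.suc-injective (≡.trans (≡.sym (size-ins v S v∉S)) e))) T (ne ∘ ≡.cong suc)

  -- Init T x says that x vanishes on every set preceding T lexicographically, where of two sets
  -- the one containing the first label on which they differ comes first.

  Init : ∀ {M} → Subset M → Chain M → Set ℓ
  Init []          x = ⊤
  Init (true ∷ T)  x = Init T (x ∘ (true ∷_))
  Init (false ∷ T) x = (∀ S → x (true ∷ S) ≈ 0#) × Init T (x ∘ (false ∷_))

  Lead : ∀ {M} → Subset M → Chain M → Set (c ⊔ ℓ)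
  Lead T x = Init T x × Regular (x T)

  Init-cong : ∀ {M} (T : Subset M) {x y} → x ≐ y → Init T x → Init T y
  Init-cong []          e i       = tt
  Init-cong (true ∷ T)  e i       = Init-cong T (e ∘ (true ∷_)) i
  Init-cong (false ∷ T) e (z , i) = (λ S → trans (sym (e (true ∷ S))) (z S)) , Init-cong T (e ∘ (false ∷_)) i

  Init-map : ∀ {M} (T : Subset M) {x y} → (∀ S → x S ≈ 0# → y S ≈ 0#) → Init T x → Init T y
  Init-map []          f i       = tt
  Init-map (true ∷ T)  f i       = Init-map T (f ∘ (true ∷_)) i
  Init-map (false ∷ T) f (z , i) = (λ S → f (true ∷ S) (z S)) , Init-map T (f ∘ (false ∷_)) i

  Lead-cong : ∀ {M} (T : Subset M) {x y} → x ≐ y → Lead T x → Lead T y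
  Lead-cong T e (i , r) = Init-cong T e i , Regular-cong (e T) r

  Lead-scale : ∀ {M} (T : Subset M) {x} s → Regular s → Lead T x → Lead T (λ S → s * x S)
  Lead-scale T s rs (i , r) = Init-map T (λ S e → trans (*-congˡ e) (zeroʳ s)) i , Regular-* rs r

  -- If S and V are disjoint with union `T ∪ U` but differ from T and U, the first label assigned
  -- differently puts S before T or V before U. Hence only the product of the two leading values
  -- survives at `T ∪ U`, up to sign.
  Init-⋀ : ∀ {M} (T U : Subset M) {x y} → Init T x → Init U y → disjointᵇ T U ≡ true → (x ⋀ y) (T ∪ U) ≈ 0# → x T * y U ≈ 0#
  Init-⋀ []          []          i       j       d h = h
  Init-⋀ (false ∷ T) (false ∷ U) (_ , i) (_ , j) d h = Init-⋀ T U i j d h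
  Init-⋀ (true ∷ T)  (false ∷ U) {x} {y} i       (z , j) d h = Init-⋀ T U i j d
    (trans (sym (trans (+-congˡ (⋀-zero {a = bar (x ∘ (false ∷_))} (λ S V _ → trans (*-congˡ (z V)) (zeroʳ _)) (T ∪ U))) (+-identityʳ _))) h)
  Init-⋀ (false ∷ T) (true ∷ U)  {x} {y} (z , i) j       d h = bar-*⁻¹ (x ∘ (false ∷_)) T (Init-⋀ T U
    (Init-map T (λ S e → trans (sym (*-identityʳ _)) (bar-* (x ∘ (false ∷_)) S (trans (*-identityʳ _) e))) i) j d
    (trans (sym (trans (+-congʳ (⋀-zero {b = y ∘ (false ∷_)} (λ S V _ → trans (*-congʳ (z S)) (zeroˡ _)) (T ∪ U))) (+-identityˡ _))) h))

  -- Contraction with `coord w` reads a chain, up to sign, on the sets containing w, and inserting w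
  -- into two sets without it does not change their order.
  Lead-contract : ∀ {M} (T : Subset M) w {x} → lookup T w ≡ true → Lead T x → Lead (del w T) (ι (coord w) x)
  Lead-contract (true ∷ T) zero {x} _ (i , r) =
    ((λ S → trans (-‿cong (ι-0 (λ _ → refl) S)) -0#≈0#) , Init-cong T (sym ∘ e) i) , Regular-cong (sym (e T)) r
    where
    e : ∀ S → ι (coord zero) x (false ∷ S) ≈ x (true ∷ S)
    e S = trans (+-cong (*-identityˡ _) (ι-0 (λ _ → refl) S)) (+-identityʳ _)
  Lead-contract (true ∷ T) (suc w) w∈T l with Lead-contract T w w∈T l
  ... | i , r = Init-map (del w T) (λ S e → trans (-‿cong e) -0#≈0#) i , Regular-neg r
  Lead-contract (false ∷ T) (suc w) {x} w∈T ((z , i) , r) with Lead-contract T w w∈T (i , r)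
  ... | i′ , r′ = ((λ S → trans (-‿cong (ι-zero (coord w) z S)) -0#≈0#) , Init-cong (del w T) (sym ∘ e) i′) , Regular-cong (sym (e (del w T))) r′
    where
    e : ∀ S → ι (coord (suc w)) x (false ∷ S) ≈ ι (coord w) (x ∘ (false ∷_)) S
    e S = trans (+-congʳ (zeroˡ _)) (+-identityˡ _)

  lift₀ : ∀ {n} → Covector n → Covector (suc n)
  lift₀ g zero    = 0#
  lift₀ g (suc v) = g v

  coords : ∀ n → Vec (Covector n) n
  coords zero    = []
  coords (suc n) = coord zero ∷ Vec.map lift₀ (coords n)

  φ-lift : ∀ {n M} (fs : Vec (Covector n) M) a → φ (Vec.map lift₀ fs) a ≐ φ fs (a ∘ (false ∷_))
  φ-lift []       a []          = refl
  φ-lift (f ∷ fs) a (false ∷ T) = φ-lift fs a T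
  φ-lift (f ∷ fs) a (true ∷ T)  = trans (φ-lift fs (ι (lift₀ f) a) T) (φ-cong fs (λ S → trans (+-congʳ (zeroˡ _)) (+-identityˡ _)) T)

  φ-coords : ∀ {n} (a : Chain n) → φ (coords n) a ≐ a
  φ-coords {zero}  a []          = refl
  φ-coords {suc n} a (false ∷ T) = trans (φ-lift (coords n) a T) (φ-coords (a ∘ (false ∷_)) T)
  φ-coords {suc n} a (true ∷ T)  = trans (φ-lift (coords n) (ι (coord zero) a) T)
    (trans (φ-coords (ι (coord zero) a ∘ (false ∷_)) T) (trans (+-cong (*-identityˡ _) (ι-0 (λ _ → refl) T)) (+-identityʳ _)))

infixl 1 _>>=_
_>>=_ : ∀ {a b} {A : Set a} {B : Set b} → ¬ ¬ A → (A → ¬ ¬ B) → ¬ ¬ B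
(m >>= f) k = m λ x → f x k

return : ∀ {a} {A : Set a} → A → ¬ ¬ A
return x k = k x

-- Division-free elimination and families of initial sets

module Elimination {c ℓ} (R : CommutativeRing c ℓ)
  (1≉0 : ¬ CommutativeRing._≈_ R (CommutativeRing.1# R) (CommutativeRing.0# R))
  (dichotomy : ∀ x → ¬ ¬ (CommutativeRing._≈_ R x (CommutativeRing.0# R) ⊎ Initial.Regular R x)) where
  open CommutativeRing R hiding (zero)
  open import Algebra.Properties.Ring ring using (-0#≈0#)
  open IntegerSolver R
  open Exterior R
  open Initial R

  Regular⇒≉0 : ∀ {x} → Regular x → ¬ (x ≈ 0#)
  Regular⇒≉0 r e = 1≉0 (r 1# (trans (*-congʳ e) (zeroˡ 1#)))

  lc : ∀ {n k} → Vec Carrier k → Vec (Chain n) k → Chain n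
  lc []       []       T = 0#
  lc (s ∷ ss) (u ∷ us) T = s * u T + lc ss us T

  AllZero : ∀ {k} → Vec Carrier k → Set ℓ
  AllZero []       = ⊤
  AllZero (s ∷ ss) = s ≈ 0# × AllZero ss

  Span : ∀ {n k} → Vec (Chain n) k → Chain n → Set (c ⊔ ℓ)
  Span us a = Σ (Vec Carrier _) λ ss → lc ss us ≐ a

  infix 4 _◁_
  -- Inclusion of spans together with a transfer of coefficients that detects zero: independence of
  -- `us` is thereby inherited by `vs`, which is how the number of remaining vectors is controlled.
  _◁_ : ∀ {n k k′} → Vec (Chain n) k′ → Vec (Chain n) k → Set (c ⊔ ℓ)
  vs ◁ us = ∀ ss → Σ (Vec Carrier _) λ ts → (lc ts us ≐ lc ss vs) × (AllZero ts → AllZero ss)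

  ◁-refl : ∀ {n k} (us : Vec (Chain n) k) → us ◁ us
  ◁-refl us ss = ss , (λ _ → refl) , λ z → z

  ◁-trans : ∀ {n k k′ k″} {ws : Vec (Chain n) k″} {vs : Vec (Chain n) k′} {us : Vec (Chain n) k} → ws ◁ vs → vs ◁ us → ws ◁ us
  ◁-trans f g ss with f ss
  ... | ts , e , z with g ts
  ...   | rs , e′ , z′ = rs , (λ T → trans (e′ T) (e T)) , z ∘ z′

  ◁-span : ∀ {n k k′} {vs : Vec (Chain n) k′} {us : Vec (Chain n) k} → vs ◁ us → ∀ {a} → Span vs a → Span us a
  ◁-span f (ss , e) with f ss
  ... | ts , e′ , _ = ts , λ T → trans (e′ T) (e T)

  scale-lc : ∀ {n k} s (ss : Vec Carrier k) (us : Vec (Chain n) k) → lc (Vec.map (s *_) ss) us ≐ λ T → s * lc ss us T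
  scale-lc s []       []       T = sym (zeroʳ s)
  scale-lc s (t ∷ ss) (u ∷ us) T = trans (+-congˡ (scale-lc s ss us T)) (solve 4 (λ s t u l → (s :* t) :* u :+ s :* l := s :* (t :* u :+ l)) refl s t _ _)

  scale-zero : ∀ {k} s → Regular s → (ss : Vec Carrier k) → AllZero (Vec.map (s *_) ss) → AllZero ss
  scale-zero s r []       _       = tt
  scale-zero s r (t ∷ ss) (z , h) = r t z , scale-zero s r ss h

  record Linear {n} (e : Chain n → Carrier) : Set (c ⊔ ℓ) where
    field
      e-cong : ∀ {a b} → a ≐ b → e a ≈ e b
      e-lin  : ∀ s s′ a b → e (λ T → s * a T + s′ * b T) ≈ s * e a + s′ * e b

    e-zero : ∀ {a} → (∀ T → a T ≈ 0#) → e a ≈ 0#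
    e-zero {a} h = trans (e-cong λ T → trans (h T) (solve 1 (λ x → :0 := :0 :* x :+ :0 :* x) refl (a T)))
      (trans (e-lin 0# 0# a a) (solve 1 (λ x → :0 :* x :+ :0 :* x := :0) refl _))

    e-cons : ∀ {k} s (ss : Vec Carrier k) u us → e (lc (s ∷ ss) (u ∷ us)) ≈ s * e u + e (lc ss us)
    e-cons s ss u us = trans (e-cong λ T → +-congˡ (sym (*-identityˡ _))) (trans (e-lin s 1# u (lc ss us)) (+-congˡ (*-identityˡ _)))

    e-scale : ∀ s a → e (λ T → s * a T) ≈ s * e a
    e-scale s a = trans (e-cong λ T → solve 2 (λ s x → s :* x := s :* x :+ :0 :* x) refl s (a T))
      (trans (e-lin s 0# a a) (solve 2 (λ s x → s :* x :+ :0 :* x := s :* x) refl s _))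

  -- In the absence of fractions `vs` exhausts the kernel of e only up to regular factors, which is
  -- the content of the last component of `some`.
  data Pivot {n} (e : Chain n → Carrier) : ∀ {k} → Vec (Chain n) k → Set (c ⊔ ℓ) where
    none : ∀ {k} {us : Vec (Chain n) k} → (∀ ss → e (lc ss us) ≈ 0#) → Pivot e us
    some : ∀ {k} {us : Vec (Chain n) (suc k)} (p : Chain n) → Span us p → Regular (e p) →
      (vs : Vec (Chain n) k) → vs ◁ us → (∀ ss → e (lc ss vs) ≈ 0#) →
      (∀ ss → e (lc ss us) ≈ 0# → Σ Carrier λ δ → Regular δ × Span vs (λ T → δ * lc ss us T)) → Pivot e us

  module _ {n} {e : Chain n → Carrier} (L : Linear e) where
    open Linear L

    reduce : ∀ {k} → Chain n → Vec (Chain n) k → Vec (Chain n) k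
    reduce u = Vec.map λ v T → e u * v T + - e v * u T

    reduce-lc : ∀ {k} u (ss : Vec Carrier k) us → lc ss (reduce u us) ≐ λ T → e u * lc ss us T + - e (lc ss us) * u T
    reduce-lc u []       []       T = sym (trans (+-cong (zeroʳ _) (trans (*-congʳ (trans (-‿cong (e-zero λ _ → refl)) -0#≈0#)) (zeroˡ _))) (+-identityˡ 0#))
    reduce-lc u (s ∷ ss) (v ∷ us) T = trans (+-congˡ (reduce-lc u ss us T))
      (sym (trans (+-congˡ (*-congʳ (-‿cong (e-cons s ss v us))))
        (solve 7 (λ s eu v ev u l el → eu :* (s :* v :+ l) :+ (:- (s :* ev :+ el)) :* u := s :* (eu :* v :+ (:- ev) :* u) :+ (eu :* l :+ (:- el) :* u)) refl s (e u) (v T) (e v) (u T) _ _)))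

    zeros : ∀ k → Vec Carrier k
    zeros k = Vec.replicate k 0#

    zeros-lc : ∀ {k} (us : Vec (Chain n) k) T → lc (zeros k) us T ≈ 0#
    zeros-lc []       T = refl
    zeros-lc (u ∷ us) T = trans (+-cong (zeroˡ _) (zeros-lc us T)) (+-identityˡ 0#)

    pivot : ∀ {k} (us : Vec (Chain n) k) → ¬ ¬ Pivot e us
    pivot [] = return (none λ where [] → e-zero λ _ → refl)
    pivot {suc k} (u ∷ us) = dichotomy (e u) >>= λ where
      (inj₂ r) → return (some u
        (1# ∷ zeros k , λ T → trans (+-cong (*-identityˡ _) (zeros-lc us T)) (+-identityʳ _)) r
        (reduce u us)
        (λ ss → - e (lc ss us) ∷ Vec.map (e u *_) ss
              , (λ T → trans (+-congˡ (scale-lc (e u) ss us T)) (trans (+-comm _ _) (sym (reduce-lc u ss us T))))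
              , λ z → scale-zero (e u) r ss (proj₂ z))
        (λ ss → trans (e-cong (reduce-lc u ss us)) (trans (e-lin (e u) (- e (lc ss us)) (lc ss us) u)
          (solve 2 (λ x y → x :* y :+ (:- y) :* x := :0) refl (e u) (e (lc ss us)))))
        (λ where (s ∷ ss) h → e u , r , ss , λ T → trans (reduce-lc u ss us T)
                   (trans (solve 5 (λ s eu u l el → eu :* l :+ (:- el) :* u := eu :* (s :* u :+ l) :+ (:- (s :* eu :+ el)) :* u) refl s (e u) (u T) (lc ss us T) (e (lc ss us)))
                     (trans (+-congˡ (trans (*-congʳ (trans (-‿cong (trans (sym (e-cons s ss u us)) h)) -0#≈0#)) (zeroˡ _))) (+-identityʳ _)))))
      (inj₁ z) → pivot us >>= λ where
        (none h) → return (none λ where (s ∷ ss) → trans (e-cons s ss u us) (trans (+-cong (trans (*-congˡ z) (zeroʳ s)) (h ss)) (+-identityˡ 0#)))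
        (some p (ps , pe) r vs vs◁us h comp) → return (some p
          (0# ∷ ps , λ T → trans (+-cong (zeroˡ _) (pe T)) (+-identityˡ _)) r
          (u ∷ vs)
          (λ where (s ∷ ss) → let (ts , e′ , zz) = vs◁us ss in s ∷ ts , (λ T → +-congˡ (e′ T)) , λ (a , b) → a , zz b)
          (λ where (s ∷ ss) → trans (e-cons s ss u vs) (trans (+-cong (trans (*-congˡ z) (zeroʳ s)) (h ss)) (+-identityˡ 0#)))
          (λ where (s ∷ ss) q → let (δ , rδ , ts , e′) = comp ss (trans (sym (trans (e-cons s ss u us) (trans (+-congʳ (trans (*-congˡ z) (zeroʳ s))) (+-identityˡ _)))) q)
                                in δ , rδ , δ * s ∷ ts , λ T → trans (+-congˡ (e′ T)) (solve 4 (λ d s u l → (d :* s) :* u :+ d :* l := d :* (s :* u :+ l)) refl δ s (u T) _)))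

  -- Gaussian elimination in lexicographic order: the pivots are exactly the initial sets of
  -- elements of the span, and `vs` accounts, up to regular factors, for the elements with vanishing
  -- coordinates.
  record Echelon {n M k} (ev : Chain n → Chain M) (us : Vec (Chain n) k) : Set (c ⊔ ℓ) where
    field
      pivots   : Subset M → Bool
      rest     : ℕ
      vs       : Vec (Chain n) rest
      vs◁us    : vs ◁ us
      vanish   : ∀ ss T → ev (lc ss vs) T ≈ 0#
      count    : cnt pivots ℕ.+ rest ≡ k
      sound    : ∀ T → pivots T ≡ true → Σ (Chain n) λ a → Span us a × Lead T (ev a)
      complete : ∀ T a → Span us a → Lead T (ev a) → pivots T ≡ true
      residual : ∀ a → Span us a → (∀ T → ev a T ≈ 0#) → Σ Carrier λ δ → Regular δ × Span vs (λ T → δ * a T)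

  echelon : ∀ {n M k} (ev : Chain n → Chain M) → (∀ T → Linear (λ a → ev a T)) → (us : Vec (Chain n) k) → ¬ ¬ Echelon ev us
  echelon {M = zero} ev L us = pivot (L []) us >>= λ where
    (none h) → return record
      { pivots = λ _ → false ; rest = _ ; vs = us ; vs◁us = ◁-refl us ; vanish = λ { ss [] → h ss } ; count = ≡.refl
      ; sound = λ _ () ; complete = λ { [] a (ss , e) (_ , r) → ⊥-elim (Regular⇒≉0 r (trans (sym (Linear.e-cong (L []) e)) (h ss))) }
      ; residual = λ a (ss , e) _ → 1# , Regular-1 , ss , λ T → trans (e T) (sym (*-identityˡ _)) }
    (some p sp r vs i h comp) → return record
      { pivots = λ _ → true ; rest = _ ; vs = vs ; vs◁us = i ; vanish = λ { ss [] → h ss } ; count = ≡.refl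
      ; sound = λ { [] _ → p , sp , tt , r } ; complete = λ _ _ _ _ → ≡.refl
      ; residual = λ a (ss , e) z → let (δ , rδ , ts , e′) = comp ss (trans (Linear.e-cong (L []) e) (z [])) in
          δ , rδ , ts , λ T → trans (e′ T) (*-congˡ (e T)) }
  -- Sets containing the first label come first in the order, so their coordinates are eliminated
  -- first; the vectors left over vanish there and are treated on the sets without that label.
  echelon {n} {M = suc M} {k} ev L us = echelon (λ a → ev a ∘ (true ∷_)) (L ∘ (true ∷_)) us >>= λ E₁ →
    echelon (λ a → ev a ∘ (false ∷_)) (L ∘ (false ∷_)) (Echelon.vs E₁) >>= λ E₀ → return (combine E₁ E₀)
    where
    combine : (E₁ : Echelon (λ a → ev a ∘ (true ∷_)) us) → Echelon (λ a → ev a ∘ (false ∷_)) (Echelon.vs E₁) → Echelon ev us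
    combine E₁ E₀ = record
      { pivots = piv ; rest = E₀.rest ; vs = E₀.vs ; vs◁us = ◁-trans E₀.vs◁us E₁.vs◁us
      ; vanish = λ where
          ss (true ∷ T)  → let (ts , e , _) = E₀.vs◁us ss in trans (Linear.e-cong (L (true ∷ T)) (sym ∘ e)) (E₁.vanish ts T)
          ss (false ∷ T) → E₀.vanish ss T
      ; count = ≡.trans (≡.cong (ℕ._+ E₀.rest) (ℕ.+-comm (cnt E₀.pivots) (cnt E₁.pivots)))
          (≡.trans (ℕ.+-assoc (cnt E₁.pivots) (cnt E₀.pivots) E₀.rest) (≡.trans (≡.cong (cnt E₁.pivots ℕ.+_) E₀.count) E₁.count))
      ; sound = λ where
          (true ∷ T)  y → E₁.sound T y
          (false ∷ T) y → let (a , (ss , e) , i , r) = E₀.sound T y in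
            a , ◁-span E₁.vs◁us (ss , e) , ((λ S → trans (Linear.e-cong (L (true ∷ S)) (sym ∘ e)) (E₁.vanish ss S)) , i) , r
      ; complete = λ where
          (true ∷ T)  a sp l → E₁.complete T a sp l
          (false ∷ T) a sp ((z , i) , r) → let (δ , rδ , sp′) = E₁.residual a sp z in
            E₀.complete T _ sp′ (Lead-cong T (λ S → sym (Linear.e-scale (L (false ∷ S)) δ a)) (Lead-scale T δ rδ (i , r)))
      ; residual = λ a sp z → let (δ , rδ , sp′) = E₁.residual a sp (z ∘ (true ∷_))
                                  (δ′ , rδ′ , ss , e) = E₀.residual _ sp′ λ S → trans (Linear.e-scale (L (false ∷ S)) δ a) (trans (*-congˡ (z (false ∷ S))) (zeroʳ δ))
                              in δ′ * δ , Regular-* rδ′ rδ , ss , λ T → trans (e T) (sym (*-assoc _ _ _)) }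
      where
      module E₁ = Echelon E₁
      module E₀ = Echelon E₀
      piv : Subset (suc M) → Bool
      piv (true ∷ T)  = E₁.pivots T
      piv (false ∷ T) = E₀.pivots T

  Supp : ∀ {n} → (Subset n → Bool) → Chain n → Set ℓ
  Supp A a = ∀ S → A S ≡ false → a S ≈ 0#

  record Basis {n} (A : Subset n → Bool) : Set (c ⊔ ℓ) where
    field
      {dim} : ℕ
      dim≡  : dim ≡ cnt A
      us    : Vec (Chain n) dim
      spans : ∀ a → Supp A a → Span us a
      supp  : ∀ ss → Supp A (lc ss us)
      indep : ∀ ss → (∀ T → lc ss us T ≈ 0#) → AllZero ss

  embed : ∀ {n} → Bool → Chain n → Chain (suc n)
  embed true  u (true ∷ T)  = u T
  embed true  u (false ∷ T) = 0#
  embed false u (true ∷ T)  = 0#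
  embed false u (false ∷ T) = u T

  embed-lc : ∀ {n k} b (ss : Vec Carrier k) (us : Vec (Chain n) k) → lc ss (Vec.map (embed b) us) ≐ embed b (lc ss us)
  embed-lc true  []       []       (true ∷ T)  = refl
  embed-lc true  []       []       (false ∷ T) = refl
  embed-lc false []       []       (true ∷ T)  = refl
  embed-lc false []       []       (false ∷ T) = refl
  embed-lc true  (s ∷ ss) (u ∷ us) (true ∷ T)  = +-congˡ (embed-lc true ss us (true ∷ T))
  embed-lc true  (s ∷ ss) (u ∷ us) (false ∷ T) = trans (+-cong (zeroʳ s) (embed-lc true ss us (false ∷ T))) (+-identityˡ 0#)
  embed-lc false (s ∷ ss) (u ∷ us) (true ∷ T)  = trans (+-cong (zeroʳ s) (embed-lc false ss us (true ∷ T))) (+-identityˡ 0#)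
  embed-lc false (s ∷ ss) (u ∷ us) (false ∷ T) = +-congˡ (embed-lc false ss us (false ∷ T))

  ++-lc : ∀ {n k k′} (ss : Vec Carrier k) (ts : Vec Carrier k′) (us : Vec (Chain n) k) vs → lc (ss ++ ts) (us ++ vs) ≐ λ T → lc ss us T + lc ts vs T
  ++-lc []       ts []       vs T = sym (+-identityˡ _)
  ++-lc (s ∷ ss) ts (u ∷ us) vs T = trans (+-congˡ (++-lc ss ts us vs T)) (sym (+-assoc _ _ _))

  ++-AllZero : ∀ {k k′} (ss : Vec Carrier k) {ts : Vec Carrier k′} → AllZero ss → AllZero ts → AllZero (ss ++ ts)
  ++-AllZero []       _       h = h
  ++-AllZero (s ∷ ss) (z , g) h = z , ++-AllZero ss g h

  basis : ∀ {n} (A : Subset n → Bool) → Basis A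
  basis {zero} A with decᵇ (A [])
  ... | inj₁ eq = record
    { dim≡ = ≡.sym (≡.cong toℕᵇ eq) ; us = (λ _ → 1#) ∷ []
    ; spans = λ a _ → a [] ∷ [] , λ { [] → trans (+-identityʳ _) (*-identityʳ _) }
    ; supp = λ { _ [] e → ⊥-elim (true≢false eq e) }
    ; indep = λ { (s ∷ []) h → trans (sym (trans (+-identityʳ _) (*-identityʳ _))) (h []) , tt } }
  ... | inj₂ eq = record
    { dim≡ = ≡.sym (≡.cong toℕᵇ eq) ; us = [] ; spans = λ a h → [] , λ { [] → sym (h [] eq) } ; supp = λ { [] _ _ → refl } ; indep = λ { [] _ → tt } }
  basis {suc n} A = record
    { dim≡ = ≡.cong₂ ℕ._+_ B₀.dim≡ B₁.dim≡
    ; us = Vec.map (embed false) B₀.us ++ Vec.map (embed true) B₁.us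
    ; spans = λ a h → let (ss , e) = B₀.spans (a ∘ (false ∷_)) (λ S → h (false ∷ S))
                          (ts , f) = B₁.spans (a ∘ (true ∷_)) (λ S → h (true ∷ S))
                      in ss ++ ts , λ where
                        (false ∷ T) → trans (at-false ss ts T) (e T)
                        (true ∷ T)  → trans (at-true ss ts T) (f T)
    ; supp = λ ss → supp′ ss (Vec.splitAt _ ss)
    ; indep = λ ss → indep′ ss (Vec.splitAt _ ss) }
    where
    module B₀ = Basis (basis (A ∘ (false ∷_)))
    module B₁ = Basis (basis (A ∘ (true ∷_)))
    both : ∀ ss ts T → lc (ss ++ ts) (Vec.map (embed false) B₀.us ++ Vec.map (embed true) B₁.us) T ≈ embed false (lc ss B₀.us) T + embed true (lc ts B₁.us) T
    both ss ts T = trans (++-lc ss ts (Vec.map (embed false) B₀.us) (Vec.map (embed true) B₁.us) T) (+-cong (embed-lc false ss B₀.us T) (embed-lc true ts B₁.us T))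
    at-false : ∀ ss ts T → _ ≈ _
    at-false ss ts T = trans (both ss ts (false ∷ T)) (+-identityʳ (lc ss B₀.us T))
    at-true : ∀ ss ts T → _ ≈ _
    at-true ss ts T = trans (both ss ts (true ∷ T)) (+-identityˡ (lc ts B₁.us T))
    supp′ : ∀ ss → (∃ λ (xs : Vec Carrier B₀.dim) → ∃ λ (ys : Vec Carrier B₁.dim) → ss ≡ xs ++ ys) → Supp A (lc ss (Vec.map (embed false) B₀.us ++ Vec.map (embed true) B₁.us))
    supp′ _ (xs , ys , ≡.refl) (false ∷ S) e = trans (at-false xs ys S) (B₀.supp xs S e)
    supp′ _ (xs , ys , ≡.refl) (true ∷ S)  e = trans (at-true xs ys S) (B₁.supp ys S e)
    indep′ : ∀ ss → (∃ λ (xs : Vec Carrier B₀.dim) → ∃ λ (ys : Vec Carrier B₁.dim) → ss ≡ xs ++ ys) → (∀ T → lc ss (Vec.map (embed false) B₀.us ++ Vec.map (embed true) B₁.us) T ≈ 0#) → AllZero ss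
    indep′ _ (xs , ys , ≡.refl) h = ++-AllZero xs
      (B₀.indep xs λ T → trans (sym (at-false xs ys T)) (h (false ∷ T)))
      (B₁.indep ys λ T → trans (sym (at-true xs ys T)) (h (true ∷ T)))

  record InitialFamily {n M} (fs : Vec (Covector n) M) (A : Subset n → Bool) : Set (c ⊔ ℓ) where
    field
      family   : Subset M → Bool
      count    : cnt family ≡ cnt A
      sound    : ∀ T → family T ≡ true → Σ (Chain n) λ a → Supp A a × Lead T (φ fs a)
      complete : ∀ T a → Supp A a → Lead T (φ fs a) → family T ≡ true

  initialFamily : ∀ {n M} (fs : Vec (Covector n) M) → (∀ a → (∀ T → φ fs a T ≈ 0#) → ∀ S → a S ≈ 0#) →
    (A : Subset n → Bool) → ¬ ¬ InitialFamily fs A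
  initialFamily {n} fs injective A = echelon (φ fs) (λ T → record { e-cong = λ e → φ-cong fs e T ; e-lin = λ s s′ a b → φ-linear fs s s′ a b T }) B.us >>= λ E →
    let module E = Echelon E in return record
    { family = E.pivots
    ; count = ≡.trans (≡.sym (≡.trans (≡.cong (cnt E.pivots ℕ.+_) (exhausted E.vs E.vs◁us E.vanish)) (ℕ.+-identityʳ _))) (≡.trans E.count B.dim≡)
    ; sound = λ T y → let (a , (ss , e) , l) = E.sound T y in a , (λ S h → trans (sym (e S)) (B.supp ss S h)) , l
    ; complete = λ T a h l → E.complete T a (B.spans a h) l }
    where
    module B = Basis (basis A)
    exhausted : ∀ {r} (vs : Vec (Chain n) r) → vs ◁ B.us → (∀ ss T → φ fs (lc ss vs) T ≈ 0#) → r ≡ 0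
    exhausted []       _ _ = ≡.refl
    exhausted {suc r} (v ∷ vs) i h with i (Vec.replicate (suc r) 1#)
    -- A leftover vector would make the combination with all coefficients 1 vanish under the
    -- injective `φ fs`, and independence would force 1 to be 0. So nothing is left and the pivots
    -- number as many as the members of A.
    ... | ts , e , z = ⊥-elim (1≉0 (proj₁ (z (B.indep ts λ T → trans (e T) (injective _ (h (Vec.replicate (suc r) 1#)) T)))))

-- The polynomial ring over F

module PolynomialRing {c ℓ} (F : Field c ℓ) where
  open Field F hiding (zero)
  open import Algebra.Properties.Ring ring using (-0#≈0#)
  open IntegerSolver commutativeRing

  Series : Set c
  Series = ℕ → Carrier

  infix 4 _≗_
  _≗_ : Series → Series → Set ℓ
  f ≗ g = ∀ i → f i ≈ g i

  conv : Series → Series → Series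
  conv f g zero    = f 0 * g 0
  conv f g (suc n) = f 0 * g (suc n) + conv (f ∘ suc) g n

  conv-cong : ∀ {f f′ g g′} → f ≗ f′ → g ≗ g′ → conv f g ≗ conv f′ g′
  conv-cong e h zero    = *-cong (e 0) (h 0)
  conv-cong e h (suc n) = +-cong (*-cong (e 0) (h (suc n))) (conv-cong (e ∘ suc) h n)

  conv-linearˡ : ∀ s f f′ g → conv (λ i → s * f i + f′ i) g ≗ λ i → s * conv f g i + conv f′ g i
  conv-linearˡ s f f′ g zero    = solve 4 (λ s a b d → (s :* a :+ b) :* d := s :* (a :* d) :+ b :* d) refl s (f 0) (f′ 0) (g 0)
  conv-linearˡ s f f′ g (suc n) = trans (+-congˡ (conv-linearˡ s (f ∘ suc) (f′ ∘ suc) g n))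
    (solve 6 (λ s a b d x y → (s :* a :+ b) :* d :+ (s :* x :+ y) := s :* (a :* d :+ x) :+ (b :* d :+ y)) refl s (f 0) (f′ 0) _ _ _)

  conv-+ˡ : ∀ f f′ g → conv (λ i → f i + f′ i) g ≗ λ i → conv f g i + conv f′ g i
  conv-+ˡ f f′ g i = trans (conv-cong {g = g} (λ j → +-congʳ (sym (*-identityˡ (f j)))) (λ _ → refl) i)
    (trans (conv-linearˡ 1# f f′ g i) (+-congʳ (*-identityˡ _)))

  conv-zeroˡ : ∀ {f} g → (∀ i → f i ≈ 0#) → ∀ i → conv f g i ≈ 0#
  conv-zeroˡ g e zero    = trans (*-congʳ (e 0)) (zeroˡ _)
  conv-zeroˡ g e (suc n) = trans (+-cong (trans (*-congʳ (e 0)) (zeroˡ _)) (conv-zeroˡ g (e ∘ suc) n)) (+-identityˡ 0#)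

  conv-assoc : ∀ f g h → conv (conv f g) h ≗ conv f (conv g h)
  conv-assoc f g h zero    = *-assoc _ _ _
  conv-assoc f g h (suc n) = trans (+-congˡ (trans (conv-linearˡ (f 0) (g ∘ suc) (conv (f ∘ suc) g) h n) (+-congˡ (conv-assoc (f ∘ suc) g h n))))
    (solve 5 (λ a b d x y → (a :* b) :* d :+ (a :* x :+ y) := a :* (b :* d :+ x) :+ y) refl _ _ _ _ _)

  conv-last : ∀ f g n → conv f g (suc n) ≈ conv f (g ∘ suc) n + f (suc n) * g 0
  conv-last f g zero    = refl
  conv-last f g (suc n) = trans (+-congˡ (conv-last (f ∘ suc) g n)) (sym (+-assoc _ _ _))

  conv-comm : ∀ f g → conv f g ≗ conv g f
  conv-comm f g zero    = *-comm _ _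
  conv-comm f g (suc n) = trans (+-congˡ (conv-comm (f ∘ suc) g n))
    (sym (trans (conv-last g f n) (trans (+-comm _ _) (+-congʳ (*-comm _ _)))))

  unit : Series
  unit zero    = 1#
  unit (suc _) = 0#

  conv-unit : ∀ g → conv unit g ≗ g
  conv-unit g zero    = *-identityˡ _
  conv-unit g (suc n) = trans (+-cong (*-identityˡ _) (conv-zeroˡ g (λ _ → refl) n)) (+-identityʳ _)

  Bounded : ℕ → Series → Set ℓ
  Bounded N f = ∀ i → N ℕ.≤ i → f i ≈ 0#

  conv-bounded : ∀ N M {f g} → Bounded N f → Bounded M g → Bounded (N ℕ.+ M) (conv f g)
  conv-bounded zero    M {f} {g} bf bg i       le = conv-zeroˡ g (λ j → bf j ℕ.z≤n) i
  conv-bounded (suc N) M         bf bg (suc i) le = trans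
    (+-cong (trans (*-congˡ (bg (suc i) (ℕ.≤-trans (ℕ.m≤n+m M (suc N)) le))) (zeroʳ _))
            (conv-bounded N M (λ j h → bf (suc j) (ℕ.s≤s h)) bg i (ℕ.≤-pred le)))
    (+-identityˡ 0#)

  -- A bound on the degree replaces the degree, which would require zero tests. With a bound,
  -- `dichotomy` needs only finitely many doubly negated tests, and finitely many can be combined.
  Poly : Set (c ⊔ ℓ)
  Poly = Σ Series λ f → Σ ℕ λ N → Bounded N f

  coeff : Poly → Series
  coeff = proj₁

  polyRing : CommutativeRing (c ⊔ ℓ) ℓ
  polyRing = record
    { Carrier = Poly
    ; _≈_ = λ p q → coeff p ≗ coeff q
    ; _+_ = λ { (f , N , bf) (g , M , bg) → (λ i → f i + g i) , N ℕ.+ M , λ i h →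
        trans (+-cong (bf i (ℕ.≤-trans (ℕ.m≤m+n N M) h)) (bg i (ℕ.≤-trans (ℕ.m≤n+m M N) h))) (+-identityˡ 0#) }
    ; _*_ = λ { (f , N , bf) (g , M , bg) → conv f g , N ℕ.+ M , conv-bounded N M bf bg }
    ; -_ = λ { (f , N , bf) → (λ i → - f i) , N , λ i h → trans (-‿cong (bf i h)) -0#≈0# }
    ; 0# = (λ _ → 0#) , 0 , λ _ _ → refl
    ; 1# = unit , 1 , λ { (suc _) _ → refl }
    ; isCommutativeRing = record
      { isRing = record
        { +-isAbelianGroup = record
          { isGroup = record
            { isMonoid = record
              { isSemigroup = record
                { isMagma = record
                  { isEquivalence = record { refl = λ _ → refl ; sym = λ e i → sym (e i) ; trans = λ e h i → trans (e i) (h i) }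
                  ; ∙-cong = λ e h i → +-cong (e i) (h i) }
                ; assoc = λ _ _ _ _ → +-assoc _ _ _ }
              ; identity = (λ _ _ → +-identityˡ _) , (λ _ _ → +-identityʳ _) }
            ; inverse = (λ _ _ → -‿inverseˡ _) , (λ _ _ → -‿inverseʳ _)
            ; ⁻¹-cong = λ e i → -‿cong (e i) }
          ; comm = λ _ _ _ → +-comm _ _ }
        ; *-cong = conv-cong
        ; *-assoc = λ p q r → conv-assoc (coeff p) (coeff q) (coeff r)
        ; *-identity = (λ p → conv-unit (coeff p)) , λ p i → trans (conv-comm (coeff p) unit i) (conv-unit (coeff p) i)
        ; distrib = (λ p q r i → trans (conv-comm (coeff p) _ i) (trans (conv-+ˡ (coeff q) (coeff r) (coeff p) i)
                      (+-cong (conv-comm (coeff q) (coeff p) i) (conv-comm (coeff r) (coeff p) i))))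
                  , λ p q r → conv-+ˡ (coeff q) (coeff r) (coeff p) }
      ; *-comm = λ p q → conv-comm (coeff p) (coeff q) } }

  module P = CommutativeRing polyRing
  open Initial polyRing using (Regular)

  shift : Poly → Poly
  shift (f , N , b) = f ∘ suc , N , λ i h → b (suc i) (ℕ.m≤n⇒m≤1+n h)

  -- As in power series: with an invertible constant term, the coefficients of the other factor are
  -- forced to vanish one after the other, the lowest first.
  unit-regular : ∀ p → (∃ λ u → coeff p 0 * u ≈ 1#) → Regular p
  unit-regular (f , N , b) (u , fu) (g , _) h i = below (suc i) i ℕ.≤-refl
    where
    cancel : ∀ {x} → f 0 * x ≈ 0# → x ≈ 0#
    cancel {x} e = trans (sym (*-identityˡ x)) (trans (*-congʳ (sym fu))
      (trans (solve 3 (λ f u x → (f :* u) :* x := u :* (f :* x)) refl (f 0) u x) (trans (*-congˡ e) (zeroʳ u))))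
    conv-below : ∀ f′ n → (∀ j → j ℕ.≤ n → g j ≈ 0#) → conv f′ g n ≈ 0#
    conv-below f′ zero    z = trans (*-congˡ (z 0 ℕ.≤-refl)) (zeroʳ _)
    conv-below f′ (suc n) z = trans (+-cong (trans (*-congˡ (z (suc n) ℕ.≤-refl)) (zeroʳ _)) (conv-below (f′ ∘ suc) n λ j h → z j (ℕ.m≤n⇒m≤1+n h))) (+-identityˡ 0#)
    below : ∀ m j → j ℕ.< m → g j ≈ 0#
    below (suc m) zero    _  = cancel (h 0)
    below (suc m) (suc j) lt = cancel (trans (sym (trans (+-congˡ (conv-below (f ∘ suc) j λ k le → below m k (ℕ.≤-trans (ℕ.s≤s le) (ℕ.≤-pred lt)))) (+-identityʳ _))) (h (suc j)))

  shift-regular : ∀ p → coeff p 0 ≈ 0# → Regular (shift p) → Regular p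
  shift-regular p z r q h = r q λ i → trans (sym (trans (+-congʳ (trans (*-congʳ z) (zeroˡ _))) (+-identityˡ _))) (h (suc i))

  dichotomy : ∀ p → ¬ ¬ (p P.≈ P.0# ⊎ Regular p)
  dichotomy (f , N , b) = go N f N b b
    where
    dec : ∀ x → ¬ ¬ (Dec (x ≈ 0#))
    dec x k = k (no λ e → k (yes e))
    go : ∀ m f N (b : Bounded N f) → Bounded m f → ¬ ¬ ((f , N , b) P.≈ P.0# ⊎ Regular (f , N , b))
    go zero    f N b bm = return (inj₁ λ i → bm i ℕ.z≤n)
    go (suc m) f N b bm = dec (f 0) >>= λ where
      (no ne) → return (inj₂ (unit-regular (f , N , b) (inverse (f 0) ne)))
      (yes e) → go m (f ∘ suc) N (proj₂ (proj₂ (shift (f , N , b)))) (λ i h → bm (suc i) (ℕ.s≤s h)) >>= λ where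
        (inj₁ z) → return (inj₁ λ { zero → e ; (suc i) → z i })
        (inj₂ r) → return (inj₂ (shift-regular (f , N , b) e r))

  monomial : ℕ → Poly
  monomial zero    = P.1#
  monomial (suc k) = (λ { zero → 0# ; (suc i) → coeff (monomial k) i }) , suc (proj₁ (proj₂ (monomial k)))
                   , λ { (suc i) (ℕ.s≤s h) → proj₂ (proj₂ (monomial k)) i h }

  monomial-regular : ∀ i j → i ≢ j → Regular (monomial i P.- monomial j)
  monomial-regular zero    zero    ne = ⊥-elim (ne ≡.refl)
  monomial-regular zero    (suc j) ne = unit-regular (monomial zero P.- monomial (suc j)) (1# , solve 0 ((:1 :- :0) :* :1 := :1) refl)
  monomial-regular (suc i) zero    ne = unit-regular (monomial (suc i) P.- monomial zero) (- 1# , solve 0 ((:0 :- :1) :* (:- :1) := :1) refl)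
  monomial-regular (suc i) (suc j) ne = shift-regular (monomial (suc i) P.- monomial (suc j)) (solve 0 (:0 :- :0 := :0) refl)
    (λ q h → monomial-regular i j (ne ∘ ≡.cong suc) q h)

  1≉0 : ¬ (P.1# P.≈ P.0#)
  1≉0 e = 0≉1 (sym (e 0))

  point : ∀ {n} → Fin n → Poly
  point v = monomial (toℕ v)

  point-regular : ∀ {n} (v w : Fin n) → v ≢ w → Regular (point v P.- point w)
  point-regular v w ne = monomial-regular (toℕ v) (toℕ w) (ne ∘ Fin.toℕ-injective)

-- Disjointness under insertion

disjoint-insʳ : ∀ {n} v (A T : Subset n) → disjointᵇ A (ins v T) ≡ true → lookup A v ≡ false × disjointᵇ A T ≡ true
disjoint-insʳ zero    (false ∷ A) (_ ∷ T)     d = ≡.refl , d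
disjoint-insʳ (suc v) (true ∷ A)  (false ∷ T) d = disjoint-insʳ v A T d
disjoint-insʳ (suc v) (false ∷ A) (_ ∷ T)     d = disjoint-insʳ v A T d

disjoint-insˡ : ∀ {n} v (A T : Subset n) → disjointᵇ (ins v A) T ≡ true → lookup T v ≡ false × disjointᵇ A T ≡ true
disjoint-insˡ zero    (true ∷ A)  (false ∷ T) d = ≡.refl , d
disjoint-insˡ zero    (false ∷ A) (false ∷ T) d = ≡.refl , d
disjoint-insˡ (suc v) (true ∷ A)  (false ∷ T) d = disjoint-insˡ v A T d
disjoint-insˡ (suc v) (false ∷ A) (_ ∷ T)     d = disjoint-insˡ v A T d

disjoint-intro-insˡ : ∀ {n} v (A T : Subset n) → lookup T v ≡ false → disjointᵇ A T ≡ true → disjointᵇ (ins v A) T ≡ true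
disjoint-intro-insˡ zero    (_ ∷ A)     (false ∷ T) e d = out d
  where
  out : ∀ {a b} → not (a ∧ false) ∧ b ≡ true → b ≡ true
  out {true}  d = d
  out {false} d = d
disjoint-intro-insˡ (suc v) (true ∷ A)  (false ∷ T) e d = disjoint-intro-insˡ v A T e d
disjoint-intro-insˡ (suc v) (false ∷ A) (_ ∷ T)     e d = disjoint-intro-insˡ v A T e d

disjoint-intro-insʳ : ∀ {n} v (A T : Subset n) → lookup A v ≡ false → disjointᵇ A T ≡ true → disjointᵇ A (ins v T) ≡ true
disjoint-intro-insʳ zero    (false ∷ A) (_ ∷ T)     e d = d
disjoint-intro-insʳ (suc v) (true ∷ A)  (false ∷ T) e d = disjoint-intro-insʳ v A T e d
disjoint-intro-insʳ (suc v) (false ∷ A) (_ ∷ T)     e d = disjoint-intro-insʳ v A T e d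

disjoint-lookup : ∀ {n} v (A T : Subset n) → disjointᵇ A T ≡ true → lookup T v ≡ true → lookup A v ≡ false
disjoint-lookup v A T d e = proj₁ (disjoint-insʳ v A T (≡.trans (≡.cong (disjointᵇ A) (ins-id v T e)) d))

-- Finite sums and products, evaluation of polynomials

module FiniteSums {c ℓ} (R : CommutativeRing c ℓ) where
  open CommutativeRing R hiding (zero)
  open import Algebra.Properties.Ring ring using (-0#≈0#)
  open IntegerSolver R
  open Exterior R
  open Initial R

  sumF prodF : ∀ {n} → (Fin n → Carrier) → Carrier
  sumF {zero}  f = 0#
  sumF {suc n} f = f zero + sumF (f ∘ suc)
  prodF {zero}  f = 1#
  prodF {suc n} f = f zero * prodF (f ∘ suc)

  sumF-cong : ∀ {n} {f g : Fin n → Carrier} → (∀ i → f i ≈ g i) → sumF f ≈ sumF g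
  sumF-cong {zero}  e = refl
  sumF-cong {suc n} e = +-cong (e zero) (sumF-cong (e ∘ suc))

  sumF-zero : ∀ {n} {f : Fin n → Carrier} → (∀ i → f i ≈ 0#) → sumF f ≈ 0#
  sumF-zero {zero}  e = refl
  sumF-zero {suc n} e = trans (+-cong (e zero) (sumF-zero (e ∘ suc))) (+-identityˡ 0#)

  sumF-linear : ∀ {n} s s′ (f g : Fin n → Carrier) → sumF (λ i → s * f i + s′ * g i) ≈ s * sumF f + s′ * sumF g
  sumF-linear {zero}  s s′ f g = solve 2 (λ s s′ → :0 := s :* :0 :+ s′ :* :0) refl s s′
  sumF-linear {suc n} s s′ f g = trans (+-congˡ (sumF-linear s s′ (f ∘ suc) (g ∘ suc)))
    (solve 6 (λ s s′ a b x y → (s :* a :+ s′ :* b) :+ (s :* x :+ s′ :* y) := s :* (a :+ x) :+ s′ :* (b :+ y)) refl s s′ _ _ _ _)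

  sumF-scale : ∀ {n} s (f : Fin n → Carrier) → sumF (λ i → s * f i) ≈ s * sumF f
  sumF-scale s f = trans (sumF-cong λ i → solve 2 (λ s x → s :* x := s :* x :+ :0 :* x) refl s (f i))
    (trans (sumF-linear s 0# f f) (solve 2 (λ s x → s :* x :+ :0 :* x := s :* x) refl s _))

  sumF-single : ∀ {n} w (f : Fin n → Carrier) → (∀ v → v ≢ w → f v ≈ 0#) → sumF f ≈ f w
  sumF-single zero    f e = trans (+-congˡ (sumF-zero λ i → e (suc i) λ ())) (+-identityʳ _)
  sumF-single (suc w) f e = trans (+-cong (e zero λ ()) (sumF-single w (f ∘ suc) λ v ne → e (suc v) (ne ∘ Fin.suc-injective))) (+-identityˡ _)

  It-sum : ∀ {n k} (h : ℕ → Covector n) m (F : Fin k → Chain n) → It h m (λ T → sumF λ w → F w T) ≐ λ T → sumF λ w → It h m (F w) T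
  It-sum {k = zero}  h m F T = trans (It-cong h m (λ U → sym (zeroˡ (1#))) T) (trans (It-scale h m 0# (λ _ → 1#) T) (zeroˡ _))
  It-sum {k = suc k} h m F T = trans (It-cong h m (λ U → sym (+-cong (*-identityˡ _) (*-identityˡ _))) T)
    (trans (It-linear h m 1# 1# (F zero) (λ U → sumF λ w → F (suc w) U) T) (+-cong (*-identityˡ _) (trans (*-identityˡ _) (It-sum h m (F ∘ suc) T))))

  but : ∀ {n} → Fin n → (Fin n → Carrier) → Carrier
  but zero    f = prodF (f ∘ suc)
  but (suc w) f = f zero * but w (f ∘ suc)

  but-* : ∀ {n} w (f : Fin n → Carrier) → but w f * f w ≈ prodF f
  but-* zero    f = *-comm _ _
  but-* (suc w) f = trans (*-assoc _ _ _) (*-congˡ (but-* w (f ∘ suc)))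

  prodF-regular : ∀ {n} (f : Fin n → Carrier) → (∀ i → Regular (f i)) → Regular (prodF f)
  prodF-regular {zero}  f r = Regular-1
  prodF-regular {suc n} f r = Regular-* (r zero) (prodF-regular (f ∘ suc) (r ∘ suc))

  -- The products of θ over T and over its complement. Their product is the full one, `co θ ⊥`, so
  -- multiplying by `co θ T` stands for dividing by `ex θ T`.
  ex co : ∀ {n} → Covector n → Subset n → Carrier
  ex θ []          = 1#
  ex θ (true ∷ T)  = θ zero * ex (θ ∘ suc) T
  ex θ (false ∷ T) = ex (θ ∘ suc) T
  co θ []          = 1#
  co θ (true ∷ T)  = co (θ ∘ suc) T
  co θ (false ∷ T) = θ zero * co (θ ∘ suc) T

  ex-ins : ∀ {n} (θ : Covector n) v T → lookup T v ≡ false → ex θ (ins v T) ≈ θ v * ex θ T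
  ex-ins θ zero    (false ∷ T) e = refl
  ex-ins θ (suc v) (true ∷ T)  e = trans (*-congˡ (ex-ins (θ ∘ suc) v T e)) (solve 3 (λ a b d → a :* (b :* d) := b :* (a :* d)) refl _ _ _)
  ex-ins θ (suc v) (false ∷ T) e = ex-ins (θ ∘ suc) v T e

  co-ins : ∀ {n} (θ : Covector n) v T → lookup T v ≡ false → θ v * co θ (ins v T) ≈ co θ T
  co-ins θ zero    (false ∷ T) e = refl
  co-ins θ (suc v) (true ∷ T)  e = co-ins (θ ∘ suc) v T e
  co-ins θ (suc v) (false ∷ T) e = trans (solve 3 (λ a b d → b :* (a :* d) := a :* (b :* d)) refl _ _ _) (*-congˡ (co-ins (θ ∘ suc) v T e))

  co-del : ∀ {n} (θ : Covector n) v T → lookup T v ≡ true → θ v * co θ T ≈ co θ (del v T)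
  co-del θ v T e = trans (*-congˡ (reflexive (≡.cong (co θ) (≡.sym (ins-del v T e))))) (co-ins θ v (del v T) (lookup-del v T))

  ex-co : ∀ {n} (θ : Covector n) T → ex θ T * co θ T ≈ co θ ⊥
  ex-co θ []          = *-identityˡ 1#
  ex-co θ (true ∷ T)  = trans (*-assoc _ _ _) (*-congˡ (ex-co (θ ∘ suc) T))
  ex-co θ (false ∷ T) = trans (solve 3 (λ a b d → a :* (b :* d) := b :* (a :* d)) refl _ _ _) (*-congˡ (ex-co (θ ∘ suc) T))

  ex-regular : ∀ {n} (θ : Covector n) T → (∀ v → Regular (θ v)) → Regular (ex θ T)
  ex-regular θ []          r = Regular-1
  ex-regular θ (true ∷ T)  r = Regular-* (r zero) (ex-regular (θ ∘ suc) T (r ∘ suc))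
  ex-regular θ (false ∷ T) r = ex-regular (θ ∘ suc) T (r ∘ suc)

  co-regular : ∀ {n} (θ : Covector n) T → (∀ v → Regular (θ v)) → Regular (co θ T)
  co-regular θ []          r = Regular-1
  co-regular θ (true ∷ T)  r = co-regular (θ ∘ suc) T (r ∘ suc)
  co-regular θ (false ∷ T) r = Regular-* (r zero) (co-regular (θ ∘ suc) T (r ∘ suc))

  ev : ℕ → (ℕ → Carrier) → Carrier → Carrier
  ev zero    f u = 0#
  ev (suc k) f u = f 0 + u * ev k (f ∘ suc) u

  ev-cong : ∀ k {f g} u → (∀ i → f i ≈ g i) → ev k f u ≈ ev k g u
  ev-cong zero    u e = refl
  ev-cong (suc k) u e = +-cong (e 0) (*-congˡ (ev-cong k u (e ∘ suc)))

  ev-linear : ∀ k s s′ f g u → ev k (λ i → s * f i + s′ * g i) u ≈ s * ev k f u + s′ * ev k g u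
  ev-linear zero    s s′ f g u = solve 2 (λ s s′ → :0 := s :* :0 :+ s′ :* :0) refl s s′
  ev-linear (suc k) s s′ f g u = trans (+-congˡ (*-congˡ (ev-linear k s s′ (f ∘ suc) (g ∘ suc) u)))
    (solve 7 (λ s s′ a b u x y → (s :* a :+ s′ :* b) :+ u :* (s :* x :+ s′ :* y) := s :* (a :+ u :* x) :+ s′ :* (b :+ u :* y)) refl s s′ _ _ u _ _)

  ev-scale : ∀ k s f u → ev k (λ i → s * f i) u ≈ s * ev k f u
  ev-scale k s f u = trans (ev-cong k u λ i → solve 2 (λ s x → s :* x := s :* x :+ :0 :* x) refl s (f i))
    (trans (ev-linear k s 0# f f u) (solve 2 (λ s x → s :* x :+ :0 :* x := s :* x) refl s _))

  ev-zero : ∀ k {f} u → (∀ i → f i ≈ 0#) → ev k f u ≈ 0#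
  ev-zero zero    u e = refl
  ev-zero (suc k) u e = trans (+-cong (e 0) (trans (*-congˡ (ev-zero k u (e ∘ suc))) (zeroʳ u))) (+-identityˡ 0#)

  ev-extend : ∀ k f u → f k ≈ 0# → ev (suc k) f u ≈ ev k f u
  ev-extend zero    f u e = trans (+-cong e (zeroʳ u)) (+-identityˡ 0#)
  ev-extend (suc k) f u e = +-congˡ (*-congˡ (ev-extend k (f ∘ suc) u e))

  ι-ev : ∀ {n} (g : Covector n) k (Y : ℕ → Chain n) u → ι g (λ T → ev k (λ i → Y i T) u) ≐ λ T → ev k (λ i → ι g (Y i) T) u
  ι-ev g zero    Y u T = ι-zero g (λ _ → refl) T
  ι-ev g (suc k) Y u T = trans (ι-cong (λ U → +-congʳ (sym (*-identityˡ _))) T)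
    (trans (ι-linear g 1# u (Y 0) (λ U → ev k (λ i → Y (suc i) U) u) T) (+-cong (*-identityˡ _) (*-congˡ (ι-ev g k (Y ∘ suc) u T))))

  -- ε x T i is the coefficient of uⁱ in the product of the u - x v over v in T.

  prev : (ℕ → Carrier) → ℕ → Carrier
  prev f zero    = 0#
  prev f (suc i) = f i

  ε : ∀ {n} → Covector n → Subset n → ℕ → Carrier
  ε x []          zero    = 1#
  ε x []          (suc i) = 0#
  ε x (false ∷ T) i       = ε (x ∘ suc) T i
  ε x (true ∷ T)  i       = prev (ε (x ∘ suc) T) i - x zero * ε (x ∘ suc) T i

  ε-ins : ∀ {n} (x : Covector n) v T i → lookup T v ≡ false → ε x (ins v T) i ≈ prev (ε x T) i - x v * ε x T i
  ε-ins x zero    (false ∷ T) i e = refl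
  ε-ins x (suc v) (false ∷ T) zero    e = ε-ins (x ∘ suc) v T zero e
  ε-ins x (suc v) (false ∷ T) (suc i) e = ε-ins (x ∘ suc) v T (suc i) e
  ε-ins x (suc v) (true ∷ T)  zero    e = trans (+-congˡ (-‿cong (*-congˡ (ε-ins (x ∘ suc) v T zero e))))
    (solve 3 (λ a b f → :0 :- a :* (:0 :- b :* f) := :0 :- b :* (:0 :- a :* f)) refl _ _ _)
  ε-ins x (suc v) (true ∷ T)  (suc i) e = trans (+-cong (ε-ins (x ∘ suc) v T i e) (-‿cong (*-congˡ (ε-ins (x ∘ suc) v T (suc i) e))))
    (solve 5 (λ a b f g h → (h :- b :* f) :- a :* (f :- b :* g) := (h :- a :* f) :- b :* (f :- a :* g)) refl (x zero) (x (suc v)) (ε (x ∘ suc) T i) (ε (x ∘ suc) T (suc i)) (prev (ε (x ∘ suc) T) i))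

  ε-high : ∀ {n} (x : Covector n) T i → ∣ T ∣ ℕ.< i → ε x T i ≈ 0#
  ε-high x []          (suc i) lt = refl
  ε-high x (false ∷ T) i       lt = ε-high (x ∘ suc) T i lt
  ε-high x (true ∷ T)  (suc i) lt = trans (+-cong (ε-high (x ∘ suc) T i (ℕ.≤-pred lt)) (-‿cong (trans (*-congˡ (ε-high (x ∘ suc) T (suc i) (ℕ.<-trans (ℕ.n<1+n _) lt))) (zeroʳ _))))
    (trans (+-congˡ -0#≈0#) (+-identityˡ 0#))

  ε-lead : ∀ {n} (x : Covector n) T → ε x T ∣ T ∣ ≈ 1#
  ε-lead x []          = refl
  ε-lead x (false ∷ T) = ε-lead (x ∘ suc) T
  ε-lead x (true ∷ T)  = trans (+-cong (ε-lead (x ∘ suc) T) (-‿cong (trans (*-congˡ (ε-high (x ∘ suc) T (suc ∣ T ∣) ℕ.≤-refl)) (zeroʳ _))))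
    (trans (+-congˡ -0#≈0#) (+-identityʳ 1#))

  ε-root : ∀ {n} (x : Covector n) w T k → lookup T w ≡ true → ∣ T ∣ ℕ.< k → ev k (ε x T) (x w) ≈ 0#
  ε-root x (suc w) (false ∷ T) k       e lt = ε-root (x ∘ suc) w T k e lt
  ε-root {suc n} x w (true ∷ T) (suc k) e lt = trans (factor (x w)) (vanishes w e)
    where
    f = ε (x ∘ suc) T
    factor : ∀ u → ev (suc k) (ε x (true ∷ T)) u ≈ (u - x zero) * ev k f u
    factor u = trans (ev-cong (suc k) u λ i → solve 3 (λ p a g → p :- a :* g := :1 :* p :+ (:- a) :* g) refl (prev f i) (x zero) (f i))
      (trans (ev-linear (suc k) 1# (- x zero) (prev f) f u)
        (trans (+-congˡ (*-congˡ (ev-extend k f u (ε-high (x ∘ suc) T k (ℕ.≤-pred lt)))))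
          (solve 3 (λ u a g → :1 :* (:0 :+ u :* g) :+ (:- a) :* g := (u :- a) :* g) refl u (x zero) _)))
    vanishes : ∀ w → lookup (true ∷ T) w ≡ true → (x w - x zero) * ev k f (x w) ≈ 0#
    vanishes zero    _ = trans (*-congʳ (-‿inverseʳ _)) (zeroˡ _)
    vanishes (suc w) e = trans (*-congˡ (ε-root (x ∘ suc) w T k e (ℕ.≤-pred lt))) (zeroʳ _)

-- Powers of distinct points and divided differences

module Vandermonde {c ℓ} (R : CommutativeRing c ℓ) {n : ℕ} (x : Fin n → CommutativeRing.Carrier R)
  (x-regular : ∀ v w → v ≢ w → Initial.Regular R (CommutativeRing._-_ R (x v) (x w))) where
  open CommutativeRing R hiding (zero)
  open import Algebra.Properties.Ring ring using (-0#≈0#)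
  open IntegerSolver R
  open Exterior R
  open Initial R
  open FiniteSums R

  pw : ℕ → Covector n
  pw zero    v = 1#
  pw (suc i) v = x v * pw i v

  -- The value at w is set to 1 instead of 0, so that all values are regular and rescaling by them
  -- can be undone. The chains to which this is applied avoid w and do not see that value.
  θ : Fin n → Covector n
  θ w v with v Fin.≟ w
  ... | yes _ = 1#
  ... | no  _ = x v - x w

  θ-≢ : ∀ {w v} → v ≢ w → θ w v ≈ x v - x w
  θ-≢ {w} {v} ne with v Fin.≟ w
  ... | yes e = ⊥-elim (ne e)
  ... | no  _ = refl

  θ-≡ : ∀ w → θ w w ≈ 1#
  θ-≡ w with w Fin.≟ w
  ... | yes _ = refl
  ... | no ne = ⊥-elim (ne ≡.refl)

  θ-regular : ∀ w v → Regular (θ w v)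
  θ-regular w v with v Fin.≟ w
  ... | yes _ = Regular-1
  ... | no ne = x-regular v w ne

  Θ : Fin n → Carrier
  Θ w = co (θ w) ⊥

  -- Each `Θ w` has to be cleared twice, once as the denominator of a partial fraction at w and once
  -- as the factor left by rescaling with `θ w`; hence the squares. `M w` plays the part of Δ /
  -- `Θ w`, and `N w` that of Δ / `Θ w` squared.
  Δ : Carrier
  Δ = prodF λ w → Θ w * Θ w

  N M : Fin n → Carrier
  N w = but w λ v → Θ v * Θ v
  M w = N w * Θ w

  M-Θ : ∀ w → M w * Θ w ≈ Δ
  M-Θ w = trans (*-assoc _ _ _) (but-* w λ v → Θ v * Θ v)

  Δ-regular : Regular Δ
  Δ-regular = prodF-regular _ λ w → Regular-* (co-regular (θ w) ⊥ (θ-regular w)) (co-regular (θ w) ⊥ (θ-regular w))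

  ind : Fin n → Subset n → Carrier
  ind w T = if lookup T w then 1# else 0#

  ind-true : ∀ w T → lookup T w ≡ true → ind w T ≈ 1#
  ind-true w T e rewrite e = refl

  ind-false : ∀ w T → lookup T w ≡ false → ind w T ≈ 0#
  ind-false w T e rewrite e = refl

  -- Division-free divided differences: up to the factor Δ this is the sum of
  -- g w / ∏ (x v - x w) over w in T.

  weight : Subset n → Fin n → Carrier
  weight T w = M w * (ind w T * co (θ w) T)

  dd : Subset n → (Fin n → Carrier) → Carrier
  dd T g = sumF λ w → weight T w * g w

  dd-cong : ∀ T {g h} → (∀ w → g w ≈ h w) → dd T g ≈ dd T h
  dd-cong T e = sumF-cong λ w → *-congˡ (e w)

  dd-linear : ∀ T s s′ g h → dd T (λ w → s * g w + s′ * h w) ≈ s * dd T g + s′ * dd T h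
  dd-linear T s s′ g h = trans (sumF-cong λ w → solve 5 (λ k s s′ a b → k :* (s :* a :+ s′ :* b) := s :* (k :* a) :+ s′ :* (k :* b)) refl (weight T w) s s′ (g w) (h w))
    (sumF-linear s s′ (λ w → weight T w * g w) (λ w → weight T w * h w))

  dd-del : ∀ T v g → lookup T v ≡ true → dd T (λ w → (x v - x w) * g w) ≈ dd (del v T) g
  dd-del T v g v∈T = sumF-cong term
    where
    term : ∀ w → weight T w * ((x v - x w) * g w) ≈ weight (del v T) w * g w
    term w with v Fin.≟ w
    ... | yes ≡.refl = trans (solve 3 (λ a b g → a :* ((b :- b) :* g) := :0) refl _ _ _)
      (sym (trans (*-congʳ (*-congˡ (*-congʳ (ind-false v (del v T) (lookup-del v T))))) (solve 3 (λ m k g → (m :* (:0 :* k)) :* g := :0) refl _ _ _)))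
    ... | no ne = trans (solve 5 (λ m i k d g → (m :* (i :* k)) :* (d :* g) := (m :* (i :* (d :* k))) :* g) refl (M w) (ind w T) (co (θ w) T) (x v - x w) (g w))
      (*-congʳ (*-congˡ (*-cong (reflexive (≡.cong (λ b → if b then 1# else 0#) (lookup-del-≢ T ne)))
        (trans (*-congʳ (sym (θ-≢ ne))) (co-del (θ w) v T v∈T)))))
      where
      lookup-del-≢ : ∀ {m} {v w : Fin m} (T : Subset m) → v ≢ w → lookup T w ≡ lookup (del v T) w
      lookup-del-≢ {v = zero}  {zero}  (_ ∷ _) ne = ⊥-elim (ne ≡.refl)
      lookup-del-≢ {v = zero}  {suc w} (_ ∷ _) ne = ≡.refl
      lookup-del-≢ {v = suc v} {zero}  (_ ∷ _) ne = ≡.refl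
      lookup-del-≢ {v = suc v} {suc w} (_ ∷ T) ne = lookup-del-≢ T (ne ∘ ≡.cong suc)

  sg : ℕ → Carrier
  sg zero    = 1#
  sg (suc p) = - sg p

  sg-sq : ∀ p → sg p * sg p ≈ 1#
  sg-sq zero    = *-identityˡ 1#
  sg-sq (suc p) = trans (solve 1 (λ a → (:- a) :* (:- a) := a :* a) refl (sg p)) (sg-sq p)

  lookup-del-true : ∀ {m} v u (T : Subset m) → lookup (del v T) u ≡ true → lookup T u ≡ true × u ≢ v
  lookup-del-true zero    (suc u) (_ ∷ T) e = e , λ ()
  lookup-del-true (suc v) zero    (_ ∷ T) e = e , λ ()
  lookup-del-true (suc v) (suc u) (_ ∷ T) e with lookup-del-true v u T e
  ... | h , ne = h , ne ∘ Fin.suc-injective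

  value : ℕ → ℕ → Carrier
  value p i with i ℕ.≟ p
  ... | yes _ = sg p * Δ
  ... | no  _ = 0#

  value-≡ : ∀ p → value p p ≈ sg p * Δ
  value-≡ p with p ℕ.≟ p
  ... | yes _ = refl
  ... | no ne = ⊥-elim (ne ≡.refl)

  value-≢ : ∀ {p i} → i ≢ p → value p i ≈ 0#
  value-≢ {p} {i} ne with i ℕ.≟ p
  ... | yes e = ⊥-elim (ne e)
  ... | no _  = refl

  -- A divided difference over p + 1 points kills the powers below p and is constant on the power p.
  -- The sign is due to denominators x v - x w, taken in the order opposite to the usual one.
  lagrange : ∀ p T → ∣ T ∣ ≡ suc p → ∀ i → i ℕ.≤ p → dd T (pw i) ≈ value p i
  lagrange zero T e zero z≤n with size-pos T e
  ... | w , w∈T = trans (sumF-single w _ λ v ne → trans (*-congʳ (*-congˡ (*-congʳ (ind-false v T (¬true⇒false λ v∈T → ne (unique v v∈T)))))) (solve 3 (λ m k g → (m :* (:0 :* k)) :* g := :0) refl _ _ _))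
    (trans (*-identityʳ _) (trans (*-congˡ (trans (*-congʳ (ind-true w T w∈T)) (trans (*-identityˡ _) single))) (trans (M-Θ w) (sym (trans (value-≡ 0) (*-identityˡ Δ))))))
    where
    del-⊥ : del w T ≡ ⊥
    del-⊥ = size-0 (del w T) (ℕ.suc-injective (≡.trans (size-del w T w∈T) e))
    unique : ∀ v → lookup T v ≡ true → v ≡ w
    unique v v∈T with v Fin.≟ w
    ... | yes eq = eq
    ... | no ne = ⊥-elim (true≢false v∈T (≡.trans (≡.cong (λ S → lookup S v) (≡.sym (ins-del w T w∈T)))
                    (≡.trans (lookup-ins-≢ {v = w} (del w T) ne) (≡.trans (≡.cong (λ S → lookup S v) del-⊥) (lookup-replicate v false)))))
    single : co (θ w) T ≈ Θ w
    single = trans (sym (trans (*-congʳ (θ-≡ w)) (*-identityˡ _))) (trans (co-del (θ w) w T w∈T) (reflexive (≡.cong (co (θ w)) del-⊥)))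
  lagrange (suc p) T e zero z≤n with size-pos T e
  ... | v , v∈T with size-pos (del v T) (ℕ.suc-injective (≡.trans (size-del v T v∈T) e))
  -- Writing x v - x u as (x v - x w) - (x u - x w) expresses (x v - x u) times the difference
  -- through the shorter differences without v and without u. These two are equal, and x v - x u can
  -- be cancelled.
  ...   | u , u∈T′ = trans (x-regular v u (λ eq → proj₂ u∈ (≡.sym eq)) _ (trans (sym expand) cancel)) (sym (value-≢ {suc p} {0} λ ()))
    where
    u∈ = lookup-del-true v u T u∈T′
    rec : ∀ w → lookup T w ≡ true → dd (del w T) (pw 0) ≈ value p 0
    rec w w∈T = lagrange p (del w T) (ℕ.suc-injective (≡.trans (size-del w T w∈T) e)) 0 z≤n
    expand : dd T (λ w → 1# * ((x v - x w) * 1#) + (- 1#) * ((x u - x w) * 1#)) ≈ (x v - x u) * dd T (pw 0)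
    expand = trans (dd-cong T λ w → solve 3 (λ v u w → :1 :* ((v :- w) :* :1) :+ (:- :1) :* ((u :- w) :* :1) := (v :- u) :* :1 :+ :0 :* :1) refl (x v) (x u) (x w))
      (trans (dd-linear T (x v - x u) 0# (pw 0) (pw 0)) (solve 2 (λ d z → d :* z :+ :0 :* z := d :* z) refl _ _))
    cancel : dd T (λ w → 1# * ((x v - x w) * 1#) + (- 1#) * ((x u - x w) * 1#)) ≈ 0#
    cancel = trans (dd-linear T 1# (- 1#) (λ w → (x v - x w) * 1#) (λ w → (x u - x w) * 1#))
      (trans (+-cong (*-congˡ (trans (dd-del T v (pw 0) v∈T) (rec v v∈T))) (*-congˡ (trans (dd-del T u (pw 0) (proj₁ u∈)) (rec u (proj₁ u∈)))))
        (solve 1 (λ z → :1 :* z :+ (:- :1) :* z := :0) refl _))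
  lagrange (suc p) T e (suc i) (s≤s i≤p) = let (v , v∈T) = size-pos T e in trans (dd-cong T λ w → solve 3 (λ v w q → w :* q := v :* q :+ (:- :1) :* ((v :- w) :* q)) refl (x v) (x w) (pw i w))
    (trans (dd-linear T (x v) (- 1#) (pw i) (λ w → (x v - x w) * pw i w))
      (trans (+-cong (*-congˡ (trans (lagrange (suc p) T e i (ℕ.m≤n⇒m≤1+n i≤p)) (value-≢ (ℕ.<⇒≢ (s≤s i≤p))))) (*-congˡ (trans (dd-del T v (pw i) v∈T) (lagrange p (del v T) (ℕ.suc-injective (≡.trans (size-del v T v∈T) e)) i i≤p))))
        (trans (+-congʳ (zeroʳ _)) (trans (+-identityˡ _) shift))))
    where
    shift : - 1# * value p i ≈ value (suc p) (suc i)
    shift with i ℕ.≟ p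
    ... | yes ≡.refl = trans (solve 2 (λ a d → (:- :1) :* (a :* d) := (:- a) :* d) refl (sg p) Δ) (sym (value-≡ (suc p)))
    ... | no ne = trans (zeroʳ _) (sym (value-≢ (ne ∘ ℕ.suc-injective)))

  -- Horner's scheme: every coefficient except the last one meets a power below p and disappears.
  dd-ev : ∀ p T → ∣ T ∣ ≡ suc p → ∀ k j f → suc k ℕ.+ j ≡ suc p → dd T (λ w → ev (suc k) f (x w) * pw j w) ≈ f k * (sg p * Δ)
  dd-ev p T e zero j f eq = trans (dd-cong T λ w → solve 3 (λ f u q → (f :+ u :* :0) :* q := f :* q :+ :0 :* q) refl (f 0) (x w) (pw j w))
    (trans (dd-linear T (f 0) 0# (pw j) (pw j)) (trans (solve 2 (λ d z → d :* z :+ :0 :* z := d :* z) refl _ _)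
      (*-congˡ (trans (lagrange p T e j (ℕ.≤-reflexive (ℕ.suc-injective eq))) (trans (reflexive (≡.cong (value p) (ℕ.suc-injective eq))) (value-≡ p))))))
  dd-ev p T e (suc k) j f eq = trans (dd-cong T λ w → solve 4 (λ f u g q → (f :+ u :* g) :* q := f :* q :+ :1 :* (g :* (u :* q))) refl (f 0) (x w) (ev (suc k) (f ∘ suc) (x w)) (pw j w))
    (trans (dd-linear T (f 0) 1# (pw j) (λ w → ev (suc k) (f ∘ suc) (x w) * pw (suc j) w))
      (trans (+-cong (trans (*-congˡ (trans (lagrange p T e j (ℕ.<⇒≤ j<p)) (value-≢ (ℕ.<⇒≢ j<p)))) (zeroʳ _))
                     (trans (*-identityˡ _) (dd-ev p T e k (suc j) (f ∘ suc) (≡.trans (ℕ.+-suc (suc k) j) eq))))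
        (+-identityˡ _)))
    where
    j<p : j ℕ.< p
    j<p = ≡.subst (suc j ℕ.≤_) (ℕ.suc-injective eq) (s≤s (ℕ.m≤n+m j k))

  interpolate : ∀ p T → ∣ T ∣ ≡ suc p → ∀ f → dd T (λ w → ev (suc p) f (x w)) ≈ f p * (sg p * Δ)
  interpolate p T e f = trans (dd-cong T λ w → sym (*-identityʳ _)) (dd-ev p T e p 0 f (ℕ.+-identityʳ (suc p)))

  Avoids : Fin n → Chain n → Set ℓ
  Avoids w a = ∀ T → lookup T w ≡ true → a T ≈ 0#

  ι-avoids : ∀ {w} {g : Covector n} {a} → Avoids w a → Avoids w (ι g a)
  ι-avoids {w} {g} h T w∈T = ι-vanish {g = g} T λ v _ → h (ins v T) (lookup-ins-mono v w T w∈T)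

  It-avoids : ∀ {w} (h : ℕ → Covector n) m {a} → Avoids w a → Avoids w (It h m a)
  It-avoids h zero    e = e
  It-avoids h (suc m) e = ι-avoids {g = h m} (It-avoids h m e)

  ι-agree : ∀ {w} {g h : Covector n} {a} → Avoids w a → (∀ v → v ≢ w → g v ≈ h v) → ι g a ≐ ι h a
  ι-agree {w} {g} {h} {a} av e T = ι-cong-local T term
    where
    term : ∀ v → lookup T v ≡ false → g v * a (ins v T) ≈ h v * a (ins v T)
    term v _ with v Fin.≟ w
    ... | no ne = *-congʳ (e v ne)
    ... | yes ≡.refl = trans (*-congˡ (av (ins v T) (lookup-ins v T))) (trans (zeroʳ _) (sym (trans (*-congˡ (av (ins v T) (lookup-ins v T))) (zeroʳ _))))

  It-agree : ∀ {w} (g h : ℕ → Covector n) m {a} → Avoids w a → (∀ i v → v ≢ w → g i v ≈ h i v) → It g m a ≐ It h m a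
  It-agree g h zero    av e T = refl
  It-agree g h (suc m) av e T = trans (ι-cong (It-agree g h m av e) T) (ι-agree (It-avoids h m av) (e m) T)

  pw′ : Fin n → ℕ → Covector n
  pw′ w i v = (x v - x w) * pw i v

  pw′-ι : ∀ w i a → ι (pw′ w i) a ≐ λ T → ι (pw (suc i)) a T + - x w * ι (pw i) a T
  pw′-ι w i a T = trans (ι-local₂ {g = pw (suc i)} {g′ = pw i} {z = a} {z′ = a} 1# (- x w) T λ v _ → solve 4 (λ xv xw q z → ((xv :- xw) :* q) :* z := :1 :* ((xv :* q) :* z) :+ (:- xw) :* (q :* z)) refl (x v) (x w) (pw i v) _)
    (+-congʳ (*-identityˡ _))

  -- The covector (x - x w) xⁱ is xⁱ⁺¹ minus a multiple of xⁱ, and by the time it is applied the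
  -- chain has already been contracted with xⁱ, so the multiple contributes nothing.
  telescope : ∀ w m a → It (pw′ w) m (ι (pw 0) a) ≐ It pw (suc m) a
  telescope w zero    a T = refl
  telescope w (suc m) a T = trans (ι-cong (telescope w m a) T) (trans (pw′-ι w m (It pw (suc m) a) T)
    (trans (+-congˡ (trans (*-congˡ (ι-square (pw m) (It pw m a) T)) (zeroʳ _))) (+-identityʳ _)))

  -- The covectors (x - x w) xⁱ vanish at w and thus pass through `ext w` up to sign, while on
  -- chains avoiding w they agree with the covectors of the hypothesis. By `telescope` they can be
  -- traded, together with x⁰, for x⁰, ..., xᵐ.
  star-fill : ∀ w m (ζ y : Chain n) κ → Avoids w ζ → (∀ T → lookup T w ≡ false → y T ≈ 0#) →
    It (λ i v → θ w v * pw i v) m ζ ≐ (λ T → κ * ι (coord w) y T) →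
    It pw (suc m) (ext w ζ) ≐ λ T → κ * ι (pw 0) y T
  star-fill w m ζ y κ ζ-avoids y-off e T = begin
    It pw (suc m) (ext w ζ) T                                  ≈⟨ telescope w m (ext w ζ) T ⟨
    K (ι (pw 0) (ext w ζ)) T                                   ≈⟨ signed-twice m (K (ι (pw 0) (ext w ζ))) T ⟨
    signed m (signed m (K (ι (pw 0) (ext w ζ)))) T             ≈⟨ signed-cong m (ι-It (pw 0) (pw′ w) m (ext w ζ)) T ⟨
    signed m (ι (pw 0) (K (ext w ζ))) T                        ≈⟨ signed-cong m (ι-cong {g = pw 0} K-ext) T ⟩
    signed m (ι (pw 0) (signed m κy)) T                        ≈⟨ signed-cong m (ι-signed (pw 0) m κy) T ⟩
    signed m (signed m (ι (pw 0) κy)) T                        ≈⟨ signed-twice m (ι (pw 0) κy) T ⟩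
    ι (pw 0) κy T                                              ≈⟨ ι-scale (pw 0) κ y T ⟩
    κ * ι (pw 0) y T                                           ∎
    where
    open import Relation.Binary.Reasoning.Setoid setoid
    K : Chain n → Chain n
    K = It (pw′ w) m
    κy : Chain n
    κy U = κ * y U
    Kζ : K ζ ≐ λ U → κ * ι (coord w) y U
    Kζ U = trans (It-agree (pw′ w) (λ i v → θ w v * pw i v) m ζ-avoids (λ i v ne → *-congʳ (sym (θ-≢ ne))) U) (e U)
    K-ext : K (ext w ζ) ≐ signed m κy
    K-ext U = begin
      K (ext w ζ) U                                            ≈⟨ It-ext (pw′ w) w m ζ (λ i → trans (*-congʳ (-‿inverseʳ (x w))) (zeroˡ (pw i w))) U ⟩
      signed m (ext w (K ζ)) U                                 ≈⟨ signed-cong m (ext-cong w Kζ) U ⟩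
      signed m (ext w (λ V → κ * ι (coord w) y V)) U           ≈⟨ signed-cong m (ext-scale w κ (ι (coord w) y)) U ⟩
      signed m (λ V → κ * ext w (ι (coord w) y) V) U           ≈⟨ signed-cong m (λ V → *-congˡ (ext-ι w y-off V)) U ⟩
      signed m κy U                                            ∎

  -- Exactness of iterated contractions on links

  module Exactness (L : Subset n → Bool) (L-closed : ∀ v T → L (ins v T) ≡ true → L T ≡ true) (d : ℕ) where

    lkᵇ : Subset n → ℕ → Subset n → Bool
    lkᵇ A p T = linkᵇ L A T ∧ (∣ T ∣ ≡ᵇ p)

    InC : Subset n → ℕ → Chain n → Set ℓ
    InC A p a = ∀ T → lkᵇ A p T ≡ false → a T ≈ 0#

    lk-intro : ∀ {A p T} → disjointᵇ A T ≡ true → L (A ∪ T) ≡ true → ∣ T ∣ ≡ p → lkᵇ A p T ≡ true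
    lk-intro d l e = ∧-intro (∧-intro d l) (≡ᵇ-intro e)

    lk-elim : ∀ {A p T} → lkᵇ A p T ≡ true → disjointᵇ A T ≡ true × L (A ∪ T) ≡ true × ∣ T ∣ ≡ p
    lk-elim h = let (dl , e) = ∧-true h ; (d , l) = ∧-true dl in d , l , ≡ᵇ-true e

    lk-ins : ∀ {A p} v T → lookup T v ≡ false → lkᵇ A (suc p) (ins v T) ≡ true → lkᵇ A p T ≡ true
    lk-ins {A} {p} v T v∉T h = let (d , l , e) = lk-elim {A} {suc p} {ins v T} h in
      lk-intro {A} {p} {T} (proj₂ (disjoint-insʳ v A T d)) (L-closed v (A ∪ T) (≡.subst (λ S → L S ≡ true) (∪-ins v A T) l))
        (ℕ.suc-injective (≡.trans (≡.sym (size-ins v T v∉T)) e))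

    lk-ins⁺ : ∀ {A p} v T → lookup T v ≡ false → lkᵇ A (suc p) (ins v T) ≡ true → lkᵇ (ins v A) p T ≡ true
    lk-ins⁺ {A} {p} v T v∉T h = let (d , l , e) = lk-elim {A} {suc p} {ins v T} h in
      lk-intro {ins v A} {p} {T} (disjoint-intro-insˡ v A T v∉T (proj₂ (disjoint-insʳ v A T d)))
        (≡.subst (λ S → L S ≡ true) (≡.trans (∪-ins v A T) (≡.sym (ins-∪ v A T))) l)
        (ℕ.suc-injective (≡.trans (≡.sym (size-ins v T v∉T)) e))

    lk-ins⁻ : ∀ {A p} v T → lookup A v ≡ false → lkᵇ (ins v A) p T ≡ true → lkᵇ A (suc p) (ins v T) ≡ true
    lk-ins⁻ {A} {p} v T v∉A h = let (d , l , e) = lk-elim {ins v A} {p} {T} h ; (v∉T , d′) = disjoint-insˡ v A T d in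
      lk-intro {A} {suc p} {ins v T} (disjoint-intro-insʳ v A T v∉A d′)
        (≡.subst (λ S → L S ≡ true) (≡.trans (ins-∪ v A T) (≡.sym (∪-ins v A T))) l)
        (≡.trans (size-ins v T v∉T) (≡.cong suc e))

    InC-ι : ∀ {A p} {g : Covector n} {a} → InC A (suc p) a → InC A p (ι g a)
    InC-ι {A} {p} {g} h T e = ι-vanish {g = g} T λ v v∉T → h (ins v T) (¬true⇒false λ t → true≢false (lk-ins {A} {p} v T v∉T t) e)

    InC-It : ∀ {A p} (h : ℕ → Covector n) m {a} → InC A (p ℕ.+ m) a → InC A p (It h m a)
    InC-It {A} {p} h zero {a} i = ≡.subst (λ q → InC A q a) (ℕ.+-identityʳ p) i
    InC-It {A} {p} h (suc m) {a} i = InC-ι {A} {p} {h m} (InC-It {A} {suc p} h m (≡.subst (λ q → InC A q a) (ℕ.+-suc p m) i))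

    InC-signed : ∀ {A p} m {a} → InC A p a → InC A p (signed m a)
    InC-signed m h T e = signed-zero m T (h T e)

    InC-size : ∀ {A p a} T → InC A p a → ∣ T ∣ ≢ p → a T ≈ 0#
    InC-size {A} {p} T h ne = h T (¬true⇒false λ t → ne (proj₂ (proj₂ (lk-elim {A} {p} {T} t))))

    InC-avoids : ∀ {A p a} v → InC A p a → lookup A v ≡ true → Avoids v a
    InC-avoids {A} {p} v h v∈A T v∈T = h T (¬true⇒false λ t → true≢false v∈A (disjoint-lookup v A T (proj₁ (lk-elim {A} {p} {T} t)) v∈T))

    -- The induction step invokes its hypothesis twice in succession, once in the link of A and once
    -- in the links of the vertices, and then interpolates at the cost of Δ.
    δ : ℕ → Carrier
    δ zero    = 1#
    δ (suc m) = (δ m * δ m) * Δ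

    δ-regular : ∀ m → Regular (δ m)
    δ-regular zero    = Regular-1
    δ-regular (suc m) = Regular-* (Regular-* (δ-regular m) (δ-regular m)) Δ-regular

    -- The claim is made for all A and p at once because the step for A passes to `ins w A`. The
    -- bound by d keeps the solution within sizes where homology of the links is known to vanish.
    Exact : ℕ → Set (c ⊔ ℓ)
    Exact m = ∀ A p a → InC A p a → ∣ A ∣ ℕ.+ (p ℕ.+ suc m) ℕ.≤ d → (∀ i → i ℕ.≤ m → ∀ T → ι (pw i) a T ≈ 0#) →
      Σ (Chain n) λ y → InC A (p ℕ.+ suc m) y × It pw (suc m) y ≐ λ T → δ m * a T

    -- Rescaling the basis vectors turns the covectors ϑ xⁱ into the covectors xⁱ.
    scaled : ∀ m → Exact m → (ϑ : Covector n) → (∀ v → Regular (ϑ v)) →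
      ∀ A p a → InC A p a → ∣ A ∣ ℕ.+ (p ℕ.+ suc m) ℕ.≤ d → (∀ i → i ℕ.≤ m → ∀ T → ι (λ v → ϑ v * pw i v) a T ≈ 0#) →
      Σ (Chain n) λ y → InC A (p ℕ.+ suc m) y × It (λ i v → ϑ v * pw i v) (suc m) y ≐ λ T → (co ϑ ⊥ * δ m) * a T
    scaled m G ϑ reg A p a ia le kill = y , iy , solves
      where
      S : Chain n → Chain n
      S b T = ex ϑ T * b T
      S-ι : ∀ g b T → ι g (S b) T ≈ ex ϑ T * ι (λ v → ϑ v * g v) b T
      S-ι g b T = ι-local (ex ϑ T) T λ v v∉T → trans (*-congˡ (*-congʳ (ex-ins ϑ v T v∉T))) (solve 4 (λ g t e b → g :* ((t :* e) :* b) := e :* ((t :* g) :* b)) refl (g v) (ϑ v) (ex ϑ T) _)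
      S-It : ∀ k b T → ex ϑ T * It (λ i v → ϑ v * pw i v) k b T ≈ It pw k (S b) T
      S-It zero    b T = refl
      S-It (suc k) b T = trans (sym (S-ι (pw k) (It (λ i v → ϑ v * pw i v) k b) T)) (ι-cong (S-It k b) T)
      sol = G A p (S a) (λ T e → trans (*-congˡ (ia T e)) (zeroʳ _)) le λ i i≤m T → trans (S-ι (pw i) a T) (trans (*-congˡ (kill i i≤m T)) (zeroʳ _))
      y′ = proj₁ sol
      y : Chain n
      y T = co ϑ T * y′ T
      iy : InC A (p ℕ.+ suc m) y
      iy T e = trans (*-congˡ (proj₁ (proj₂ sol) T e)) (zeroʳ _)
      K = It (λ i v → ϑ v * pw i v) (suc m) y
      solves : K ≐ λ T → (co ϑ ⊥ * δ m) * a T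
      solves T = trans (solve 2 (λ k b → k := (k :- b) :+ b) refl (K T) ((co ϑ ⊥ * δ m) * a T))
        (trans (+-congʳ (ex-regular ϑ T reg _ (trans (solve 3 (λ e k b → e :* (k :- b) := e :* k :- e :* b) refl (ex ϑ T) (K T) ((co ϑ ⊥ * δ m) * a T))
          (trans (+-congʳ (trans (S-It (suc m) y T) (trans (It-cong pw (suc m) (λ U → trans (sym (*-assoc _ _ _)) (*-congʳ (ex-co ϑ U))) T)
              (trans (It-scale pw (suc m) (co ϑ ⊥) y′ T) (*-congˡ (proj₂ (proj₂ sol) T))))))
            (solve 4 (λ c d e a → c :* (d :* (e :* a)) :- e :* ((c :* d) :* a) := :0) refl (co ϑ ⊥) (δ m) (ex ϑ T) (a T))))))
          (+-identityˡ _))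

    -- Multiplying a T by the product of the u - x v over T gives, for every u, a chain killed by
    -- x⁰, …, xᵐ, hence chains Y i with generating function Y in u; the partial fraction of
    -- Y T / ∏ (u - x v) at u = x w is supported on the star of w and comes from a chain of the
    -- link of w that is killed by one covector less.
    module Step (m : ℕ) (G : Exact m) (A : Subset n) (p : ℕ) (a : Chain n) (ia : InC A p a)
      (le : ∣ A ∣ ℕ.+ (p ℕ.+ suc (suc m)) ℕ.≤ d) (kill : ∀ i → i ℕ.≤ suc m → ∀ T → ι (pw i) a T ≈ 0#) where

      le₁ : suc (∣ A ∣ ℕ.+ (p ℕ.+ suc m)) ℕ.≤ d
      le₁ = ≡.subst (ℕ._≤ d) (≡.trans (≡.cong (∣ A ∣ ℕ.+_) (ℕ.+-suc p (suc m))) (ℕ.+-suc ∣ A ∣ (p ℕ.+ suc m))) le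

      -- Inserting v multiplies the product over T by u - x v, so contracting with xʲ produces
      -- contractions of a with xʲ and with xʲ⁺¹. Both vanish, which is why one covector is given up
      -- here.
      solution : ∀ i → Σ (Chain n) λ b → InC A (p ℕ.+ suc m) b × It pw (suc m) b ≐ λ T → δ m * (ε x T i * a T)
      solution i = G A p (λ T → ε x T i * a T) (λ T e → trans (*-congˡ (ia T e)) (zeroʳ _)) (ℕ.<⇒≤ le₁) λ j j≤m T →
        trans (ι-local₂ {g = pw j} {g′ = pw (suc j)} {z = a} {z′ = a} (prev (ε x T) i) (- ε x T i) T λ v v∉T →
            trans (*-congˡ (*-congʳ (ε-ins x v T i v∉T))) (solve 5 (λ q r xv e z → q :* ((r :- xv :* e) :* z) := r :* (q :* z) :+ (:- e) :* ((xv :* q) :* z)) refl (pw j v) (prev (ε x T) i) (x v) (ε x T i) _))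
          (trans (+-cong (trans (*-congˡ (kill j (ℕ.m≤n⇒m≤1+n j≤m) T)) (zeroʳ _)) (trans (*-congˡ (kill (suc j) (s≤s j≤m) T)) (zeroʳ _))) (+-identityˡ 0#))

      abstract
        Y : ℕ → Chain n
        -- Contracting with x¹, ..., xᵐ and saving x⁰ for the end leaves a chain killed by these m
        -- covectors whose contraction with x⁰ is known; the sign pays for moving x⁰ past them.
        Y i = signed m (It (pw ∘ suc) m (proj₁ (solution i)))

        Y-in : ∀ i → InC A (suc p) (Y i)
        Y-in i = InC-signed {A} {suc p} m (InC-It {A} {suc p} (pw ∘ suc) m (≡.subst (λ q → InC A q (proj₁ (solution i))) (ℕ.+-suc p m) (proj₁ (proj₂ (solution i)))))

        Y-zero : ∀ i T → ι (pw 0) (Y i) T ≈ δ m * (ε x T i * a T)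
        Y-zero i T = trans (ι-signed (pw 0) m (It (pw ∘ suc) m (proj₁ (solution i))) T)
          (trans (signed-cong m (ι-It (pw 0) (pw ∘ suc) m (proj₁ (solution i))) T)
            (trans (signed-twice m (It (pw ∘ suc) m (ι (pw 0) (proj₁ (solution i)))) T)
              (trans (sym (It-head pw m (proj₁ (solution i)) T)) (proj₂ (proj₂ (solution i)) T))))

        Y-suc : ∀ i j → j ℕ.< m → ∀ T → ι (pw (suc j)) (Y i) T ≈ 0#
        Y-suc i j j<m T = trans (ι-signed (pw (suc j)) m (It (pw ∘ suc) m (proj₁ (solution i))) T)
          (signed-zero m T (It-kill (pw ∘ suc) m (proj₁ (solution i)) j j<m T))

        E : Fin n → Chain n
        E w T = ev (suc p) (λ i → Y i T) (x w)

        E-in : ∀ w → InC A (suc p) (E w)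
        E-in w T e = ev-zero (suc p) (x w) λ i → Y-in i T e

        E-kill : ∀ w i → i ℕ.≤ m → ∀ T → lookup T w ≡ true → ι (pw i) (E w) T ≈ 0#
        E-kill w (suc j) lt T w∈T = trans (ι-ev (pw (suc j)) (suc p) Y (x w) T) (ev-zero (suc p) (x w) λ i → Y-suc i j lt T)
        E-kill w zero _ T w∈T = trans (ι-ev (pw 0) (suc p) Y (x w) T) (trans (ev-cong (suc p) (x w) λ i → trans (Y-zero i T) (solve 3 (λ d e z → d :* (e :* z) := (d :* z) :* e) refl (δ m) (ε x T i) (a T)))
          (trans (ev-scale (suc p) (δ m * a T) (ε x T) (x w)) (bySize (∣ T ∣ ℕ.≟ p))))
          where
          bySize : Dec (∣ T ∣ ≡ p) → (δ m * a T) * ev (suc p) (ε x T) (x w) ≈ 0#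
          -- Evaluation at x w helps precisely on sets containing w, for which x w is a root of the
          -- product over T.
          bySize (yes e) = trans (*-congˡ (ε-root x w T (suc p) w∈T (s≤s (ℕ.≤-reflexive e)))) (zeroʳ _)
          bySize (no ne) = trans (*-congʳ (trans (*-congˡ (InC-size {A} {p} T ia ne)) (zeroʳ _))) (zeroˡ _)

        E-def : ∀ w T → E w T ≈ ev (suc p) (λ i → Y i T) (x w)
        E-def w T = refl

      -- The product over the complement of T replaces division by the x v - x w with v in T other
      -- than w; the difference is the factor `Θ w`.
      y : Fin n → Chain n
      y w T = (ind w T * co (θ w) T) * E w T

      y-in : ∀ w → InC A (suc p) (y w)
      y-in w T e = trans (*-congˡ (E-in w T e)) (zeroʳ _)

      y-off : ∀ w T → lookup T w ≡ false → y w T ≈ 0#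
      y-off w T e = trans (*-congʳ (trans (*-congʳ (ind-false w T e)) (zeroˡ _))) (zeroˡ _)

      y-kill : ∀ w i → i ℕ.≤ m → ∀ T → ι (pw′ w i) (y w) T ≈ 0#
      y-kill w i i≤m T with decᵇ (lookup T w)
      ... | inj₁ w∈T = trans (ι-local {g = pw i} {z = E w} (co (θ w) T) T term) (trans (*-congˡ (E-kill w i i≤m T w∈T)) (zeroʳ _))
        where
        term : ∀ v → lookup T v ≡ false → pw′ w i v * y w (ins v T) ≈ co (θ w) T * (pw i v * E w (ins v T))
        term v v∉T = trans (*-congˡ (*-congʳ (trans (*-congʳ (ind-true w (ins v T) (lookup-ins-mono v w T w∈T))) (*-identityˡ _))))
          (trans (solve 4 (λ d q k z → (d :* q) :* (k :* z) := (d :* k) :* (q :* z)) refl (x v - x w) (pw i v) (co (θ w) (ins v T)) (E w (ins v T)))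
            (*-congʳ (trans (*-congʳ (sym (θ-≢ λ v≡w → true≢false w∈T (≡.trans (≡.cong (lookup T) (≡.sym v≡w)) v∉T)))) (co-ins (θ w) v T v∉T))))
      ... | inj₂ w∉T = trans (ι-local {g = pw i} {z = E w} 0# T term) (zeroˡ _)
        where
        term : ∀ v → lookup T v ≡ false → pw′ w i v * y w (ins v T) ≈ 0# * (pw i v * E w (ins v T))
        term v v∉T with v Fin.≟ w
        ... | yes ≡.refl = solve 4 (λ x q z b → ((x :- x) :* q) :* z := :0 :* b) refl (x v) (pw i v) (y v (ins v T)) (pw i v * E v (ins v T))
        ... | no ne = trans (*-congˡ (y-off w (ins v T) (≡.trans (lookup-ins-≢ T (ne ∘ ≡.sym)) w∉T))) (trans (zeroʳ _) (sym (zeroˡ _)))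

      η : Fin n → Chain n
      η w = ι (coord w) (y w)

      η-avoids : ∀ w → Avoids w (η w)
      η-avoids w T w∈T = trans (ι-local {g = coord w} {z = y w} 0# T λ v v∉T → trans (*-congʳ (coord-≢ λ e → true≢false w∈T (≡.trans (≡.cong (lookup T) (≡.sym e)) v∉T))) (trans (zeroˡ _) (sym (zeroˡ _)))) (zeroˡ _)

      η-in : ∀ w → InC (ins w A) p (η w)
      η-in w T e = trans (ι-local {g = coord w} {z = y w} 0# T term) (zeroˡ _)
        where
        term : ∀ v → lookup T v ≡ false → coord w v * y w (ins v T) ≈ 0# * (coord w v * y w (ins v T))
        term v v∉T with v Fin.≟ w
        ... | no ne = trans (*-congʳ (coord-≢ ne)) (trans (zeroˡ _) (sym (zeroˡ _)))
        ... | yes ≡.refl = trans (*-congˡ (y-in v (ins v T) (¬true⇒false λ t → true≢false (lk-ins⁺ {A} {p} v T v∉T t) e))) (trans (zeroʳ _) (sym (zeroˡ _)))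

      η-kill : ∀ w i → i ℕ.≤ m → ∀ T → ι (λ v → θ w v * pw i v) (η w) T ≈ 0#
      η-kill w i i≤m T = trans (ι-agree {h = pw′ w i} (η-avoids w) (λ v ne → *-congʳ (θ-≢ ne)) T)
        (trans (ι-anticomm (pw′ w i) (coord w) (y w) T) (trans (-‿cong (ι-zero (coord w) (y-kill w i i≤m) T)) -0#≈0#))

      Filler : Fin n → Set (c ⊔ ℓ)
      Filler w = Σ (Chain n) λ z → InC A (p ℕ.+ suc (suc m)) z × It pw (suc (suc m)) z ≐ λ T → (Θ w * δ m) * ι (pw 0) (y w) T

      filler-∈ : ∀ w → lookup A w ≡ true → Filler w
      filler-∈ w w∈A = (λ _ → 0#) , (λ _ _ → refl) , λ T → trans (It-zero pw (suc (suc m)) (λ _ → refl) T)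
          (sym (trans (*-congˡ (ι-zero (pw 0) (λ U → vanishes U (decᵇ (lookup U w))) T)) (zeroʳ _)))
        where
        vanishes : ∀ T → lookup T w ≡ true ⊎ lookup T w ≡ false → y w T ≈ 0#
        vanishes T (inj₁ w∈T) = InC-avoids {A} {suc p} w (y-in w) w∈A T w∈T
        vanishes T (inj₂ w∉T) = y-off w T w∉T

      filler-∉ : ∀ w → lookup A w ≡ false → Filler w
      filler-∉ w w∉A = finish (scaled m G (θ w) (θ-regular w) (ins w A) p (η w) (η-in w)
                (ℕ.≤-trans (ℕ.+-monoˡ-≤ (p ℕ.+ suc m) (size-ins-≤ w A)) le₁) (η-kill w))
        where
        finish : (Σ (Chain n) λ z → InC (ins w A) (p ℕ.+ suc m) z × It (λ i v → θ w v * pw i v) (suc m) z ≐ λ T → (Θ w * δ m) * η w T) → Filler w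
        finish (ζ , iζ , e) = ext w ζ , in-A , star-fill w (suc m) ζ (y w) (Θ w * δ m) (InC-avoids {ins w A} {p ℕ.+ suc m} w iζ (lookup-ins w A)) (y-off w) e
          where
          in-A : InC A (p ℕ.+ suc (suc m)) (ext w ζ)
          in-A T e = ext-vanish w T λ w∈T → iζ (del w T) (¬true⇒false λ t →
            true≢false (≡.subst₂ (λ q S → lkᵇ A q S ≡ true) (≡.sym (ℕ.+-suc p (suc m))) (ins-del w T w∈T) (lk-ins⁻ {A} {p ℕ.+ suc m} w (del w T) w∉A t)) e)

      filler : ∀ w → Filler w
      filler w = [ filler-∈ w , filler-∉ w ]′ (decᵇ (lookup A w))

      -- On a set of p + 1 points, `Y` is used as a polynomial of degree at most p in u, so the
      -- weighted sum of its values at these points is its leading coefficient. That coefficient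
      -- suffices because the product over a set of size p is monic of degree p.
      sum-y : ∀ T → (sumF λ w → M w * y w T) ≈ (sg p * Δ) * Y p T
      sum-y T = by (∣ T ∣ ℕ.≟ suc p)
        where
        by : Dec (∣ T ∣ ≡ suc p) → (sumF λ w → M w * y w T) ≈ (sg p * Δ) * Y p T
        by (yes e) = trans (sumF-cong λ w → trans (sym (*-assoc _ _ _)) (*-congˡ (E-def w T))) (trans (interpolate p T e (λ i → Y i T)) (*-comm _ _))
        by (no ne) = trans (sumF-zero λ w → trans (*-congˡ (InC-size {A} {suc p} T (y-in w) ne)) (zeroʳ _))
          (sym (trans (*-congˡ (InC-size {A} {suc p} T (Y-in p) ne)) (zeroʳ _)))

      result : Σ (Chain n) λ z → InC A (p ℕ.+ suc (suc m)) z × It pw (suc (suc m)) z ≐ λ T → δ (suc m) * a T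
      result = z , (λ T e → trans (*-congˡ (sumF-zero λ w → trans (*-congˡ (proj₁ (proj₂ (filler w)) T e)) (zeroʳ _))) (zeroʳ _)) , solves
        where
        z₀ z : Chain n
        -- The filler at w already carries the factor `Θ w`, so weighting it by `N w` yields the
        -- weight `M w` required by `sum-y`.
        z₀ T = sumF λ w → N w * proj₁ (filler w) T
        z T = sg p * z₀ T
        ε-top : ∀ T → ε x T p * a T ≈ a T
        ε-top T with ∣ T ∣ ℕ.≟ p
        ... | yes ≡.refl = trans (*-congʳ (ε-lead x T)) (*-identityˡ _)
        ... | no ne = trans (*-congˡ (InC-size {A} {p} T ia ne)) (trans (zeroʳ _) (sym (InC-size {A} {p} T ia ne)))
        sums : ∀ T → It pw (suc (suc m)) z₀ T ≈ δ m * ι (pw 0) (λ U → sumF λ w → M w * y w U) T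
        sums T = trans (It-sum pw (suc (suc m)) (λ w U → N w * proj₁ (filler w) U) T)
          (trans (sumF-cong λ w → trans (It-scale pw (suc (suc m)) (N w) (proj₁ (filler w)) T) (trans (*-congˡ (proj₂ (proj₂ (filler w)) T))
              (solve 4 (λ n t d q → n :* ((t :* d) :* q) := d :* ((n :* t) :* q)) refl (N w) (Θ w) (δ m) _)))
            (trans (sumF-scale (δ m) (λ w → M w * ι (pw 0) (y w) T)) (*-congˡ (sym (trans (It-sum pw 1 (λ w U → M w * y w U) T) (sumF-cong λ w → ι-scale (pw 0) (M w) (y w) T))))))
        solves : It pw (suc (suc m)) z ≐ λ T → δ (suc m) * a T
        solves T = trans (It-scale pw (suc (suc m)) (sg p) z₀ T) (trans (*-congˡ (trans (sums T) (*-congˡ (trans (ι-cong sum-y T) (trans (ι-scale (pw 0) (sg p * Δ) (Y p) T) (*-congˡ (trans (Y-zero p T) (*-congˡ (ε-top T)))))))))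
          (trans (solve 4 (λ s d D z → s :* (d :* ((s :* D) :* (d :* z))) := (s :* s) :* (((d :* d) :* D) :* z)) refl (sg p) (δ m) Δ (a T))
            (trans (*-congʳ (sg-sq p)) (*-identityˡ _))))

    exact : Exact 0 → ∀ m → Exact m
    exact base zero    = base
    exact base (suc m) A p a ia le kill = Step.result m (exact base m) A p a ia le kill

-- Inclusion, difference and search among subsets

subᵇ : ∀ {n} → Subset n → Subset n → Bool
subᵇ []      []      = true
subᵇ (a ∷ A) (b ∷ B) = (not a ∨ b) ∧ subᵇ A B

subᵇ-lookup : ∀ {n} (A B : Subset n) v → subᵇ A B ≡ true → lookup A v ≡ true → lookup B v ≡ true
subᵇ-lookup (true ∷ A) (b ∷ B) zero    h e = proj₁ (∧-true h)
subᵇ-lookup (a ∷ A)    (b ∷ B) (suc v) h e = subᵇ-lookup A B v (proj₂ (∧-true {not a ∨ b} h)) e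

subᵇ-intro : ∀ {n} (A B : Subset n) → (∀ v → lookup A v ≡ true → lookup B v ≡ true) → subᵇ A B ≡ true
subᵇ-intro []          []      h = ≡.refl
subᵇ-intro (true ∷ A)  (b ∷ B) h = ∧-intro (h zero ≡.refl) (subᵇ-intro A B (h ∘ suc))
subᵇ-intro (false ∷ A) (b ∷ B) h = subᵇ-intro A B (h ∘ suc)

subᵇ-refl : ∀ {n} (A : Subset n) → subᵇ A A ≡ true
subᵇ-refl A = subᵇ-intro A A λ _ e → e

subᵇ-ins : ∀ {n} v (A B : Subset n) → subᵇ A B ≡ true → lookup B v ≡ true → subᵇ (ins v A) B ≡ true
subᵇ-ins v A B h e = subᵇ-intro (ins v A) B λ u u∈ → by u u∈ (u Fin.≟ v)
  where
  by : ∀ u → lookup (ins v A) u ≡ true → Dec (u ≡ v) → lookup B u ≡ true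
  by u u∈ (yes ≡.refl) = e
  by u u∈ (no ne)      = subᵇ-lookup A B u h (≡.trans (≡.sym (lookup-ins-≢ A ne)) u∈)

subᵇ-ins⁻ : ∀ {n} v (A B : Subset n) → subᵇ (ins v A) B ≡ true → subᵇ A B ≡ true
subᵇ-ins⁻ v A B h = subᵇ-intro A B λ u e → subᵇ-lookup (ins v A) B u h (lookup-ins-mono v u A e)

subᵇ-ins-self : ∀ {n} v (A : Subset n) → subᵇ A (ins v A) ≡ true
subᵇ-ins-self v A = subᵇ-intro A (ins v A) λ u → lookup-ins-mono v u A

diff : ∀ {n} → Subset n → Subset n → Subset n
diff []          []          = []
diff (g ∷ G)     (true ∷ C)  = false ∷ diff G C
diff (g ∷ G)     (false ∷ C) = g ∷ diff G C

diff-disjoint : ∀ {n} (G C : Subset n) → disjointᵇ C (diff G C) ≡ true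
diff-disjoint []      []          = ≡.refl
diff-disjoint (g ∷ G) (true ∷ C)  = diff-disjoint G C
diff-disjoint (g ∷ G) (false ∷ C) = diff-disjoint G C

diff-∪ : ∀ {n} (G C : Subset n) → subᵇ C G ≡ true → C ∪ diff G C ≡ G
diff-∪ []          []          h = ≡.refl
diff-∪ (true ∷ G)  (true ∷ C)  h = ≡.cong (true ∷_) (diff-∪ G C h)
diff-∪ (false ∷ G) (true ∷ C)  ()
diff-∪ (g ∷ G)     (false ∷ C) h = ≡.cong (g ∷_) (diff-∪ G C h)

diff-size : ∀ {n} (G C : Subset n) → subᵇ C G ≡ true → ∣ C ∣ ℕ.+ ∣ diff G C ∣ ≡ ∣ G ∣
diff-size []          []          h = ≡.refl
diff-size (true ∷ G)  (true ∷ C)  h = ≡.cong suc (diff-size G C h)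
diff-size (false ∷ G) (true ∷ C)  ()
diff-size (true ∷ G)  (false ∷ C) h = ≡.trans (ℕ.+-suc ∣ C ∣ _) (≡.cong suc (diff-size G C h))
diff-size (false ∷ G) (false ∷ C) h = diff-size G C h

diff-lookup : ∀ {n} (G C : Subset n) v → lookup (diff G C) v ≡ true → lookup G v ≡ true × lookup C v ≡ false
diff-lookup (g ∷ G) (false ∷ C) zero    e = e , ≡.refl
diff-lookup (g ∷ G) (true ∷ C)  (suc v) e = diff-lookup G C v e
diff-lookup (g ∷ G) (false ∷ C) (suc v) e = diff-lookup G C v e

someᵇ : ∀ {n} → (Subset n → Bool) → Bool
someᵇ {zero}  P = P []
someᵇ {suc n} P = someᵇ (P ∘ (false ∷_)) ∨ someᵇ (P ∘ (true ∷_))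

someᵇ-true : ∀ {n} (P : Subset n → Bool) → someᵇ P ≡ true → ∃ λ T → P T ≡ true
someᵇ-true {zero}  P e = [] , e
someᵇ-true {suc n} P e with ∨-true e
... | inj₁ h = let (T , t) = someᵇ-true _ h in false ∷ T , t
... | inj₂ h = let (T , t) = someᵇ-true _ h in true ∷ T , t

someᵇ-intro : ∀ {n} (P : Subset n → Bool) T → P T ≡ true → someᵇ P ≡ true
someᵇ-intro P []          e = e
someᵇ-intro P (false ∷ T) e rewrite someᵇ-intro (P ∘ (false ∷_)) T e = ≡.refl
someᵇ-intro P (true ∷ T)  e = ∨-introʳ (someᵇ (P ∘ (false ∷_))) (someᵇ-intro (P ∘ (true ∷_)) T e)

-- The simplicial boundary as a contraction

module Boundary {c ℓ} (F : Field c ℓ) where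
  open Field F hiding (zero)
  open import Algebra.Properties.Ring ring using (-0#≈0#; -‿involutive)
  open Exterior commutativeRing

  if-true : ∀ {b x y} → b ≡ true → (if b then x else y) ≈ x
  if-true ≡.refl = refl

  if-false : ∀ {b x y} → b ≡ false → (if b then x else y) ≈ y
  if-false ≡.refl = refl

  𝟏 : ∀ {n} → Covector n
  𝟏 _ = 1#

  module _ {n} (L : Subset n → Bool) where
    open Homology F L using (∂; sgn)

    parity : ∀ m → (suc m % 2 ≡ᵇ 0) ≡ not (m % 2 ≡ᵇ 0)
    parity zero          = ≡.refl
    parity (suc zero)    = ≡.refl
    parity (suc (suc m)) = parity m

    sgn-suc : ∀ m x → sgn (suc m) x ≈ sgn m (- x)
    sgn-suc m x rewrite parity m with m % 2 ≡ᵇ 0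
    ... | true  = refl
    ... | false = sym (-‿involutive x)

    sgn-0 : ∀ m → sgn m 0# ≈ 0#
    sgn-0 m with m % 2 ≡ᵇ 0
    ... | true  = refl
    ... | false = -0#≈0#

    -- The boundary ignores values outside L, whereas a contraction reads them all; cutting the
    -- chain down to L makes the two agree.
    mask : Chain n → Chain n
    mask ch T = if L T then ch T else 0#

    sumL : ∀ {m} → (Fin m → Carrier) → Carrier
    sumL f = foldr _+_ 0# (tabulate f)

    sumL-cong : ∀ {m} {f g : Fin m → Carrier} → (∀ v → f v ≈ g v) → sumL f ≈ sumL g
    sumL-cong {zero}  e = refl
    sumL-cong {suc m} e = +-cong (e zero) (sumL-cong (e ∘ suc))

    sumL-ι : ∀ {m} (a : Chain m) σ → sumL (λ v → if not (lookup σ v) then sgn (countBelow σ v) (a (ins v σ)) else 0#) ≈ ι 𝟏 a σ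
    sumL-ι {zero}  a []          = refl
    sumL-ι {suc m} a (false ∷ σ) = +-cong (sym (*-identityˡ _)) (sumL-ι (a ∘ (false ∷_)) σ)
    sumL-ι {suc m} a (true ∷ σ)  = trans (+-identityˡ _) (trans (sumL-cong λ v → step v) (trans (sumL-ι (λ T → - a (true ∷ T)) σ) (ι-neg 𝟏 (a ∘ (true ∷_)) σ)))
      where
      step : ∀ v → (if not (lookup σ v) then sgn (suc (countBelow σ v)) (a (true ∷ ins v σ)) else 0#) ≈ (if not (lookup σ v) then sgn (countBelow σ v) (- a (true ∷ ins v σ)) else 0#)
      step v with lookup σ v
      ... | true  = refl
      ... | false = sgn-suc (countBelow σ v) _

    ∂-ι : ∀ ch σ → ∂ ch σ ≈ ι 𝟏 (mask ch) σ
    ∂-ι ch σ = trans (reflexive (≡.cong (foldr _+_ 0#) (List.map-tabulate id f))) (trans (sumL-cong term) (sumL-ι (mask ch) σ))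
      where
      f : Fin n → Carrier
      f v = if not (lookup σ v) ∧ L (σ ∪ ⁅ v ⁆) then sgn (countBelow σ v) (ch (σ ∪ ⁅ v ⁆)) else 0#
      term : ∀ v → f v ≈ (if not (lookup σ v) then sgn (countBelow σ v) (mask ch (ins v σ)) else 0#)
      term v rewrite ∪-⁅⁆ σ v with lookup σ v
      ... | true = refl
      ... | false with L (ins v σ)
      ...   | true  = refl
      ...   | false = sym (sgn-0 (countBelow σ v))

-- Purity of Cohen-Macaulay complexes and the base case of exactness

module PureComplex {c ℓ} (F : Field c ℓ) {n : ℕ} (L : Subset n → Bool)
  (L-closed : ∀ v T → L (ins v T) ≡ true → L T ≡ true) (d : ℕ) (L-size : ∀ T → L T ≡ true → ∣ T ∣ ℕ.≤ d)
  (CM : CohenMacaulay F L) (top : Σ (Subset n) λ G → L G ≡ true × ∣ G ∣ ≡ d) where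
  open Field F hiding (zero)
  open IntegerSolver commutativeRing
  open Exterior commutativeRing
  open Boundary F

  extᵇ : Subset n → Bool
  extᵇ C = someᵇ λ G → L G ∧ ((∣ G ∣ ≡ᵇ d) ∧ subᵇ C G)

  extᵇ-intro : ∀ C G → L G ≡ true → ∣ G ∣ ≡ d → subᵇ C G ≡ true → extᵇ C ≡ true
  extᵇ-intro C G l e s = someᵇ-intro _ G (∧-intro l (∧-intro (≡ᵇ-intro e) s))

  extᵇ-elim : ∀ C → extᵇ C ≡ true → Σ (Subset n) λ G → L G ≡ true × ∣ G ∣ ≡ d × subᵇ C G ≡ true
  extᵇ-elim C h = let (G , t) = someᵇ-true _ h ; (l , t′) = ∧-true t ; (e , s) = ∧-true t′ in G , l , ≡ᵇ-true e , s

  L-∪ : ∀ A T → L (A ∪ T) ≡ true → L A ≡ true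
  L-∪ A T l = go ∣ T ∣ T ≡.refl l
    where
    go : ∀ k T → ∣ T ∣ ≡ k → L (A ∪ T) ≡ true → L A ≡ true
    go zero    T e l = ≡.subst (λ S → L S ≡ true) (≡.trans (≡.cong (A ∪_) (size-0 T e)) (∪-identityʳ A)) l
    go (suc k) T e l = let (v , v∈T) = size-pos T e in
      go k (del v T) (ℕ.suc-injective (≡.trans (size-del v T v∈T) e))
        (L-closed v _ (≡.subst (λ S → L S ≡ true) (≡.trans (≡.cong (A ∪_) (≡.sym (ins-del v T v∈T))) (∪-ins v A (del v T))) l))

  -- Homology is granted to vanish only below the dimension of the link. A face of size d above A
  -- supplies a face of the link that is large enough.
  link-dim : ∀ A k → L A ≡ true → extᵇ A ≡ true → ∣ A ∣ ℕ.+ suc k ℕ.≤ d → Σ (Subset n) λ τ → linkᵇ L A τ ≡ true × k ℕ.< ∣ τ ∣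
  link-dim A k l h le = let (G , lG , eG , s) = extᵇ-elim A h in
    diff G A , ∧-intro (diff-disjoint G A) (≡.subst (λ S → L S ≡ true) (≡.sym (diff-∪ G A s)) lG) ,
    ℕ.+-cancelˡ-≤ ∣ A ∣ (suc k) _ (ℕ.≤-trans le (ℕ.≤-reflexive (≡.sym (≡.trans (diff-size G A s) eG))))

  point-link : ∀ C u → lookup C u ≡ false → L (ins u C) ≡ true → linkᵇ L C (ins u ⊥) ≡ true
  point-link C u u∉C l = ∧-intro (disjoint-intro-insʳ u C ⊥ u∉C (disjoint-⊥ C))
    (≡.subst (λ S → L S ≡ true) (≡.sym (≡.trans (∪-ins u C ⊥) (≡.cong (ins u) (∪-identityʳ C)))) l)
    where
    disjoint-⊥ : ∀ {m} (A : Subset m) → disjointᵇ A ⊥ ≡ true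
    disjoint-⊥ []          = ≡.refl
    disjoint-⊥ (true ∷ A)  = disjoint-⊥ A
    disjoint-⊥ (false ∷ A) = disjoint-⊥ A

  ∪-ins-ins : ∀ v u (C : Subset n) → C ∪ ins v (ins u ⊥) ≡ ins v (ins u C)
  ∪-ins-ins v u C = ≡.trans (∪-ins v C (ins u ⊥)) (≡.cong (ins v) (≡.trans (∪-ins u C ⊥) (≡.cong (ins u) (∪-identityʳ C))))

  -- If x could not be added to the extendable face C, then x would not be joined in the
  -- link of C to any vertex that can be added, contradicting the vanishing of H̃₀.

  module Disconnected (C : Subset n) (lC : L C ≡ true) (x : Fin n) (x∉C : lookup C x ≡ false) (lx : L (ins x C) ≡ true)
    (x-bad : extᵇ (ins x C) ≡ false) (y : Fin n) (y∉C : lookup C y ≡ false) (y-good : extᵇ (ins y C) ≡ true)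
    (spread : ∀ u v → lookup C u ≡ false → extᵇ (ins u C) ≡ true → L (ins v (ins u C)) ≡ true → extᵇ (ins v (ins u C)) ≡ true)
    (H : Homology.HomologyVanishes F (linkᵇ L C) 1) where

    Lk = linkᵇ L C

    𝟙 : Chain n
    𝟙 T = if ∣ T ∣ ≡ᵇ 0 then 1# else 0#

    𝟙-⊥ : 𝟙 ⊥ ≈ 1#
    𝟙-⊥ rewrite ∣⊥∣≡0 n = refl

    vertex : Fin n → Chain n
    vertex v = ext v 𝟙

    vertex-⊥ : ∀ v → ι 𝟏 (vertex v) ⊥ ≈ 1#
    vertex-⊥ v = trans (ι-ext 𝟏 v 𝟙 ⊥) (trans (+-cong (trans (*-identityˡ _) 𝟙-⊥) (-‿cong (ext-vanish v ⊥ λ t → ⊥-elim (true≢false t (lookup-replicate v false)))))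
      (solve 0 (:1 :- :0 := :1) refl))

    vertex-≢ : ∀ v u → u ≢ v → vertex v (ins u ⊥) ≈ 0#
    vertex-≢ v u ne = ext-vanish v (ins u ⊥) λ t → ⊥-elim (true≢false t (≡.trans (lookup-ins-≢ ⊥ (ne ∘ ≡.sym)) (lookup-replicate v false)))

    z : Chain n
    z T = 1# * vertex x T + (- 1#) * vertex y T

    vertex-Lk : ∀ v u → lookup C v ≡ false → L (ins v C) ≡ true → Lk (ins u ⊥) ≡ false → vertex v (ins u ⊥) ≈ 0#
    vertex-Lk v u v∉C l f = vertex-≢ v u λ { ≡.refl → true≢false (point-link C v v∉C l) f }

    ly : L (ins y C) ≡ true
    ly = let (G , lG , _ , s) = extᵇ-elim (ins y C) y-good in L-∪ (ins y C) (diff G (ins y C)) (≡.subst (λ S → L S ≡ true) (≡.sym (diff-∪ G (ins y C) s)) lG)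

    z-cycle : ∀ σ → Lk σ ≡ true → suc ∣ σ ∣ ≡ 1 → Homology.∂ F Lk z σ ≈ 0#
    z-cycle σ _ e = ≡.subst (λ σ → Homology.∂ F Lk z σ ≈ 0#) (≡.sym (size-0 σ (ℕ.suc-injective e)))
      (trans (∂-ι Lk z ⊥) (trans (ι-cong-local ⊥ λ v _ → *-congˡ (unmask v))
        (trans (ι-linear 𝟏 1# (- 1#) (vertex x) (vertex y) ⊥) (trans (+-cong (*-congˡ (vertex-⊥ x)) (*-congˡ (vertex-⊥ y))) (solve 0 (:1 :* :1 :+ (:- :1) :* :1 := :0) refl)))))
      where
      unmask : ∀ v → mask Lk z (ins v ⊥) ≈ z (ins v ⊥)
      unmask v with Lk (ins v ⊥) in eq
      ... | true  = refl
      ... | false = sym (trans (+-cong (*-congˡ (vertex-Lk x v x∉C lx eq)) (*-congˡ (vertex-Lk y v y∉C ly eq))) (solve 0 (:1 :* :0 :+ (:- :1) :* :0 := :0) refl))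

    module Filled (b : Chain n) (b-fills : ∀ τ → Lk τ ≡ true → ∣ τ ∣ ≡ 1 → Homology.∂ F Lk b τ ≈ z τ) where

      good : Subset n → Bool
      good T = Lk T ∧ extᵇ (C ∪ T)

      -- Of a chain filling the difference of the vertices x and y only the edges that are
      -- extendable together with C are kept. An extendable vertex keeps all its edges by `spread`,
      -- any other loses them all, and x is of the second kind; the boundary of what remains is
      -- therefore minus the vertex y.
      b′ : Chain n
      b′ T = if good T then b T else 0#

      b′-bad : ∀ T → good T ≡ false → b′ T ≈ 0#
      b′-bad T e rewrite e = refl

      sub-ext : ∀ A v → extᵇ (ins v A) ≡ true → extᵇ A ≡ true
      sub-ext A v h = let (G , l , e , s) = extᵇ-elim (ins v A) h in extᵇ-intro A G l e (subᵇ-ins⁻ v A G s)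

      at-vertex : ∀ u → ι 𝟏 b′ (ins u ⊥) ≈ (- 1#) * vertex y (ins u ⊥)
      at-vertex u = by (decᵇ (lookup C u)) (decᵇ (extᵇ (ins u C)))
        where
        zero-there : (lookup C u ≡ true ⊎ extᵇ (ins u C) ≡ false) → ι 𝟏 b′ (ins u ⊥) ≈ (- 1#) * vertex y (ins u ⊥)
        zero-there why = trans (ι-vanish {g = 𝟏} (ins u ⊥) λ v _ → b′-bad _ (¬true⇒false λ t → contra v (∧-true t)))
          (sym (trans (*-congˡ (vertex-≢ y u λ { ≡.refl → [ (λ u∈C → true≢false u∈C y∉C) , (λ bad → true≢false y-good bad) ]′ why })) (zeroʳ _)))
          where
          contra : ∀ v → Lk (ins v (ins u ⊥)) ≡ true × extᵇ (C ∪ ins v (ins u ⊥)) ≡ true → _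
          contra v (l , e) = [ (λ u∈C → true≢false u∈C (disjoint-lookup u C (ins v (ins u ⊥)) (proj₁ (∧-true l)) (lookup-ins-mono v u (ins u ⊥) (lookup-ins u ⊥))))
                             , (λ bad → true≢false (sub-ext (ins u C) v (≡.subst (λ S → extᵇ S ≡ true) (∪-ins-ins v u C) e)) bad) ]′ why
        by : lookup C u ≡ true ⊎ lookup C u ≡ false → extᵇ (ins u C) ≡ true ⊎ extᵇ (ins u C) ≡ false → ι 𝟏 b′ (ins u ⊥) ≈ (- 1#) * vertex y (ins u ⊥)
        by (inj₁ u∈C) _          = zero-there (inj₁ u∈C)
        by (inj₂ _)   (inj₂ bad) = zero-there (inj₂ bad)
        by (inj₂ u∉C) (inj₁ ok)  = trans (ι-cong-local (ins u ⊥) λ v _ → *-congˡ (agree v))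
            (trans (sym (∂-ι Lk b (ins u ⊥))) (trans (b-fills (ins u ⊥) u-link (≡.trans (size-ins u ⊥ (lookup-replicate u false)) (≡.cong suc (∣⊥∣≡0 n))))
              (trans (+-congʳ (trans (*-congˡ (vertex-≢ x u λ { ≡.refl → true≢false ok x-bad })) (zeroʳ _))) (+-identityˡ _))))
          where
          lu : L (ins u C) ≡ true
          lu = let (G , lG , _ , s) = extᵇ-elim (ins u C) ok in L-∪ (ins u C) (diff G (ins u C)) (≡.subst (λ S → L S ≡ true) (≡.sym (diff-∪ G (ins u C) s)) lG)
          u-link : Lk (ins u ⊥) ≡ true
          u-link = point-link C u u∉C lu
          agree : ∀ v → b′ (ins v (ins u ⊥)) ≈ mask Lk b (ins v (ins u ⊥))
          agree v = [ present , (λ f → trans (b′-bad T (≡.cong (_∧ extᵇ (C ∪ T)) f)) (sym (if-false f))) ]′ (decᵇ (Lk T))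
            where
            T = ins v (ins u ⊥)
            present : Lk T ≡ true → b′ T ≈ mask Lk b T
            present t = trans (if-true (∧-intro t (≡.subst (λ S → extᵇ S ≡ true) (≡.sym (∪-ins-ins v u C))
              (spread u v u∉C ok (≡.subst (λ S → L S ≡ true) (∪-ins-ins v u C) (proj₂ (∧-true t))))))) (sym (if-true t))

      -- A boundary has vanishing coefficient sum, being killed by a second contraction, but minus a
      -- single vertex has sum -1.
      absurd : 0# ≈ 1#
      absurd = trans (sym (solve 1 (λ o → :- :0 := :0) refl 0#)) (trans (-‿cong (trans (sym (ι-square 𝟏 b′ ⊥)) (trans (ι-cong-local ⊥ λ v _ → *-congˡ (at-vertex v)) (ι-scale 𝟏 (- 1#) (vertex y) ⊥))))
        (trans (-‿cong (*-congˡ (vertex-⊥ y))) (solve 0 (:- ((:- :1) :* :1) := :1) refl)))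

    contradiction : 0# ≈ 1#
    contradiction = let (b , e) = H z z-cycle in Filled.absurd b e

  Spread : Subset n → Set
  Spread C = ∀ u v → lookup C u ≡ false → extᵇ (ins u C) ≡ true → L (ins v (ins u C)) ≡ true → extᵇ (ins v (ins u C)) ≡ true

  extend-step : ∀ h C → ∣ C ∣ ℕ.+ suc (suc h) ≡ d → extᵇ C ≡ true → Spread C → ∀ x → lookup C x ≡ false → L (ins x C) ≡ true → extᵇ (ins x C) ≡ true
  extend-step h C e ok spread x x∉C lx = [ id , (λ bad → ⊥-elim (0≉1 (contra bad (extᵇ-elim C ok)))) ]′ (decᵇ (extᵇ (ins x C)))
    where
    lC : L C ≡ true
    lC = L-closed x C lx
    contra : extᵇ (ins x C) ≡ false → (Σ (Subset n) λ G → L G ≡ true × ∣ G ∣ ≡ d × subᵇ C G ≡ true) → 0# ≈ 1#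
    contra bad (G , lG , eG , s) =
      let (y , y∈) = size-pos (diff G C) {suc h} (ℕ.+-cancelˡ-≡ ∣ C ∣ _ _ (≡.trans (diff-size G C s) (≡.trans eG (≡.sym e))))
          (y∈G , y∉C) = diff-lookup G C y y∈
      in Disconnected.contradiction C lC x x∉C lx bad y y∉C (extᵇ-intro (ins y C) G lG eG (subᵇ-ins y C G s y∈G)) spread
           (CM C lC 1 (link-dim C 1 lC ok (ℕ.≤-trans (ℕ.+-monoʳ-≤ ∣ C ∣ (s≤s (s≤s z≤n))) (ℕ.≤-reflexive e))))

  ∈-or-∉ : ∀ C x → extᵇ C ≡ true → (lookup C x ≡ false → extᵇ (ins x C) ≡ true) → extᵇ (ins x C) ≡ true
  ∈-or-∉ C x ok f = [ (λ x∈C → ≡.subst (λ S → extᵇ S ≡ true) (≡.sym (ins-id x C x∈C)) ok) , f ]′ (decᵇ (lookup C x))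

  -- Induction on the codimension h of C: the hypothesis for the faces `ins u C` is the property
  -- `spread` for C. The argument with H̃₀ needs a link with a face of at least two elements, so h =
  -- 0 and h = 1 are settled directly by size.
  extend : ∀ h C → ∣ C ∣ ℕ.+ h ≡ d → extᵇ C ≡ true → ∀ x → L (ins x C) ≡ true → extᵇ (ins x C) ≡ true
  extend zero C e ok x lx = ∈-or-∉ C x ok λ x∉C → ⊥-elim (ℕ.<-irrefl ≡.refl (ℕ.≤-trans (ℕ.≤-reflexive (≡.cong suc (≡.sym (≡.trans (≡.sym (ℕ.+-identityʳ _)) e))))
      (ℕ.≤-trans (ℕ.≤-reflexive (≡.sym (size-ins x C x∉C))) (L-size (ins x C) lx))))
  extend (suc zero) C e ok x lx = ∈-or-∉ C x ok λ x∉C →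
    extᵇ-intro (ins x C) (ins x C) lx (≡.trans (size-ins x C x∉C) (≡.trans (ℕ.+-comm 1 ∣ C ∣) e)) (subᵇ-refl (ins x C))
  extend (suc (suc h)) C e ok x lx = ∈-or-∉ C x ok λ x∉C → extend-step h C e ok
    (λ u v u∉C oku l → extend (suc h) (ins u C) (≡.trans (≡.cong (ℕ._+ suc h) (size-ins u C u∉C)) (≡.trans (≡.sym (ℕ.+-suc ∣ C ∣ (suc h))) e)) oku v l)
    x x∉C lx

  pure : ∀ k C → ∣ C ∣ ≡ k → L C ≡ true → extᵇ C ≡ true
  pure zero    C e l = let (G , lG , eG) = top in extᵇ-intro C G lG eG (subᵇ-intro C G λ v v∈ → ⊥-elim (true≢false v∈ (≡.trans (≡.cong (λ S → lookup S v) (size-0 C e)) (lookup-replicate v false))))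
  pure (suc k) C e l = let (v , v∈C) = size-pos C e
                           C′ = del v C
                           lC = ≡.subst (λ S → L S ≡ true) (≡.sym (ins-del v C v∈C)) l
                           l′ = L-closed v C′ lC
                       in ≡.subst (λ S → extᵇ S ≡ true) (ins-del v C v∈C)
                            (extend (d ℕ.∸ ∣ C′ ∣) C′ (ℕ.m+[n∸m]≡n (L-size C′ l′)) (pure k C′ (ℕ.suc-injective (≡.trans (size-del v C v∈C) e)) l′) v lC)

  module Pol = PolynomialRing F
  module ExtP = Exterior Pol.polyRing
  module V = Vandermonde Pol.polyRing {n} Pol.point Pol.point-regular
  module Ex = V.Exactness L L-closed d

  slice : ℕ → ExtP.Chain n → Chain n
  slice i a T = Pol.coeff (a T) i

  ι-slice : ∀ {m} i (a : ExtP.Chain m) σ → Pol.coeff (ExtP.ι (λ _ → Pol.P.1#) a σ) i ≈ ι 𝟏 (λ T → Pol.coeff (a T) i) σ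
  ι-slice {zero}  i a []          = refl
  ι-slice {suc m} i a (false ∷ σ) = +-cong (trans (Pol.conv-unit (Pol.coeff (a (true ∷ σ))) i) (sym (*-identityˡ _))) (ι-slice i (a ∘ (false ∷_)) σ)
  ι-slice {suc m} i a (true ∷ σ)  = -‿cong (ι-slice i (a ∘ (true ∷_)) σ)

  common-bound : ∀ {m} (a : ExtP.Chain m) → ∃ λ N → ∀ T → Pol.Bounded N (Pol.coeff (a T))
  common-bound {zero}  a = proj₁ (proj₂ (a [])) , λ { [] → proj₂ (proj₂ (a [])) }
  common-bound {suc m} a = let (N , f) = common-bound (a ∘ (false ∷_)) ; (M , g) = common-bound (a ∘ (true ∷_)) in N ℕ.+ M , λ where
    (false ∷ T) i h → f T i (ℕ.≤-trans (ℕ.m≤m+n N M) h)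
    (true ∷ T)  i h → g T i (ℕ.≤-trans (ℕ.m≤n+m M N) h)

  -- The covector x⁰ is constantly 1, so a chain over F[t] killed by it is a cycle over F in every
  -- coefficient. The coefficients are filled separately, and cutting off at a common bound for the
  -- coefficients of a makes the fillings into polynomials.
  module Coefficientwise (A : Subset n) (p : ℕ) (a : ExtP.Chain n) (ia : Ex.InC A p a)
    (cycle : ∀ T i → Pol.coeff (ExtP.ι (λ _ → Pol.P.1#) a T) i ≈ 0#) (H : Homology.HomologyVanishes F (linkᵇ L A) p) where

    Lk = linkᵇ L A

    slice-cycle : ∀ i σ → Lk σ ≡ true → suc ∣ σ ∣ ≡ p → Homology.∂ F Lk (slice i a) σ ≈ 0#
    slice-cycle i σ _ _ = trans (∂-ι Lk (slice i a) σ) (trans (ι-cong-local σ λ v _ → *-congˡ (unmask (ins v σ) (decᵇ (Lk (ins v σ))))) (trans (sym (ι-slice i a σ)) (cycle σ i)))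
      where
      unmask : ∀ T → Lk T ≡ true ⊎ Lk T ≡ false → mask Lk (slice i a) T ≈ slice i a T
      unmask T (inj₁ t) = if-true t
      unmask T (inj₂ f) = trans (if-false f) (sym (ia T (≡.cong (_∧ (∣ T ∣ ≡ᵇ p)) f) i))

    module Filled (b : ℕ → Chain n) (b-fills : ∀ i τ → Lk τ ≡ true → ∣ τ ∣ ≡ p → Homology.∂ F Lk (b i) τ ≈ slice i a τ) where
      N = proj₁ (common-bound a)

      y : ExtP.Chain n
      y T = (λ i → if Ex.lkᵇ A (p ℕ.+ 1) T then (if i <ᵇ N then b i T else 0#) else 0#) , N , bound
        where
        bound : Pol.Bounded N (λ i → if Ex.lkᵇ A (p ℕ.+ 1) T then (if i <ᵇ N then b i T else 0#) else 0#)
        bound i h with Ex.lkᵇ A (p ℕ.+ 1) T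
        ... | false = refl
        ... | true  = if-false (¬true⇒false λ t → ℕ.<-irrefl ≡.refl (ℕ.<-≤-trans (ℕ.<ᵇ⇒< i N (≡.subst Data.Bool.T (≡.sym t) _)) h))

      y-in : Ex.InC A (p ℕ.+ 1) y
      y-in T e i = if-false e

      fills-in : ∀ τ i → Ex.lkᵇ A p τ ≡ true → ι 𝟏 (slice i y) τ ≈ slice i a τ
      fills-in τ i t = by (decᵇ (i <ᵇ N))
        where
        l : Lk τ ≡ true
        l = proj₁ (∧-true t)
        sz : ∣ τ ∣ ≡ p
        sz = ≡ᵇ-true (proj₂ (∧-true {Lk τ} t))
        by : (i <ᵇ N) ≡ true ⊎ (i <ᵇ N) ≡ false → ι 𝟏 (slice i y) τ ≈ slice i a τ
        by (inj₁ lt) = trans (ι-cong-local τ λ v v∉τ → *-congˡ (same v v∉τ (decᵇ (Lk (ins v τ))))) (trans (sym (∂-ι Lk (b i) τ)) (b-fills i τ l sz))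
          where
          same : ∀ v → lookup τ v ≡ false → Lk (ins v τ) ≡ true ⊎ Lk (ins v τ) ≡ false → slice i y (ins v τ) ≈ mask Lk (b i) (ins v τ)
          same v v∉τ (inj₁ t) = trans (if-true (∧-intro t (≡ᵇ-intro (≡.trans (size-ins v τ v∉τ) (≡.trans (≡.cong suc sz) (ℕ.+-comm 1 p)))))) (trans (if-true lt) (sym (if-true t)))
          same v v∉τ (inj₂ f) = trans (if-false (≡.cong (_∧ _) f)) (sym (if-false f))
        by (inj₂ ge) = trans (ι-vanish {g = 𝟏} τ λ v _ → vanish (ins v τ) (decᵇ (Ex.lkᵇ A (p ℕ.+ 1) (ins v τ))))
            (sym (proj₂ (common-bound a) τ i (ℕ.≮⇒≥ λ lt → true≢false (≤ᵇ-intro lt) ge)))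
          where
          vanish : ∀ T → Ex.lkᵇ A (p ℕ.+ 1) T ≡ true ⊎ Ex.lkᵇ A (p ℕ.+ 1) T ≡ false → slice i y T ≈ 0#
          vanish T (inj₁ t) = trans (if-true t) (if-false ge)
          vanish T (inj₂ f) = if-false f

      y-fills : ∀ τ i → Pol.coeff (ExtP.It V.pw 1 y τ) i ≈ Pol.coeff (Pol.P._*_ Pol.P.1# (a τ)) i
      y-fills τ i = [ (λ t → trans (ι-slice i y τ) (trans (fills-in τ i t) (sym (Pol.conv-unit (Pol.coeff (a τ)) i))))
                    , (λ f → trans (Ex.InC-ι {A} {p} {V.pw 0} (≡.subst (λ q → Ex.InC A q y) (ℕ.+-comm p 1) y-in) τ f i)
                                   (sym (trans (Pol.conv-unit (Pol.coeff (a τ)) i) (ia τ f i)))) ]′ (decᵇ (Ex.lkᵇ A p τ))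

  exact-0 : Ex.Exact 0
  exact-0 A p a ia le kill = by (decᵇ (L A))
    where
    Goal = Σ (ExtP.Chain n) λ y → Ex.InC A (p ℕ.+ 1) y × ExtP._≐_ (ExtP.It V.pw 1 y) (λ T → Pol.P._*_ Pol.P.1# (a T))
    by : L A ≡ true ⊎ L A ≡ false → Goal
    by (inj₁ l) = let H = CM A l p (link-dim A p l (pure _ A ≡.refl l) (≡.subst (λ q → ∣ A ∣ ℕ.+ q ℕ.≤ d) (ℕ.+-comm p 1) le)) in finish H
      where
      finish : Homology.HomologyVanishes F (linkᵇ L A) p → Goal
      finish H = W.y , W.y-in , W.y-fills
        where
        module Co = Coefficientwise A p a ia (kill 0 z≤n) H
        module W = Co.Filled (λ i → proj₁ (H (slice i a) (Co.slice-cycle i))) (λ i → proj₂ (H (slice i a) (Co.slice-cycle i)))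
    -- `Exact` also speaks about nonfaces A. Their links are empty, so a is zero.
    by (inj₂ f) = (λ _ → Pol.P.0#) , (λ _ _ _ → refl) , λ T i → trans (ExtP.ι-zero (V.pw 0) {λ _ → Pol.P.0#} (λ _ _ → refl) T i)
      (sym (trans (Pol.conv-unit (Pol.coeff (a T)) i) (ia T (¬true⇒false λ t → true≢false (L-∪ A T (proj₁ (proj₂ (Ex.lk-elim {A} {p} {T} t)))) f) i)))

  exact : ∀ m → Ex.Exact m
  exact = Ex.exact exact-0

-- The complex of initial monomials

¬¬-upto : ∀ {a} N {P : ℕ → Set a} → (∀ p → ¬ ¬ P p) → ¬ ¬ (∀ p → p ℕ.≤ N → P p)
¬¬-upto zero    h = h 0 >>= λ z → return λ { zero _ → z }
¬¬-upto (suc N) {P} h = h (suc N) >>= λ s → ¬¬-upto N {P} h >>= λ f → return λ p le →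
  [ (λ lt → f p (ℕ.≤-pred lt)) , (λ e → ≡.subst P (≡.sym e) s) ]′ (ℕ.m≤n⇒m<n∨m≡n le)

meets⇒smaller : ∀ {n} (T U : Subset n) → disjointᵇ T U ≡ false → ∣ T ∪ U ∣ ℕ.< ∣ T ∣ ℕ.+ ∣ U ∣
meets⇒smaller []          []          ()
meets⇒smaller (true ∷ T)  (true ∷ U)  d = s≤s (ℕ.≤-trans (s≤s (size-∪-≤ T U)) (ℕ.≤-reflexive (≡.sym (ℕ.+-suc ∣ T ∣ ∣ U ∣))))
meets⇒smaller (true ∷ T)  (false ∷ U) d = s≤s (meets⇒smaller T U d)
meets⇒smaller (false ∷ T) (true ∷ U)  d = ≡.subst (suc (suc ∣ T ∪ U ∣) ℕ.≤_) (≡.sym (ℕ.+-suc ∣ T ∣ ∣ U ∣)) (s≤s (meets⇒smaller T U d))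
meets⇒smaller (false ∷ T) (false ∷ U) d = meets⇒smaller T U d

disjoint-⊥ˡ : ∀ {n} (T : Subset n) → disjointᵇ ⊥ T ≡ true
disjoint-⊥ˡ []      = ≡.refl
disjoint-⊥ˡ (_ ∷ T) = disjoint-⊥ˡ T

faces : ∀ {n} → (Subset n → Bool) → ℕ → Subset n → Bool
faces L p S = L S ∧ (∣ S ∣ ≡ᵇ p)

module AlgebraicShift {c ℓ} (R : CommutativeRing c ℓ)
  (1≉0 : ¬ CommutativeRing._≈_ R (CommutativeRing.1# R) (CommutativeRing.0# R))
  (dichotomy : ∀ x → ¬ ¬ (CommutativeRing._≈_ R x (CommutativeRing.0# R) ⊎ Initial.Regular R x))
  {n : ℕ} (x : Fin n → CommutativeRing.Carrier R)
  (x-regular : ∀ v w → v ≢ w → Initial.Regular R (CommutativeRing._-_ R (x v) (x w)))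
  (L : Subset n → Bool) (L-closed : ∀ v T → L (ins v T) ≡ true → L T ≡ true) (d : ℕ)
  (exact : ∀ m → Vandermonde.Exactness.Exact R x x-regular L L-closed d m) where
  open CommutativeRing R hiding (zero)
  open import Algebra.Properties.Ring ring using (-0#≈0#)
  open Exterior R
  open Initial R
  open Elimination R 1≉0 dichotomy
  open Vandermonde R x x-regular
  open Exactness L L-closed d hiding (exact)

  -- The coordinate covectors behind the powers make `φ` injective, so no chain is lost and face
  -- numbers are preserved; the powers in front become the cone labels.
  labels : ∀ j k → Vec (Covector n) (k ℕ.+ n)
  labels j zero    = coords n
  labels j (suc k) = pw j ∷ labels (suc j) k

  labels-injective : ∀ j k a → (∀ T → φ (labels j k) a T ≈ 0#) → ∀ S → a S ≈ 0#
  labels-injective j zero    a h S = trans (sym (φ-coords a S)) (h S)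
  labels-injective j (suc k) a h   = labels-injective (suc j) k a (h ∘ (false ∷_))

  lk-⊥ : ∀ p T → lkᵇ ⊥ p T ≡ faces L p T
  lk-⊥ p T = ≡.cong₂ (λ b S → (b ∧ L S) ∧ (∣ T ∣ ≡ᵇ p)) (disjoint-⊥ˡ T) (∪-identityˡ T)

  supp⇒InC : ∀ {p a} → Supp (faces L p) a → InC ⊥ p a
  supp⇒InC {p} h T e = h T (≡.trans (≡.sym (lk-⊥ p T)) e)

  InC⇒supp : ∀ {p a} → InC ⊥ p a → Supp (faces L p) a
  InC⇒supp {p} h T e = h T (≡.trans (lk-⊥ p T) e)

  lead-size : ∀ {M} (fs : Vec (Covector n) M) {p a T} → (∀ S → ∣ S ∣ ≢ p → a S ≈ 0#) → Lead T (φ fs a) → ∣ T ∣ ≡ p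
  lead-size fs {p} {a} {T} h (_ , r) with ∣ T ∣ ℕ.≟ p
  ... | yes e = e
  ... | no ne = ⊥-elim (Regular⇒≉0 r (φ-homogeneous fs p a h T ne))

  φ-signed : ∀ {M} (fs : Vec (Covector n) M) j a → φ fs (signed j a) ≐ signed j (φ fs a)
  φ-signed fs zero    a T = refl
  φ-signed fs (suc j) a T = trans (φ-neg fs (signed j a) T) (-‿cong (φ-signed fs j a T))

  Lead-signed : ∀ {M} j (T : Subset M) {y} → Lead T y → Lead T (signed j y)
  Lead-signed zero    T l = l
  Lead-signed (suc j) T l = let (i , r) = Lead-signed j T l in Init-map T (λ S e → trans (-‿cong e) -0#≈0#) i , Regular-neg r

  module Shifted (K : ℕ) (K≤d : K ℕ.≤ d) where

    -- The invariant for iterated links: Y is the link of the first j labels, and since a set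
    -- starting with these labels is read off after contraction with x⁰, ..., xʲ⁻¹, its faces are
    -- the initial sets of such contractions. All sizes, the j labels included, stay below K.
    record Rep (j k : ℕ) (Y : Subset (k ℕ.+ n) → Bool) : Set (c ⊔ ℓ) where
      field
        sound    : ∀ S → Y S ≡ true → j ℕ.+ ∣ S ∣ ℕ.≤ K × Σ (Chain n) λ a → InC ⊥ (j ℕ.+ ∣ S ∣) a × Lead S (φ (labels j k) (It pw j a))
        complete : ∀ S a → j ℕ.+ ∣ S ∣ ℕ.≤ K → InC ⊥ (j ℕ.+ ∣ S ∣) a → Lead S (φ (labels j k) (It pw j a)) → Y S ≡ true
    open Rep

    Rep-link : ∀ j k Y → Rep j (suc k) Y → Rep (suc j) k (Y ∘ (true ∷_))
    sound (Rep-link j k Y ρ) S y = let (le , a , i , l) = sound ρ (true ∷ S) y in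
      ≡.subst (ℕ._≤ K) (ℕ.+-suc j ∣ S ∣) le , a , ≡.subst (λ q → InC ⊥ q a) (ℕ.+-suc j ∣ S ∣) i , l
    complete (Rep-link j k Y ρ) S a le i l = complete ρ (true ∷ S) a
      (≡.subst (ℕ._≤ K) (≡.sym (ℕ.+-suc j ∣ S ∣)) le) (≡.subst (λ q → InC ⊥ q a) (≡.sym (ℕ.+-suc j ∣ S ∣)) i) l

    -- Contracting a representing chain with the covector of v removes v from its initial set;
    -- moving this contraction past the j earlier ones costs only a sign.
    Rep-closed : ∀ j k Y → Rep j k Y → Closed Y
    Rep-closed j k Y ρ v T y = by (decᵇ (lookup T v))
      where
      f = lookup (labels j k) v
      by : lookup T v ≡ true ⊎ lookup T v ≡ false → Y T ≡ true
      by (inj₁ v∈T) = ≡.subst (λ S → Y S ≡ true) (ins-id v T v∈T) y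
      by (inj₂ v∉T) = remove (sound ρ (ins v T) y)
        where
        size : j ℕ.+ ∣ ins v T ∣ ≡ suc (j ℕ.+ ∣ T ∣)
        size = ≡.trans (≡.cong (j ℕ.+_) (size-ins v T v∉T)) (ℕ.+-suc j ∣ T ∣)
        remove : (j ℕ.+ ∣ ins v T ∣ ℕ.≤ K × Σ (Chain n) λ a → InC ⊥ (j ℕ.+ ∣ ins v T ∣) a × Lead (ins v T) (φ (labels j k) (It pw j a))) → Y T ≡ true
        remove (le , a , i , l) = complete ρ T (ι f a) (ℕ.≤-trans (ℕ.n≤1+n _) (≡.subst (ℕ._≤ K) size le))
          (InC-ι {⊥} {j ℕ.+ ∣ T ∣} {f} (≡.subst (λ q → InC ⊥ q a) size i))
          (Lead-cong T same (Lead-signed j T (≡.subst (λ S → Lead S (ι (coord v) (φ (labels j k) (It pw j a)))) (del-ins v T v∉T)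
            (Lead-contract (ins v T) v (lookup-ins v T) l))))
          where
          same : signed j (ι (coord v) (φ (labels j k) (It pw j a))) ≐ φ (labels j k) (It pw j (ι f a))
          same S = trans (signed-cong j (λ U → sym (φ-ι (labels j k) v (It pw j a) U)) S)
            (trans (sym (φ-signed (labels j k) j (ι f (It pw j a)) S))
              (φ-cong (labels j k) (λ U → trans (signed-cong j (ι-It f pw j a) U) (signed-twice j (It pw j (ι f a)) U)) S))

    -- If `false ∷ T` is initial, all coordinates of the contraction with xʲ vanish, and by
    -- injectivity so does this contraction. The chain is thus killed by x⁰, ..., xʲ, and exactness
    -- makes a regular multiple of it a contraction with these covectors; the chain contracted there
    -- has initial set `true ∷ T`.
    Rep-cone : ∀ j k Y → j ℕ.+ suc k ≡ K → Rep j (suc k) Y → ∀ T → ∣ T ∣ ℕ.≤ k → Y (false ∷ T) ≡ true → Y (true ∷ T) ≡ true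
    Rep-cone j k Y e ρ T le y = add (sound ρ (false ∷ T) y)
      where
      p = ∣ T ∣
      bound : p ℕ.+ suc j ℕ.≤ K
      bound = ℕ.≤-trans (ℕ.+-monoˡ-≤ (suc j) le) (ℕ.≤-reflexive (≡.trans (ℕ.+-comm k (suc j)) (≡.trans (≡.sym (ℕ.+-suc j k)) e)))
      size : j ℕ.+ suc p ≡ p ℕ.+ suc j
      size = ≡.trans (ℕ.+-suc j p) (≡.trans (≡.cong suc (ℕ.+-comm j p)) (≡.sym (ℕ.+-suc p j)))
      add : (j ℕ.+ p ℕ.≤ K × Σ (Chain n) λ a → InC ⊥ (j ℕ.+ p) a × Lead (false ∷ T) (φ (labels j (suc k)) (It pw j a))) → Y (true ∷ T) ≡ true
      add (_ , a , i , (z , ini) , r) = finish (exact j ⊥ p (It pw j a) (InC-It {⊥} {p} pw j (≡.subst (λ q → InC ⊥ q a) (ℕ.+-comm j p) i))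
          (≡.subst (λ q → q ℕ.+ (p ℕ.+ suc j) ℕ.≤ d) (≡.sym (∣⊥∣≡0 n)) (ℕ.≤-trans bound K≤d)) killed)
        where
        killed : ∀ m → m ℕ.≤ j → ∀ S → ι (pw m) (It pw j a) S ≈ 0#
        killed m m≤j = [ (λ lt → It-kill pw j a m lt) , (λ { ≡.refl → labels-injective (suc j) k _ z }) ]′ (ℕ.m≤n⇒m<n∨m≡n m≤j)
        finish : (Σ (Chain n) λ b → InC ⊥ (p ℕ.+ suc j) b × It pw (suc j) b ≐ λ S → δ j * It pw j a S) → Y (true ∷ T) ≡ true
        finish (b , ib , eb) = complete ρ (true ∷ T) b (≡.subst (ℕ._≤ K) (≡.sym size) bound) (≡.subst (λ q → InC ⊥ q b) (≡.sym size) ib)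
          (Lead-cong T (λ S → sym (trans (φ-cong fs eb S) (scale S))) (Lead-scale T (δ j) (δ-regular j) (ini , r)))
          where
          fs = labels (suc j) k
          scale : ∀ S → φ fs (λ U → δ j * It pw j a U) S ≈ δ j * φ fs (It pw j a) S
          scale S = trans (φ-cong fs (λ U → trans (sym (+-identityʳ _)) (+-congˡ (sym (zeroˡ (It pw j a U))))) S)
            (trans (φ-linear fs (δ j) 0# (It pw j a) (It pw j a) S) (trans (+-congˡ (zeroˡ _)) (+-identityʳ _)))

    Rep-coned : ∀ k j Y → j ℕ.+ k ≡ K → Rep j k Y → Coned k Y
    Rep-coned zero    j Y e ρ = _
    Rep-coned (suc k) j Y e ρ = Rep-closed j (suc k) Y ρ , Rep-cone j k Y e ρ ,
      Rep-coned k (suc j) (Y ∘ (true ∷_)) (≡.trans (≡.sym (ℕ.+-suc j k)) e) (Rep-link j k Y ρ)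

    module Assemble (I : ∀ p → p ℕ.≤ K → InitialFamily (labels 0 K) (faces L p)) where
      open InitialFamily

      Y : Subset (K ℕ.+ n) → Bool
      Y T with ∣ T ∣ ℕ.≤? K
      ... | yes le = family (I ∣ T ∣ le) T
      ... | no  _  = false

      Y-sound : ∀ T → Y T ≡ true → Σ (∣ T ∣ ℕ.≤ K) λ le → family (I ∣ T ∣ le) T ≡ true
      Y-sound T y with ∣ T ∣ ℕ.≤? K
      ... | yes le = le , y

      Y-complete : ∀ T a → ∣ T ∣ ℕ.≤ K → Supp (faces L ∣ T ∣) a → Lead T (φ (labels 0 K) a) → Y T ≡ true
      Y-complete T a le s l with ∣ T ∣ ℕ.≤? K
      ... | yes le′ = complete (I ∣ T ∣ le′) T a s l
      ... | no  nle = ⊥-elim (nle le)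

      rep : Rep 0 K Y
      sound rep S y = let (le , f) = Y-sound S y ; (a , s , l) = InitialFamily.sound (I ∣ S ∣ le) S f in
        le , a , supp⇒InC s , l
      complete rep S a le i l = Y-complete S a le (InC⇒supp i) l

      coned : Coned K Y
      coned = Rep-coned K 0 Y ≡.refl rep

      faces-homogeneous : ∀ {p a} → Supp (faces L p) a → ∀ S → ∣ S ∣ ≢ p → a S ≈ 0#
      faces-homogeneous {p} h S ne = h S (¬true⇒false λ t → ne (≡ᵇ-true (proj₂ (∧-true {L S} t))))

      Y-count : ∀ p → p ℕ.≤ K → fc p Y ≡ cnt (faces L p)
      Y-count p le = ≡.trans (cnt-cong λ T → bool-ext (to T) (from T)) (count (I p le))
        where
        to : ∀ T → Y T ∧ (∣ T ∣ ≡ᵇ p) ≡ true → family (I p le) T ≡ true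
        to T h = let (y , e) = ∧-true h ; (le′ , f) = Y-sound T y ; (a , s , l) = InitialFamily.sound (I ∣ T ∣ le′) T f in
          complete (I p le) T a (≡.subst (λ q → Supp (faces L q) a) (≡ᵇ-true e) s) l
        from : ∀ T → family (I p le) T ≡ true → Y T ∧ (∣ T ∣ ≡ᵇ p) ≡ true
        from T f = let (a , s , l) = InitialFamily.sound (I p le) T f
                       e = lead-size (labels 0 K) {p} {a} {T} (faces-homogeneous s) l in
          ∧-intro (Y-complete T a (≡.subst (ℕ._≤ K) (≡.sym e) le) (≡.subst (λ q → Supp (faces L q) a) (≡.sym e) s) l) (≡ᵇ-intro e)

      member : ∀ {r A} → r ℕ.≤ K → (∀ S → A S ≡ true → faces L r S ≡ true) → (IA : InitialFamily (labels 0 K) A) →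
        ∀ T → family IA T ≡ true → Y T ≡ true × ∣ T ∣ ≡ r
      member {r} {A} le h IA T f = let (y , e) = ∧-true (from f) in y , ≡ᵇ-true e
        where
        from : family IA T ≡ true → Y T ∧ (∣ T ∣ ≡ᵇ r) ≡ true
        from f = let (a , s , l) = InitialFamily.sound IA T f
                     s′ = λ S e → s S (¬true⇒false λ t → true≢false (h S t) e)
                     e = lead-size (labels 0 K) {r} {a} {T} (faces-homogeneous s′) l in
          ∧-intro (Y-complete T a (≡.subst (ℕ._≤ K) (≡.sym e) le) (≡.subst (λ q → Supp (faces L q) a) (≡.sym e) s′) l) (≡ᵇ-intro e)

      cross : ∀ {A B} → (∀ S U → A S ≡ true → B U ≡ true → disjointᵇ S U ≡ false) →
        (IA : InitialFamily (labels 0 K) A) (IB : InitialFamily (labels 0 K) B) →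
        ∀ T U → family IA T ≡ true → family IB U ≡ true → disjointᵇ T U ≡ false
      cross {A} {B} h IA IB T U fT fU = ¬true⇒false λ dis →
        let (a , sa , (ia , ra)) = InitialFamily.sound IA T fT
            (b , sb , (ib , rb)) = InitialFamily.sound IB U fU
            zeroes : ∀ S V → disjointᵇ S V ≡ true → a S * b V ≈ 0#
            zeroes S V dSV = [ (λ tA → trans (*-congˡ (sb V (¬true⇒false λ tB → true≢false dSV (h S V tA tB)))) (zeroʳ _))
                             , (λ fA → trans (*-congʳ (sa S fA)) (zeroˡ _)) ]′ (decᵇ (A S))
            a⋀b = λ W → trans (sym (φ-⋀ (labels 0 K) a b W)) (φ-zero (labels 0 K) (⋀-zero zeroes) W)
        in Regular⇒≉0 rb (ra _ (Init-⋀ T U ia ib dis (a⋀b (T ∪ U))))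

    ShiftedBound : ℕ → (A B : Subset n → Bool) → Set
    ShiftedBound r A B = Σ (Subset (K ℕ.+ n) → Bool) λ Y → Coned K Y × (∀ p → p ℕ.≤ K → fc p Y ≡ cnt (faces L p)) ×
      cnt A ℕ.+ cnt B ℕ.+ gam r K r Y ℕ.≤ fc r Y ℕ.+ 1

    shiftedBound : ∀ r → r ℕ.+ r ≡ K → (A B : Subset n → Bool) →
      (∀ S → A S ≡ true → faces L r S ≡ true) → (∀ S → B S ≡ true → faces L r S ≡ true) →
      (∀ S U → A S ≡ true → B U ≡ true → disjointᵇ S U ≡ false) →
      1 ℕ.≤ cnt A → 1 ℕ.≤ cnt B → ¬ ¬ ShiftedBound r A B
    shiftedBound r e A B hA hB h 1A 1B =
      ¬¬-upto K (λ p → initialFamily (labels 0 K) (labels-injective 0 K) (faces L p)) >>= λ I →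
      initialFamily (labels 0 K) (labels-injective 0 K) A >>= λ IA →
      initialFamily (labels 0 K) (labels-injective 0 K) B >>= λ IB → return (build I IA IB)
      where
      r≤K : r ℕ.≤ K
      r≤K = ℕ.≤-trans (ℕ.m≤m+n r r) (ℕ.≤-reflexive e)
      build : (∀ p → p ℕ.≤ K → InitialFamily (labels 0 K) (faces L p)) → InitialFamily (labels 0 K) A → InitialFamily (labels 0 K) B → ShiftedBound r A B
      build I IA IB = Y , coned , Y-count , ≡.subst₂ (λ p q → p ℕ.+ q ℕ.+ gam r K r Y ℕ.≤ fc r Y ℕ.+ 1) (count IA) (count IB)
        (cross-bound-≡ K Y coned true r e (family IA) (family IB) (member r≤K hA IA) (member r≤K hB IB)
          (λ T U a b → ℕ.<-≤-trans (meets⇒smaller T U (cross h IA IB T U a b))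
            (ℕ.≤-reflexive (≡.trans (≡.cong₂ ℕ._+_ (proj₂ (member r≤K hA IA T a)) (proj₂ (member r≤K hB IB U b))) e)))
          (λ _ → cnt≥1⇒∃ (family IA) (≡.subst (1 ℕ.≤_) (≡.sym (count IA)) 1A) , cnt≥1⇒∃ (family IB) (≡.subst (1 ℕ.≤_) (≡.sym (count IB)) 1B)))
        where
        open Assemble I
        open InitialFamily

open import Function.Definitions using (Injective)
import Data.Bool.ListAction as Bool
open import Data.Nat using (_+_; _*_; _∸_; _≤_; _<_; _≤ᵇ_; _≤?_)
open import Data.Nat.Properties
open import Data.Fin.Subset using (_⊆_; _-_; _─_)
open import Data.Fin.Subset.Properties using (x∈p∩q⁻)
open import Data.Vec.Properties using (lookup⇒[]=; []=⇒lookup)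
open import Data.List using (length)
open import Data.List.Membership.Propositional using (_∈_)
open import Data.List.Relation.Unary.Any using (here; there)
open import Data.List.Relation.Unary.All as All using (All)
open import Data.List.Relation.Unary.AllPairs using (AllPairs)
open import Data.List.Relation.Unary.Unique.Propositional using (Unique)
import Data.List.Relation.Unary.Unique.Propositional.Properties as Unique
open import Relation.Nullary.Decidable using (decidable-stable)
open ≡ using (refl; sym; trans; cong; cong₂; subst)

-- Double counting, lists as families, the recursion for γ

wsum : ∀ {n} → (Subset n → ℕ) → ℕ
wsum {zero}  f = f []
wsum {suc n} f = wsum (f ∘ (false ∷_)) + wsum (f ∘ (true ∷_))

sumFin : ∀ {m} → (Fin m → ℕ) → ℕ
sumFin {zero}  f = 0
sumFin {suc m} f = f zero + sumFin (f ∘ suc)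

cnt-wsum : ∀ {n} (P : Subset n → Bool) → cnt P ≡ wsum (toℕᵇ ∘ P)
cnt-wsum {zero}  P = refl
cnt-wsum {suc n} P = cong₂ _+_ (cnt-wsum (P ∘ (false ∷_))) (cnt-wsum (P ∘ (true ∷_)))

wsum-mono : ∀ {n} {f g : Subset n → ℕ} → (∀ T → f T ≤ g T) → wsum f ≤ wsum g
wsum-mono {zero}  h = h []
wsum-mono {suc n} h = +-mono-≤ (wsum-mono (h ∘ (false ∷_))) (wsum-mono (h ∘ (true ∷_)))

wsum-+ : ∀ {n} (f g : Subset n → ℕ) → wsum (λ T → f T + g T) ≡ wsum f + wsum g
wsum-+ {zero}  f g = refl
wsum-+ {suc n} f g = trans (cong₂ _+_ (wsum-+ (f ∘ (false ∷_)) (g ∘ (false ∷_))) (wsum-+ (f ∘ (true ∷_)) (g ∘ (true ∷_))))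
  (+-interchange (wsum (f ∘ (false ∷_))) _ _ _)

wsum-0 : ∀ n → wsum {n} (λ _ → 0) ≡ 0
wsum-0 zero    = refl
wsum-0 (suc n) = cong₂ _+_ (wsum-0 n) (wsum-0 n)

wsum-* : ∀ {n} k (f : Subset n → ℕ) → wsum (λ T → k * f T) ≡ k * wsum f
wsum-* {zero}  k f = refl
wsum-* {suc n} k f = trans (cong₂ _+_ (wsum-* k (f ∘ (false ∷_))) (wsum-* k (f ∘ (true ∷_)))) (sym (*-distribˡ-+ k _ _))

sumFin-mono : ∀ {m} {f g : Fin m → ℕ} → (∀ w → f w ≤ g w) → sumFin f ≤ sumFin g
sumFin-mono {zero}  h = z≤n
sumFin-mono {suc m} h = +-mono-≤ (h zero) (sumFin-mono (h ∘ suc))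

sumFin-cong : ∀ {m} {f g : Fin m → ℕ} → (∀ w → f w ≡ g w) → sumFin f ≡ sumFin g
sumFin-cong {zero}  h = refl
sumFin-cong {suc m} h = cong₂ _+_ (h zero) (sumFin-cong (h ∘ suc))

fubini : ∀ {n m} (g : Fin m → Subset n → ℕ) → sumFin (λ w → wsum (g w)) ≡ wsum (λ T → sumFin λ w → g w T)
fubini {n} {zero}  g = sym (wsum-0 n)
fubini {n} {suc m} g = trans (cong (wsum (g zero) +_) (fubini (g ∘ suc))) (sym (wsum-+ (g zero) _))

sumFin-size : ∀ {n} (T : Subset n) → sumFin (λ w → toℕᵇ (lookup T w)) ≡ ∣ T ∣
sumFin-size []          = refl
sumFin-size (true ∷ T)  = cong suc (sumFin-size T)
sumFin-size (false ∷ T) = sumFin-size T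

toℕᵇ-mono : ∀ {a b} → (a ≡ true → b ≡ true) → toℕᵇ a ≤ toℕᵇ b
toℕᵇ-mono {false} h = z≤n
toℕᵇ-mono {true}  h rewrite h refl = ≤-refl

-- Counted are the pairs of a member T of P and a new w with `ins w T` in Q: at least k + 1 for each
-- T, and at most k + 1 for each U in Q, since the pair is recovered from U and w in U.
double-count : ∀ {n} k (P Q : Subset n → Bool) →
  (∀ T → P T ≡ true → suc k ≤ sumFin (λ w → toℕᵇ (not (lookup T w) ∧ Q (ins w T)))) →
  (∀ U → Q U ≡ true → ∣ U ∣ ≡ suc k) → cnt P ≤ cnt Q
double-count {n} k P Q up size = *-cancelˡ-≤ (suc k) (begin
  suc k * cnt P                                                             ≡⟨ cong (suc k *_) (cnt-wsum P) ⟩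
  suc k * wsum (toℕᵇ ∘ P)                                                   ≡⟨ wsum-* (suc k) (toℕᵇ ∘ P) ⟨
  wsum (λ T → suc k * toℕᵇ (P T))                                           ≤⟨ wsum-mono (λ T → lower T (decᵇ (P T))) ⟩
  wsum (λ T → sumFin λ w → toℕᵇ (not (lookup T w) ∧ Q (ins w T)))           ≡⟨ fubini (λ w T → toℕᵇ (not (lookup T w) ∧ Q (ins w T))) ⟨
  sumFin (λ w → wsum λ T → toℕᵇ (not (lookup T w) ∧ Q (ins w T)))           ≡⟨ sumFin-cong (λ w → trans (sym (cnt-wsum (λ T → not (lookup T w) ∧ Q (ins w T)))) (trans (sym (cnt-toggle w Q)) (cnt-wsum (λ T → lookup T w ∧ Q T)))) ⟩
  sumFin (λ w → wsum λ U → toℕᵇ (lookup U w ∧ Q U))                         ≡⟨ fubini (λ w U → toℕᵇ (lookup U w ∧ Q U)) ⟩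
  wsum (λ U → sumFin λ w → toℕᵇ (lookup U w ∧ Q U))                         ≤⟨ wsum-mono (λ U → upper U (decᵇ (Q U))) ⟩
  wsum (λ U → suc k * toℕᵇ (Q U))                                           ≡⟨ wsum-* (suc k) (toℕᵇ ∘ Q) ⟩
  suc k * wsum (toℕᵇ ∘ Q)                                                   ≡⟨ cong (suc k *_) (cnt-wsum Q) ⟨
  suc k * cnt Q                                                             ∎)
  where
  open ≤-Reasoning
  sumFin-none : ∀ {m} {f : Fin m → ℕ} → (∀ w → f w ≡ 0) → sumFin f ≡ 0
  sumFin-none {zero}  h = refl
  sumFin-none {suc m} h = cong₂ _+_ (h zero) (sumFin-none (h ∘ suc))
  lower : ∀ T → P T ≡ true ⊎ P T ≡ false → suc k * toℕᵇ (P T) ≤ sumFin (λ w → toℕᵇ (not (lookup T w) ∧ Q (ins w T)))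
  lower T (inj₁ t) = subst (λ b → suc k * toℕᵇ b ≤ _) (sym t) (≤-trans (≤-reflexive (*-identityʳ (suc k))) (up T t))
  lower T (inj₂ f) = subst (λ b → suc k * toℕᵇ b ≤ _) (sym f) (≤-trans (≤-reflexive (*-zeroʳ (suc k))) z≤n)
  upper : ∀ U → Q U ≡ true ⊎ Q U ≡ false → sumFin (λ w → toℕᵇ (lookup U w ∧ Q U)) ≤ suc k * toℕᵇ (Q U)
  upper U (inj₁ t) = ≤-trans (≤-trans (sumFin-mono {f = λ w → toℕᵇ (lookup U w ∧ Q U)} {g = λ w → toℕᵇ (lookup U w)} λ w → toℕᵇ-mono λ h → proj₁ (∧-true h)) (≤-reflexive (trans (sumFin-size U) (size U t))))
    (≤-reflexive (sym (trans (cong (λ b → suc k * toℕᵇ b) t) (*-identityʳ (suc k)))))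
  upper U (inj₂ f) = ≤-trans (≤-reflexive (sumFin-none λ w → trans (cong (λ b → toℕᵇ (lookup U w ∧ b)) f) (cong toℕᵇ (∧-zeroʳ (lookup U w))))) z≤n

eqᵇ : ∀ {n} → Subset n → Subset n → Bool
eqᵇ S T = subᵇ S T ∧ subᵇ T S

eqᵇ-refl : ∀ {n} (S : Subset n) → eqᵇ S S ≡ true
eqᵇ-refl S = ∧-intro (subᵇ-refl S) (subᵇ-refl S)

eqᵇ-true : ∀ {n} (S T : Subset n) → eqᵇ S T ≡ true → S ≡ T
eqᵇ-true []          []          _ = refl
eqᵇ-true (true ∷ S)  (true ∷ T)  h = cong (true ∷_) (eqᵇ-true S T h)
eqᵇ-true (false ∷ S) (false ∷ T) h = cong (false ∷_) (eqᵇ-true S T h)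
eqᵇ-true (true ∷ S)  (false ∷ T) ()
eqᵇ-true (false ∷ S) (true ∷ T)  h = ⊥-elim (true≢false (proj₂ (∧-true {subᵇ S T} h)) refl)

anyᵇ : ∀ {A : Set} → (A → Bool) → List A → Bool
anyᵇ = Bool.any

anyᵇ-true : ∀ {A : Set} (f : A → Bool) xs → anyᵇ f xs ≡ true → ∃ λ x → x ∈ xs × f x ≡ true
anyᵇ-true f (x List.∷ xs) h with ∨-true h
... | inj₁ e = x , here refl , e
... | inj₂ e = let (y , y∈ , fy) = anyᵇ-true f xs e in y , there y∈ , fy

anyᵇ-intro : ∀ {A : Set} (f : A → Bool) {xs x} → x ∈ xs → f x ≡ true → anyᵇ f xs ≡ true
anyᵇ-intro f {x List.∷ xs} (here refl) e rewrite e = refl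
anyᵇ-intro f {y List.∷ xs} (there x∈)  e = ∨-introʳ (f y) (anyᵇ-intro f x∈ e)

mem : ∀ {n} → List (Subset n) → Subset n → Bool
mem 𝒜 S = anyᵇ (λ T → eqᵇ T S) 𝒜

mem-true : ∀ {n} (𝒜 : List (Subset n)) S → mem 𝒜 S ≡ true → S ∈ 𝒜
mem-true 𝒜 S h = let (T , T∈ , e) = anyᵇ-true _ 𝒜 h in subst (_∈ 𝒜) (eqᵇ-true T S e) T∈

length-≤-cnt : ∀ {n} (𝒜 : List (Subset n)) → Unique 𝒜 → length 𝒜 ≤ cnt (mem 𝒜)
length-≤-cnt List.[] _ = z≤n
length-≤-cnt (S List.∷ 𝒜) (S∉ AllPairs.∷ u) = ≤-trans (+-mono-≤ (cnt-pos S (eqᵇ-refl S)) (length-≤-cnt 𝒜 u))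
  (cnt-disjoint (λ T e → subst (λ b → b ∨ mem 𝒜 T ≡ true) (sym e) refl) (λ T e → ∨-introʳ (eqᵇ S T) e)
    (λ T e → ¬true⇒false λ m → All.lookup S∉ (subst (_∈ 𝒜) (sym (eqᵇ-true S T e)) (mem-true 𝒜 T m)) refl))

sub⇒⊆ : ∀ {n} {A B : Subset n} → subᵇ A B ≡ true → A ⊆ B
sub⇒⊆ {A = A} {B} h {x} x∈ = lookup⇒[]= x B (subᵇ-lookup A B x h ([]=⇒lookup x∈))

subᵇ-size : ∀ {n} (A B : Subset n) → subᵇ A B ≡ true → ∣ A ∣ ≤ ∣ B ∣
subᵇ-size A B h = ≤-trans (m≤m+n ∣ A ∣ ∣ diff B A ∣) (≤-reflexive (diff-size B A h))

minus-del : ∀ {n} (T : Subset n) w → T - w ≡ del w T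
minus-del (b ∷ T) zero    = cong (false ∷_) (minus-⊥ T)
  where
  minus-⊥ : ∀ {n} (T : Subset n) → T ─ ⊥ ≡ T
  minus-⊥ []          = refl
  minus-⊥ (true ∷ T)  = cong (true ∷_) (minus-⊥ T)
  minus-⊥ (false ∷ T) = cong (false ∷_) (minus-⊥ T)
minus-del (b ∷ T) (suc w) = cong (b ∷_) (minus-del T w)

shrink : ∀ {n} (P : Subset n → Bool) → Closed P → ∀ e d G → P G ≡ true → ∣ G ∣ ≡ e + d → Σ (Subset n) λ G′ → P G′ ≡ true × ∣ G′ ∣ ≡ d
shrink P cl zero    d G p s = G , p , s
shrink P cl (suc e) d G p s = let (v , v∈) = size-pos G s in
  shrink P cl e d (del v G) (cl v (del v G) (subst (λ S → P S ≡ true) (sym (ins-del v G v∈)) p)) (suc-injective (trans (size-del v G v∈) s))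

-- The next label is a cone point of the j-fold link, so faces of this link either avoid it or arise
-- from smaller ones by adding it. Solved for the term with the larger j, this recursion computes γ
-- from face numbers alone.
gam-cone : ∀ j k {n} {Y : Subset (k + n) → Bool} → Coned k Y → ∀ p → suc p + suc j ≤ k →
  gam j k (suc p) Y ≡ gam (suc j) k (suc p) Y + gam (suc j) k p Y
gam-cone zero    (suc k) C p le = fc-cone k C p (≤-pred (subst (_≤ suc k) (+-comm (suc p) 1) le))
gam-cone (suc j) (suc k) C p le = gam-cone j k (proj₂ (proj₂ C)) p (≤-pred (subst (_≤ suc k) (+-suc (suc p) (suc j)) le))

gam-cone-0 : ∀ j k {n} {Y : Subset (k + n) → Bool} → Coned k Y → suc j ≤ k → gam j k 0 Y ≡ gam (suc j) k 0 Y
gam-cone-0 zero    (suc k) C le = fc-cone-0 k C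
gam-cone-0 (suc j) (suc k) C le = gam-cone-0 j k (proj₂ (proj₂ C)) (≤-pred le)

-- Faces of the skeleton: uniform families and shiftedness

module Skeleton {n : ℕ} (Δ : SimplicialComplex n) (d : ℕ) where

  L : Subset n → Bool
  L = skeletonᵇ Δ d

  face-sub : ∀ {A B} → subᵇ A B ≡ true → face Δ B ≡ true → face Δ A ≡ true
  face-sub s = closed Δ (sub⇒⊆ s)

  L-elim : ∀ T → L T ≡ true → face Δ T ≡ true × ∣ T ∣ ≤ d
  L-elim T l = let (f , s) = ∧-true l in f , ≤ᵇ-true s

  L-intro : ∀ T → face Δ T ≡ true → ∣ T ∣ ≤ d → L T ≡ true
  L-intro T f s = ∧-intro f (≤ᵇ-intro s)

  L-sub : ∀ A B → subᵇ A B ≡ true → L B ≡ true → L A ≡ true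
  L-sub A B s l = let (f , le) = L-elim B l in L-intro A (face-sub s f) (≤-trans (subᵇ-size A B s) le)

  L-closed : ∀ v T → L (ins v T) ≡ true → L T ≡ true
  L-closed v T = L-sub T (ins v T) (subᵇ-ins-self v T)

  L-top : (Σ (Subset n) λ σ → σ ∈Δ Δ × d ≤ ∣ σ ∣) → Σ (Subset n) λ G → L G ≡ true × ∣ G ∣ ≡ d
  L-top (σ , f , le) = let (G , g , e) = shrink (face Δ) (λ v T → face-sub (subᵇ-ins-self v T)) (∣ σ ∣ ∸ d) d σ f (sym (m∸n+n≡m le)) in
    G , L-intro G g (≤-reflexive e) , e

  faces-face : ∀ p → p ≤ d → ∀ S → faces L p S ≡ face Δ S ∧ (∣ S ∣ ≡ᵇ p)
  faces-face p le S = bool-ext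
    (λ h → let (l , e) = ∧-true h in ∧-intro (proj₁ (L-elim S l)) e)
    (λ h → let (f , e) = ∧-true h in ∧-intro (L-intro S f (subst (_≤ d) (sym (≡ᵇ-true e)) le)) e)

  module Pure (pure : ∀ C → L C ≡ true → Σ (Subset n) λ G → L G ≡ true × ∣ G ∣ ≡ d × subᵇ C G ≡ true) where

    new-vertex : ∀ C → L C ≡ true → ∣ C ∣ < d → ∃ λ w → lookup C w ≡ false × L (ins w C) ≡ true
    new-vertex C l lt = let (G , lG , eG , s) = pure C l
                            (w , w∈) = size-pos (diff G C) {d ∸ suc ∣ C ∣} (+-cancelˡ-≡ ∣ C ∣ _ _ (trans (trans (diff-size G C s) eG)
                                         (sym (trans (+-suc ∣ C ∣ _) (m+[n∸m]≡n lt)))))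
                            (w∈G , w∉C) = diff-lookup G C w w∈
                        in w , w∉C , L-sub (ins w C) G (subᵇ-ins w C G s w∈G) lG

    above : List (Subset n) → ℕ → Subset n → Bool
    above 𝒜 i U = faces L i U ∧ anyᵇ (λ T → subᵇ T U) 𝒜

    module Uniform (r : ℕ) (2r≤d : r + r ≤ d) (𝒜 : List (Subset n)) (sperner : Sperner 𝒜)
      (in-L : ∀ {A} → A ∈ 𝒜 → L A ≡ true × ∣ A ∣ ≤ r) where

      below : ℕ → Subset n → Bool
      below i S = mem 𝒜 S ∧ (∣ S ∣ ≤ᵇ i)

      raised : ℕ → Subset n → Bool
      raised i U = faces L (suc i) U ∧ anyᵇ (λ T → subᵇ T U ∧ (∣ T ∣ ≤ᵇ i)) 𝒜

      -- A face of size i has at least d - i > i covers, each of which covers only i + 1 sets.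
      raised-≥ : ∀ i → suc i ≤ r → cnt (above 𝒜 i) ≤ cnt (raised i)
      raised-≥ i i<r = double-count i (above 𝒜 i) (raised i) up λ U h → ≡ᵇ-true (proj₂ (∧-true {L U} (proj₁ (∧-true h))))
        where
        up : ∀ T → above 𝒜 i T ≡ true → suc i ≤ sumFin (λ w → toℕᵇ (not (lookup T w) ∧ raised i (ins w T)))
        up T h = ≤-trans enough (≤-trans (≤-reflexive (sym (sumFin-size (diff G T)))) (sumFin-mono {f = λ w → toℕᵇ (lookup (diff G T) w)} {g = λ w → toℕᵇ (not (lookup T w) ∧ raised i (ins w T))} λ w → toℕᵇ-mono (fits w)))
          where
          lT : L T ≡ true
          lT = proj₁ (∧-true (proj₁ (∧-true h)))
          eT : ∣ T ∣ ≡ i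
          eT = ≡ᵇ-true (proj₂ (∧-true {L T} (proj₁ (∧-true h))))
          G : Subset n
          G = proj₁ (pure T lT)
          props : L G ≡ true × ∣ G ∣ ≡ d × subᵇ T G ≡ true
          props = proj₂ (pure T lT)
          enough : suc i ≤ ∣ diff G T ∣
          enough = +-cancelˡ-≤ i (suc i) _ (≤-trans (+-mono-≤ (<⇒≤ i<r) i<r) (≤-trans 2r≤d (≤-reflexive (sym (trans (trans (cong (_+ ∣ diff G T ∣) (sym eT)) (diff-size G T (proj₂ (proj₂ props)))) (proj₁ (proj₂ props)))))))
          fits : ∀ w → lookup (diff G T) w ≡ true → not (lookup T w) ∧ raised i (ins w T) ≡ true
          fits w w∈ = let (w∈G , w∉T) = diff-lookup G T w w∈
                          (A , A∈ , A⊆T) = anyᵇ-true _ 𝒜 (proj₂ (∧-true {faces L i T} h))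
                      in ∧-intro (not-intro w∉T) (∧-intro (∧-intro (L-sub (ins w T) G (subᵇ-ins w T G (proj₂ (proj₂ props)) w∈G) (proj₁ props)) (≡ᵇ-intro (trans (size-ins w T w∉T) (cong suc eT))))
                           (anyᵇ-intro _ A∈ (∧-intro (subᵇ-intro A (ins w T) λ u u∈ → lookup-ins-mono w u T (subᵇ-lookup A T u A⊆T u∈)) (≤ᵇ-intro (≤-trans (subᵇ-size A T A⊆T) (≤-reflexive eT))))))

      member-above : ∀ i S → mem 𝒜 S ≡ true → ∣ S ∣ ≡ i → above 𝒜 i S ≡ true
      member-above i S m e = ∧-intro (∧-intro (proj₁ (in-L S∈)) (≡ᵇ-intro e)) (anyᵇ-intro _ S∈ (subᵇ-refl S))
        where
        S∈ : S ∈ 𝒜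
        S∈ = mem-true 𝒜 S m

      -- Raising the smaller members to size i + 1 never produces a member of that size, as it would
      -- properly contain a smaller member. The raised sets and the members of size i + 1 can
      -- therefore be counted side by side.
      below-≤ : ∀ i → i ≤ r → cnt (below i) ≤ cnt (above 𝒜 i)
      below-≤ zero    _   = cnt-mono λ S h → let (m , s) = ∧-true h in member-above 0 S m (n≤0⇒n≡0 (≤ᵇ-true s))
      below-≤ (suc i) i<r = begin
        cnt (below (suc i))                                              ≡⟨ cnt-split (λ S → ∣ S ∣ ≤ᵇ i) (below (suc i)) ⟩
        cnt (λ S → (∣ S ∣ ≤ᵇ i) ∧ below (suc i) S) + cnt new             ≤⟨ +-monoˡ-≤ (cnt new) (cnt-mono {P = λ S → (∣ S ∣ ≤ᵇ i) ∧ below (suc i) S} {below i} λ S h → ∧-intro (proj₁ (∧-true {mem 𝒜 S} (proj₂ (∧-true {∣ S ∣ ≤ᵇ i} h)))) (proj₁ (∧-true {∣ S ∣ ≤ᵇ i} h))) ⟩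
        cnt (below i) + cnt new                                          ≤⟨ +-monoˡ-≤ (cnt new) (≤-trans (below-≤ i (<⇒≤ i<r)) (raised-≥ i i<r)) ⟩
        cnt (raised i) + cnt new                                         ≤⟨ cnt-disjoint raised⇒above new⇒above fresh ⟩
        cnt (above 𝒜 (suc i))                                            ∎
        where
        open ≤-Reasoning
        new : Subset n → Bool
        new S = not (∣ S ∣ ≤ᵇ i) ∧ below (suc i) S
        new-size : ∀ S → new S ≡ true → mem 𝒜 S ≡ true × ∣ S ∣ ≡ suc i
        new-size S h = let (ns , b) = ∧-true h ; (m , s) = ∧-true b in m , ≤-antisym (≤ᵇ-true s) (≰⇒> λ le → true≢false (≤ᵇ-intro le) (not-true ns))
        raised⇒above : ∀ U → raised i U ≡ true → above 𝒜 (suc i) U ≡ true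
        raised⇒above U h = let (f , a) = ∧-true h ; (A , A∈ , s) = anyᵇ-true _ 𝒜 a in ∧-intro f (anyᵇ-intro _ A∈ (proj₁ (∧-true s)))
        new⇒above : ∀ S → new S ≡ true → above 𝒜 (suc i) S ≡ true
        new⇒above S h = let (m , e) = new-size S h in member-above (suc i) S m e
        fresh : ∀ U → raised i U ≡ true → new U ≡ false
        fresh U h = ¬true⇒false λ t → let (m , e) = new-size U t
                                          (A , A∈ , s) = anyᵇ-true _ 𝒜 (proj₂ (∧-true {faces L (suc i) U} h))
                                          (A⊆U , sA) = ∧-true s
                                      in <-irrefl refl (subst (λ k → k ≤ i) (trans (cong ∣_∣ (sperner A∈ (mem-true 𝒜 U m) (sub⇒⊆ A⊆U))) e) (≤ᵇ-true sA))

      length-≤-above : Unique 𝒜 → length 𝒜 ≤ cnt (above 𝒜 r)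
      length-≤-above u = ≤-trans (length-≤-cnt 𝒜 u) (≤-trans (cnt-mono λ S m → ∧-intro m (≤ᵇ-intro (proj₂ (in-L (mem-true 𝒜 S m))))) (below-≤ r ≤-refl))

    module Shifting {r : ℕ} (2r≤d : r + r ≤ d) (v : Fin r → Fin n) (shifted : Shifted Δ v) where

      -- By purity some vertex can be added, and by shiftedness it may be exchanged for the next vᵢ.
      add-vertices : ∀ S → L S ≡ true → ∣ S ∣ < r → ∀ j → j ≤ r →
        Σ (Subset n) λ T → L T ≡ true × subᵇ S T ≡ true × (∀ i → toℕ i < j → lookup T (v i) ≡ true) × ∣ T ∣ ≤ ∣ S ∣ + j
      add-vertices S l lt zero    _   = S , l , subᵇ-refl S , (λ _ ()) , m≤m+n ∣ S ∣ 0
      add-vertices S l lt (suc j) j<r = next (add-vertices S l lt j (<⇒≤ j<r))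
        where
        i₀ : Fin r
        i₀ = Data.Fin.fromℕ< j<r
        toℕ-i₀ : toℕ i₀ ≡ j
        toℕ-i₀ = Fin.toℕ-fromℕ< j<r
        next : (Σ (Subset n) λ T → L T ≡ true × subᵇ S T ≡ true × (∀ i → toℕ i < j → lookup T (v i) ≡ true) × ∣ T ∣ ≤ ∣ S ∣ + j) →
          Σ (Subset n) λ T → L T ≡ true × subᵇ S T ≡ true × (∀ i → toℕ i < suc j → lookup T (v i) ≡ true) × ∣ T ∣ ≤ ∣ S ∣ + suc j
        next (T , lT , S⊆T , has , sz) = ins (v i₀) T , lift , subᵇ-intro S _ (λ u u∈ → lookup-ins-mono (v i₀) u T (subᵇ-lookup S T u S⊆T u∈)) , has′ ,
            ≤-trans (size-ins-≤ (v i₀) T) (≤-trans (s≤s sz) (≤-reflexive (sym (+-suc ∣ S ∣ j))))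
          where
          has′ : ∀ i → toℕ i < suc j → lookup (ins (v i₀) T) (v i) ≡ true
          has′ i le = [ (λ lt → lookup-ins-mono (v i₀) (v i) T (has i lt))
                      , (λ e → subst (λ k → lookup (ins (v i₀) T) (v k) ≡ true) (Fin.toℕ-injective (trans toℕ-i₀ (sym e))) (lookup-ins (v i₀) T)) ]′ (m≤n⇒m<n∨m≡n (≤-pred le))
          -- Fewer than r elements of S and fewer than r vertices added so far leave room below d,
          -- because 2r is at most d.
          T<d : ∣ T ∣ < d
          T<d = ≤-trans (s≤s sz) (≤-trans (+-mono-≤ lt (<⇒≤ j<r)) 2r≤d)
          exchange : lookup T (v i₀) ≡ false → (∃ λ w → lookup T w ≡ false × L (ins w T) ≡ true) → L (ins (v i₀) T) ≡ true
          exchange v∉T (w , w∉T , lw) = by (w Fin.≟ v i₀)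
            where
            by : Dec (w ≡ v i₀) → L (ins (v i₀) T) ≡ true
            by (yes e) = subst (λ u → L (ins u T) ≡ true) e lw
            by (no ne) = L-intro (ins (v i₀) T) (subst (λ U → face Δ U ≡ true) (trans (∪-⁅⁆ _ (v i₀)) (cong (ins (v i₀)) (trans (minus-del (ins w T) w) (del-ins w T w∉T))))
                (shifted i₀ w differs (ins w T) (proj₁ (L-elim (ins w T) lw)) (lookup-ins w T) (trans (lookup-ins-≢ T (ne ∘ sym)) v∉T)))
                (≤-trans (≤-reflexive (size-ins (v i₀) T v∉T)) T<d)
              where
              -- The earlier vertices already lie in T and w does not, so w is none of them and
              -- shiftedness permits the exchange.
              differs : ∀ i → Data.Fin._≤_ i i₀ → w ≢ v i
              differs i le e = [ (λ lt → true≢false (has i (subst (toℕ i <_) toℕ-i₀ lt)) (trans (cong (lookup T) (sym e)) w∉T))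
                               , (λ eq → ne (trans e (cong v (Fin.toℕ-injective eq)))) ]′ (m≤n⇒m<n∨m≡n le)
          lift : L (ins (v i₀) T) ≡ true
          lift = [ (λ v∈T → subst (λ U → L U ≡ true) (sym (ins-id (v i₀) T v∈T)) lT) , (λ v∉T → exchange v∉T (new-vertex T lT T<d)) ]′ (decᵇ (lookup T (v i₀)))

      cone-vertex : ∀ i S → L S ≡ true → ∣ S ∣ < r → L (ins (v i) S) ≡ true
      cone-vertex i S l lt = let (T , lT , S⊆T , has , _) = add-vertices S l lt r ≤-refl in
        L-sub (ins (v i) S) T (subᵇ-ins (v i) S T S⊆T (has i (Fin.toℕ<n i))) lT

      avoiding : List (Fin n) → ℕ → Subset n → Bool
      avoiding ws p S = faces L p S ∧ not (anyᵇ (lookup S) ws)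

      avoiding-0 : ∀ w ws → cnt (avoiding ws 0) ≡ cnt (avoiding (w List.∷ ws) 0)
      avoiding-0 w ws = cnt-cong λ S → same S (decᵇ (lookup S w))
        where
        same : ∀ S → lookup S w ≡ true ⊎ lookup S w ≡ false → avoiding ws 0 S ≡ avoiding (w List.∷ ws) 0 S
        same S (inj₂ f) = cong (λ b → faces L 0 S ∧ not (b ∨ anyᵇ (lookup S) ws)) (sym f)
        same S (inj₁ t) = trans (cong (_∧ _) none) (sym (cong (_∧ _) none))
          where
          none : faces L 0 S ≡ false
          none = ¬true⇒false λ h → true≢false t (trans (cong (λ U → lookup U w) (size-0 S (≡ᵇ-true (proj₂ (∧-true {L S} h))))) (lookup-replicate w false))

      -- The counterpart of `gam-cone` on the side of Δ: removing the cone point w matches the faces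
      -- that contain it with the smaller faces that avoid it.
      avoiding-suc : ∀ w ws p → suc p ≤ r → (∀ S → L S ≡ true → ∣ S ∣ < r → L (ins w S) ≡ true) → All (w ≢_) ws →
        cnt (avoiding ws (suc p)) ≡ cnt (avoiding (w List.∷ ws) (suc p)) + cnt (avoiding (w List.∷ ws) p)
      avoiding-suc w ws p p<r cone w∉ = trans (cnt-split (λ S → lookup S w) (avoiding ws (suc p))) (trans (+-comm (cnt λ S → lookup S w ∧ avoiding ws (suc p) S) _) (cong₂ _+_
        (cnt-cong λ S → swap (lookup S w) (faces L (suc p) S) (anyᵇ (lookup S) ws))
        (trans (cnt-toggle w (avoiding ws (suc p))) (cnt-cong λ S → toggled S (decᵇ (lookup S w))))))
        where
        swap : ∀ a f b → not a ∧ (f ∧ not b) ≡ f ∧ not (a ∨ b)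
        swap true  true  b = refl
        swap true  false b = refl
        swap false f     b = refl
        any-ins : ∀ S ws → All (w ≢_) ws → anyᵇ (lookup (ins w S)) ws ≡ anyᵇ (lookup S) ws
        any-ins S List.[]       _             = refl
        any-ins S (u List.∷ ws) (ne All.∷ h) = cong₂ _∨_ (lookup-ins-≢ S (ne ∘ sym)) (any-ins S ws h)
        toggled : ∀ S → lookup S w ≡ true ⊎ lookup S w ≡ false → not (lookup S w) ∧ avoiding ws (suc p) (ins w S) ≡ avoiding (w List.∷ ws) p S
        toggled S (inj₁ t) = trans (cong (λ b → not b ∧ avoiding ws (suc p) (ins w S)) t) (sym (trans (cong (λ b → faces L p S ∧ not (b ∨ anyᵇ (lookup S) ws)) t) (∧-zeroʳ (faces L p S))))
        toggled S (inj₂ f) = trans (cong (λ b → not b ∧ avoiding ws (suc p) (ins w S)) f) (trans (cong₂ (λ x y → x ∧ not y) faces-ins (any-ins S ws w∉)) (sym (cong (λ b → faces L p S ∧ not (b ∨ anyᵇ (lookup S) ws)) f)))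
          where
          faces-ins : faces L (suc p) (ins w S) ≡ faces L p S
          faces-ins = bool-ext
            (λ h → let (l , e) = ∧-true h in ∧-intro (L-closed w S l) (≡ᵇ-intro (suc-injective (trans (sym (size-ins w S f)) (≡ᵇ-true e)))))
            (λ h → let (l , e) = ∧-true h in ∧-intro (cone S l (subst (λ q → suc q ≤ r) (sym (≡ᵇ-true e)) p<r)) (≡ᵇ-intro (trans (size-ins w S f) (cong suc (≡ᵇ-true e)))))

      -- Both sides obey the same recursion in the excluded vertices and the size, and with nothing
      -- excluded they are face numbers, which are equal by assumption.
      avoiding-gam : ∀ {Y : Subset (r + r + n) → Bool} → Coned (r + r) Y → (∀ p → p ≤ r + r → fc p Y ≡ cnt (faces L p)) →
        ∀ ws → Unique ws → (∀ {w} → w ∈ ws → ∀ S → L S ≡ true → ∣ S ∣ < r → L (ins w S) ≡ true) → length ws ≤ r →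
        ∀ p → p ≤ r → cnt (avoiding ws p) ≡ gam (length ws) (r + r) p Y
      avoiding-gam {Y} C count List.[] _ _ _ p le = trans (cnt-cong λ S → ∧-identityʳ (faces L p S)) (sym (count p (≤-trans le (m≤m+n r r))))
      avoiding-gam {Y} C count (w List.∷ ws) (w∉ AllPairs.∷ u) cone len zero le =
        trans (sym (avoiding-0 w ws)) (trans (avoiding-gam {Y} C count ws u (cone ∘ there) (<⇒≤ len) zero le) (gam-cone-0 (length ws) (r + r) C (≤-trans len (m≤m+n r r))))
      avoiding-gam {Y} C count (w List.∷ ws) (w∉ AllPairs.∷ u) cone len (suc p) le = +-cancelʳ-≡ (cnt (avoiding (w List.∷ ws) p)) _ _
        (trans (sym (avoiding-suc w ws p le (cone (here refl)) w∉))
          (trans (avoiding-gam {Y} C count ws u (cone ∘ there) (<⇒≤ len) (suc p) le)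
            (trans (gam-cone (length ws) (r + r) C p (+-mono-≤ le len))
              (cong (gam (suc (length ws)) (r + r) (suc p) Y +_) (sym (avoiding-gam {Y} C count (w List.∷ ws) (w∉ AllPairs.∷ u) cone len p (<⇒≤ le)))))))

-- The bound for cross-intersecting Sperner families

theorem2p19 : ∀ {c ℓ : Level} (F : Field c ℓ) {n : ℕ} (Δ : SimplicialComplex n)
    (d r : ℕ) → DepthIs F Δ d → 2 ≤ r → 2 * r ≤ d →
    (𝒜 ℬ : List (Subset n)) → FaceFamily Δ r 𝒜 → FaceFamily Δ r ℬ →
    CrossIntersecting 𝒜 ℬ →
    (v : Fin r → Fin n) → Injective _≡_ _≡_ v → Shifted Δ v →
    length 𝒜 + length ℬ ≤ (fCount Δ r + 1) ∸ gammaCount Δ v r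
theorem2p19 {c} {ℓ} F {n} Δ d r (big , CM , _) 2≤r 2r≤d 𝒜 ℬ (u𝒜 , ne𝒜 , sp𝒜 , in𝒜) (uℬ , neℬ , spℬ , inℬ) cross v v-inj shifted =
  decidable-stable (_ ≤? _) (bound >>= λ s → return (conclude s))
  where
  open Skeleton Δ d
  module PC = PureComplex F L L-closed d (λ T l → proj₂ (L-elim T l)) CM (L-top big)
  open Pure (λ C l → PC.extᵇ-elim C (PC.pure ∣ C ∣ C refl l))
  r+r≤d : r + r ≤ d
  r+r≤d = subst (_≤ d) (cong (r +_) (+-identityʳ r)) 2r≤d
  r≤d : r ≤ d
  r≤d = ≤-trans (m≤m+n r r) r+r≤d
  in-L : ∀ {𝒞 : List (Subset n)} → (∀ {A} → A ∈ 𝒞 → A ∈Δ Δ × ∣ A ∣ ≤ r) → ∀ {A} → A ∈ 𝒞 → L A ≡ true × ∣ A ∣ ≤ r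
  in-L h {A} A∈ = let (f , s) = h A∈ in L-intro A f (≤-trans s r≤d) , s
  module U𝒜 = Uniform r r+r≤d 𝒜 sp𝒜 (in-L in𝒜)
  module Uℬ = Uniform r r+r≤d ℬ spℬ (in-L inℬ)
  module Sh = Shifting r+r≤d v shifted
  module AS = AlgebraicShift PC.Pol.polyRing PC.Pol.1≉0 PC.Pol.dichotomy PC.Pol.point PC.Pol.point-regular L L-closed d PC.exact
  -- With 2r cone labels, two r-sets meet exactly if their union has fewer elements than there are
  -- cone labels, which is the form that the counting bound takes.
  module AK = AS.Shifted (r + r) r+r≤d
  length-pos : ∀ (𝒞 : List (Subset n)) → 𝒞 ≢ List.[] → 1 ≤ length 𝒞
  length-pos List.[]       ne = ⊥-elim (ne refl)
  length-pos (_ List.∷ _) _  = s≤s z≤n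
  meet : ∀ S U → above 𝒜 r S ≡ true → above ℬ r U ≡ true → disjointᵇ S U ≡ false
  meet S U a b = ¬true⇒false λ dis →
    let (A , A∈ , A⊆S) = anyᵇ-true _ 𝒜 (proj₂ (∧-true {faces L r S} a))
        (B , B∈ , B⊆U) = anyᵇ-true _ ℬ (proj₂ (∧-true {faces L r U} b))
        (x , x∈) = cross A∈ B∈
        (x∈A , x∈B) = x∈p∩q⁻ A B x∈
    in true≢false (subᵇ-lookup A S x A⊆S ([]=⇒lookup x∈A)) (disjoint-lookup x S U dis (subᵇ-lookup B U x B⊆U ([]=⇒lookup x∈B)))
  bound : ¬ ¬ AK.ShiftedBound r (above 𝒜 r) (above ℬ r)
  bound = AK.shiftedBound r refl (above 𝒜 r) (above ℬ r) (λ S h → proj₁ (∧-true h)) (λ S h → proj₁ (∧-true h)) meet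
    (≤-trans (length-pos 𝒜 ne𝒜) (U𝒜.length-≤-above u𝒜)) (≤-trans (length-pos ℬ neℬ) (Uℬ.length-≤-above uℬ))
  ws : List (Fin n)
  ws = List.map v (allFin r)
  ws-length : length ws ≡ r
  ws-length = trans (List.length-map v (allFin r)) (List.length-tabulate id)
  any-map : ∀ S (is : List (Fin r)) → anyᵇ (lookup S) (List.map v is) ≡ anyᵇ (λ i → lookup S (v i)) is
  any-map S List.[]       = refl
  any-map S (i List.∷ is) = cong (lookup S (v i) ∨_) (any-map S is)
  cone : ∀ {w} → w ∈ ws → ∀ S → L S ≡ true → ∣ S ∣ < r → L (ins w S) ≡ true
  cone {w} w∈ S l lt = go (allFin r) w∈
    where
    go : ∀ is → w ∈ List.map v is → L (ins w S) ≡ true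
    go (i List.∷ is) (here refl) = Sh.cone-vertex i S l lt
    go (i List.∷ is) (there w∈)  = go is w∈
  gamma : gammaCount Δ v r ≡ cnt (Sh.avoiding ws r)
  gamma = trans (length-filter-allSubsets λ S → face Δ S ∧ (∣ S ∣ ≡ᵇ r) ∧ not (anyᵇ (λ i → lookup S (v i)) (allFin r))) (cnt-cong λ S → sym (trans (cong₂ (λ f b → f ∧ not b) (faces-face r r≤d S) (any-map S (allFin r))) (∧-assoc (face Δ S) _ _)))
  conclude : AK.ShiftedBound r (above 𝒜 r) (above ℬ r) → length 𝒜 + length ℬ ≤ (fCount Δ r + 1) ∸ gammaCount Δ v r
  conclude (Y , C , count , le) = m+n≤o⇒m≤o∸n (length 𝒜 + length ℬ) (≤-trans
      (+-mono-≤ (+-mono-≤ (U𝒜.length-≤-above u𝒜) (Uℬ.length-≤-above uℬ)) (≤-reflexive γ≡))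
      (≤-trans le (≤-reflexive (cong (_+ 1) f≡))))
    where
    -- The complexes Δ and Y are related only through their face numbers; this is enough, since the
    -- vertices v i act as cone points on all faces with fewer than r elements.
    γ≡ : gammaCount Δ v r ≡ gam r (r + r) r Y
    γ≡ = trans gamma (trans (Sh.avoiding-gam {Y} C count ws (Unique.map⁺ v-inj (Unique.allFin⁺ r)) cone (≤-reflexive ws-length) r ≤-refl) (cong (λ k → gam k (r + r) r Y) ws-length))
    f≡ : fc r Y ≡ fCount Δ r
    f≡ = trans (count r (m≤m+n r r)) (sym (trans (length-filter-allSubsets λ S → face Δ S ∧ (∣ S ∣ ≡ᵇ r)) (cnt-cong λ S → sym (faces-face r r≤d S))))
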